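{- Let $n\ge 2$ be even, let $y\in\tilde I^{\mathsf{FPF}}_n$, and let $p,q\in\mathbb Z$ with $p<q=y(p)$. Then $$\sum_{z\in\Pi^-(y,p)}\hat F^{\mathsf{FPF}}_z=\sum_{z\in\Pi^+(y,q)}\hat F^{\mathsf{FPF}}_z.$$
   Context: The affine symmetric group $\tilde S_n$ is the group of bijections $\pi:\mathbb Z\to\mathbb Z$ with $\pi(i+n)=\pi(i)+n$ for all $i$ and $\pi(1)+\dots+\pi(n)=1+\dots+n$. $s_i$ ($i\in\mathbb Z$) interchanges $i+kn,i+1+kn$ for all $k$ and fixes other integers; $\tilde S_n$ is a Coxeter group with generators $s_1,\dots,s_n$ and length $\ell$. For $i<j$, $j\not\equiv i\pmod n$, $t_{ij}$ exchanges $i+kn$ and $j+kn$ for all $k$ and fixes other integers (these are the reflections). $\tilde I^{\mathsf{FPF}}_n$ is the set of $z\in\tilde S_n$ with $z(z(i))=i\ne z(i)$ for all $i$. Let $\Theta^+=s_1s_3\cdots s_{n-1}$, $\Theta^-=s_2s_4\cdots s_n$; every $z\in\tilde I^{\mathsf{FPF}}_n$ is conjugate in $\tilde S_n$ to exactly one $\Theta\in\{\Theta^+,\Theta^-\}$, and $\mathcal A^{\mathsf{FPF}}(z)$ is the set of minimal-length elements of $\{w\in\tilde S_n: w^{ -1}\Theta w=z\}$. Let $\hat\ell_{\mathsf{FPF}}(z)=\frac12(\ell(z)-\frac n2)$. Write $y\lessdot_F z$ if $z=tyt$ for some reflection $t$ and $\hat\ell_{\mathsf{FPF}}(z)=\hat\ell_{\mathsf{FPF}}(y)+1$.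 For $r\in\mathbb Z$: $\Pi^-(y,r)=\{z\in\tilde I^{\mathsf{FPF}}_n: y\lessdot_F z=t_{ir}yt_{ir}\text{ for some } i<r \text{ with } i\notin\{r,y(r)\}+n\mathbb Z\}$, $\Pi^+(y,r)=\{z\in\tilde I^{\mathsf{FPF}}_n: y\lessdot_F z=t_{rj}yt_{rj}\text{ for some } j>r \text{ with } j\notin\{r,y(r)\}+n\mathbb Z\}$. An element $\pi\in\tilde S_n$ is cyclically decreasing if it has a reduced expression $s_{i_1}\cdots s_{i_l}$ with $s_{i_j+1}\ne s_{i_k}$ for all $1\le j<k\le l$. The affine Stanley symmetric function is $F_\pi=\sum x_1^{\ell(\pi^1)}x_2^{\ell(\pi^2)}\cdots$, summed over all factorizations $\pi=\pi^1\pi^2\cdots$ into countably many (possibly identity) cyclically decreasing factors with $\ell(\pi)=\sum_k\ell(\pi^k)$. Finally $\hat F^{\mathsf{FPF}}_z=\sum_{\pi\in\mathcal A^{\mathsf{FPF}}(z)}F_\pi$. -}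

module Defs where

open import Data.Nat as ℕ using (ℕ; zero; suc)
open import Data.Nat.Divisibility as ℕD using (_∣?_)
open import Data.Nat.DivMod using (_/_)
open import Data.Integer as ℤ using (ℤ; +_; _+_; _-_; _<_; _≤_; ∣_∣)
open import Data.List as L using (List; []; _∷_; length; map; upTo; foldr)
open import Data.Nat.ListAction using (sum)
open import Data.List.Relation.Unary.All using (All)
open import Data.List.Relation.Unary.Any using (Any)
open import Data.List.Relation.Unary.AllPairs using (AllPairs)
open import Data.List.Relation.Binary.Pointwise using (Pointwise)
open import Data.Product using (Σ; ∃; _×_; _,_)
open import Data.Sum using (_⊎_)
open import Function using (_∘_; id)
open import Relation.Nullary using (¬_; yes; no)
open import Relation.Binary.PropositionalEquality using (_≡_; _≢_; _≗_)

-- Affine permutations are represented as functions ℤ → ℤ; products are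
-- compositions (π σ)(i) = π (σ i).  Equality of permutations is pointwise (_≗_).

_≡[_]_ : ℤ → ℕ → ℤ → Set
i ≡[ n ] j = n ℕD.∣ ∣ i - j ∣

sumℤ : List ℤ → ℤ
sumℤ = foldr _+_ (+ 0)

oneTo : ℕ → List ℤ
oneTo n = map (λ k → + suc k) (upTo n)

IsAffPerm : ℕ → (ℤ → ℤ) → Set
IsAffPerm n f =
  (∀ i → f (i + + n) ≡ f i + + n)
  × (∃ λ (g : ℤ → ℤ) → (∀ i → g (f i) ≡ i) × (∀ i → f (g i) ≡ i))
  × (sumℤ (map f (oneTo n)) ≡ sumℤ (oneTo n))

t : ℕ → ℤ → ℤ → ℤ → ℤ
t n i j x with n ∣? ∣ x - i ∣
... | yes _ = x + (j - i)
... | no _ with n ∣? ∣ x - j ∣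
...   | yes _ = x - (j - i)
...   | no _ = x

s : ℕ → ℤ → ℤ → ℤ
s n i = t n i (i + + 1)

evalWord : ℕ → List ℤ → ℤ → ℤ
evalWord n [] = id
evalWord n (i ∷ ws) = s n i ∘ evalWord n ws

IsGenWord : ℕ → List ℤ → Set
IsGenWord n ws = All (λ i → (+ 1 ≤ i) × (i ≤ + n)) ws

Len : ℕ → (ℤ → ℤ) → ℕ → Set
Len n π k =
  (∃ λ ws → IsGenWord n ws × evalWord n ws ≗ π × length ws ≡ k)
  × (∀ ws → IsGenWord n ws → evalWord n ws ≗ π → k ℕ.≤ length ws)

IsFPF : ℕ → (ℤ → ℤ) → Set
IsFPF n z = IsAffPerm n z × (∀ i → z (z i) ≡ i) × (∀ i → z i ≢ i)

Θ⁺ : ℕ → ℤ → ℤ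
Θ⁺ n = evalWord n (map (λ k → + suc (2 ℕ.* k)) (upTo (n / 2)))

Θ⁻ : ℕ → ℤ → ℤ
Θ⁻ n = evalWord n (map (λ k → + (2 ℕ.* suc k)) (upTo (n / 2)))

-- w⁻¹ Θ w = z, written as Θ w = w z (w a bijection)
Conj : ℕ → (ℤ → ℤ) → (ℤ → ℤ) → (ℤ → ℤ) → Set
Conj n Θ w z = IsAffPerm n w × (Θ ∘ w ≗ w ∘ z)

IsAtom : ℕ → (ℤ → ℤ) → (ℤ → ℤ) → Set
IsAtom n z w = ∃ λ Θ → ((Θ ≗ Θ⁺ n) ⊎ (Θ ≗ Θ⁻ n))
  × Conj n Θ w z
  × (∀ v → Conj n Θ v z → ∀ k m → Len n w k → Len n v m → k ℕ.≤ m)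

-- y ⋖_F z = t y t  with t = t_{ab}; ℓ̂_FPF(z) = ℓ̂_FPF(y) + 1 ⇔ ℓ(z) = ℓ(y) + 2
CoversVia : ℕ → (ℤ → ℤ) → (ℤ → ℤ) → ℤ → ℤ → Set
CoversVia n y z a b =
  (z ≗ t n a b ∘ y ∘ t n a b)
  × (∀ k m → Len n y k → Len n z m → m ≡ k ℕ.+ 2)

Πm : ℕ → (ℤ → ℤ) → ℤ → (ℤ → ℤ) → Set
Πm n y r z = IsFPF n z × ∃ λ i → (i < r) × ¬ (i ≡[ n ] r) × ¬ (i ≡[ n ] y r)
  × CoversVia n y z i r

Πp : ℕ → (ℤ → ℤ) → ℤ → (ℤ → ℤ) → Set
Πp n y r z = IsFPF n z × ∃ λ j → (r < j) × ¬ (j ≡[ n ] r) × ¬ (j ≡[ n ] y r)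
  × CoversVia n y z r j

CycDec : ℕ → (ℤ → ℤ) → Set
CycDec n π = ∃ λ ws → IsGenWord n ws × evalWord n ws ≗ π × Len n π (length ws)
  × AllPairs (λ a b → ¬ (s n (a + + 1) ≗ s n b)) ws

product : List (ℤ → ℤ) → ℤ → ℤ
product = foldr (λ f g → f ∘ g) id

-- Factorizations π = π¹ π² ⋯ π^m (followed by identity factors) contributing to
-- the monomial x₁^{a₁} ⋯ x_m^{a_m}: ℓ(π^k) = a_k, Σ a_k = ℓ(π).
IsFactorization : ℕ → (ℤ → ℤ) → List ℕ → List (ℤ → ℤ) → Set
IsFactorization n π a fs =
  Pointwise (λ f k → CycDec n f × Len n f k) fs a
  × product fs ≗ π
  × Len n π (sum a)

-- Terms of the coefficient of x^a in Σ_{z} F̂^FPF_z over {z : P z}: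
-- triples (z , π , (π¹,…,π^m)) with P z, π ∈ 𝒜^FPF(z), and a factorization of π.
Triple : Set
Triple = (ℤ → ℤ) × (ℤ → ℤ) × List (ℤ → ℤ)

_≈T_ : Triple → Triple → Set
(z , π , fs) ≈T (z' , π' , fs') = (z ≗ z') × (π ≗ π') × Pointwise _≗_ fs fs'

CoeffTerm : ℕ → ((ℤ → ℤ) → Set) → List ℕ → Triple → Set
CoeffTerm n P a (z , π , fs) = P z × IsAtom n z π × IsFactorization n π a fs

HasCard : (Triple → Set) → ℕ → Set
HasCard P N = ∃ λ xs → length xs ≡ N × All P xs
  × AllPairs (λ u v → ¬ (u ≈T v)) xs
  × (∀ x → P x → Any (x ≈T_) xs)

{-# OPTIONS --safe #-}
-- Write an affine factorization of an atom of z as a list of proper subsets of ℤ/n (the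
-- supports of its cyclically decreasing factors), hence as a word which is a shortest w with
-- w⁻¹Θw = z.  If z covers y, exactly one letter c of this word can be deleted so that a
-- shortest word for y remains, and z = t y t for t = t_{ij}, where (i , j) is the preimage of
-- (c , c + 1) under the letters to the right of c.  The terms of Π⁺(y,q) are those with
-- i ∈ {p,q} + nℤ, the terms of Π⁻(y,p) those with j ∈ {p,q} + nℤ.
--
-- Fix the factorization left after the deletion and let c vary in one factor, a subset A of
-- ℤ/n.  The product of A sends each position either down by one (along A) or up to the next
-- generator missing from A; so each missing c has the same left end i as the right end j of
-- another missing generator.  Hence left ends and right ends in {p,q} + nℤ are equally
-- numerous among all insertions.  Insertions with both ends in this set cancel.  If an
-- insertion does not give a shortest word, then by the exchange property exactly one other
-- letter can be deleted to reach y, with the two ends reversed, so these cancel as well.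
module Submission where

open import Data.Nat as ℕ using (ℕ; zero; suc)

-- An involution z covering y does not determine the pair (i , j): t_{ij} y t_{ij} is unchanged if
-- (i , j) is shifted by a multiple of n, reversed, or replaced by (y i , y j). Hence ends are only
-- tested for membership in {p,q} + nℤ, a set stable under y. A pair with exactly one end in it
-- automatically satisfies the condition i ∉ {r, y(r)} + nℤ.
--
-- The exchange property for involutions rests on Θ moving every integer by exactly one: on pairs
-- that are neither congruent nor matched by Θ it keeps the order, so a descent of w⁻¹Θw at such a
-- pair comes from an inversion of w. A third deletable letter is impossible because deleting all
-- three would give y in two letters fewer than its minimum.
--
-- The covering condition enters through ℓ(w⁻¹Θw) = ℓ(Θ) + 2|w| for a shortest word w. Shortest
-- words exist only up to double negation, which suffices for decidable conclusions about numbers;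
-- minimality of a given word is decided by finite search. Cardinalities are compared by injective
-- relations, uniformly in a Bool that exchanges the two sums.

module Reflections (n : ℕ) (2≤n : 2 ℕ.≤ n) where

  open import Defs
  import Data.Nat.Properties as ℕ
  import Data.Nat.Divisibility as ℕD
  import Data.Nat.DivMod as ℕDM
  import Data.Nat.Tactic.RingSolver as ℕR
  open import Data.Bool using (Bool; true; false; not)
  import Data.Bool.Properties as Bool
  open import Data.Vec as V using (Vec)
  import Data.Vec.Properties as V
  open import Data.List.Membership.Propositional using (_∈_)
  import Data.List.Membership.Propositional.Properties as ∈P
  import Data.List.Relation.Unary.AllPairs as AllPairsB
  import Data.List.Relation.Unary.Unique.DecPropositional.Properties as UniqueD
  import Data.Product.Properties as ×
  import Data.List.Relation.Unary.AllPairs.Properties as AllPairs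
  import Data.List.Relation.Unary.Any.Properties as Any
  import Data.List.Relation.Unary.All.Properties as All
  import Data.Integer.Divisibility.Signed as ℤD
  open import Data.Integer as ℤ using (ℤ; +_; -[1+_]; _+_; _-_; -_; _*_; _<_; _≤_; ∣_∣; +<+; +≤+)
  import Data.Integer.Properties as ℤ
  import Data.Integer.DivMod as ℤDM
  open import Data.Integer.Tactic.RingSolver using (solve-∀)
  open import Data.Fin as Fin using (Fin; toℕ; fromℕ<)
  import Data.Fin.Properties as Fin
  open import Data.List as L using (List; []; _∷_; _++_; length; map; reverse)
  import Data.List.Properties as L
  open import Data.List.Relation.Unary.All as All using (All; []; _∷_)
  open import Data.List.Relation.Unary.Any as Any using (Any; here; there)
  open import Data.List.Relation.Unary.AllPairs using (AllPairs; []; _∷_)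
  open import Data.List.Relation.Binary.Pointwise using (Pointwise; []; _∷_)
  open import Data.Nat.ListAction using (sum)
  open import Data.Product using (Σ; ∃; ∃₂; _×_; _,_; proj₁; proj₂)
  open import Data.Sum using (_⊎_; inj₁; inj₂)
  open import Data.Empty using (⊥; ⊥-elim)
  open import Function using (_∘_; id)
  open import Relation.Nullary using (¬_; Dec; yes; no; ¬?; _×-dec_; _⊎-dec_)
  open import Relation.Nullary.Decidable as Dec using (map′)
  open import Relation.Binary.PropositionalEquality
    using (_≡_; _≢_; _≗_; refl; sym; trans; cong; cong₂; subst; subst₂; module ≡-Reasoning)
  open import Relation.Binary.Definitions using (tri<; tri≈; tri>)

  -- Congruence modulo n and the reflections of ℤ.

  N : ℤ
  N = + n

  +-shift : ∀ y c k → y + c + k * N ≡ y + k * N + c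
  +-shift y c k = lem y c k N
    where
    lem : ∀ y c k N → y + c + k * N ≡ y + k * N + c
    lem = solve-∀

  infix 4 _~_
  record _~_ (x y : ℤ) : Set where
    constructor _,_
    field
      turns : ℤ
      shift : x ≡ y + turns * N
  open _~_ public

  ~-refl : ∀ {x} → x ~ x
  ~-refl {x} = + 0 , lem x N
    where
    lem : ∀ x N → x ≡ x + + 0 * N
    lem = solve-∀

  shift-back : ∀ {x y} k → x ≡ y + k * N → y ≡ x + (- k) * N
  shift-back {y = y} k refl = lem y k N
    where
    lem : ∀ y k N → y ≡ (y + k * N) + (- k) * N
    lem = solve-∀

  ~-sym : ∀ {x y} → x ~ y → y ~ x
  ~-sym (k , e) = - k , shift-back k e

  ~-trans : ∀ {x y z} → x ~ y → y ~ z → x ~ z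
  ~-trans {z = z} (k , refl) (l , refl) = l + k , lem z k l N
    where
    lem : ∀ z k l N → z + l * N + k * N ≡ z + (l + k) * N
    lem = solve-∀

  ~-reflexive : ∀ {x y} → x ≡ y → x ~ y
  ~-reflexive refl = ~-refl

  ~-shift : ∀ {x} k → x + k * N ~ x
  ~-shift k = k , refl

  ~-+ : ∀ {x y} c → x ~ y → x + c ~ y + c
  ~-+ {y = y} c (k , refl) = k , sym (+-shift y c k)

  ~⇒∣ : ∀ {x y} → x ~ y → x ≡[ n ] y
  ~⇒∣ {x} {y} (k , e) = ℤD.∣⇒∣ᵤ (ℤD.divides {N} {x - y} k (trans (cong (_- y) e) (lem y k N)))
    where
    lem : ∀ y k N → y + k * N - y ≡ k * N
    lem = solve-∀

  ∣⇒~ : ∀ {x y} → x ≡[ n ] y → x ~ y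
  ∣⇒~ {x} {y} d with ℤD.∣ᵤ⇒∣ {N} {x - y} d
  ... | ℤD.divides k e = k , trans (lem x y) (cong (_+_ y) e)
    where
    lem : ∀ x y → x ≡ y + (x - y)
    lem = solve-∀

  infix 4 _~?_
  opaque
    _~?_ : ∀ x y → Dec (x ~ y)
    x ~? y = map′ ∣⇒~ ~⇒∣ (n ℕD.∣? ∣ x - y ∣)

  small-multiple : ∀ k → ∣ k * N ∣ ℕ.< n → k ≡ + 0
  small-multiple k lt = go ∣ k ∣ refl
    where
    go : ∀ m → ∣ k ∣ ≡ m → k ≡ + 0
    go zero    eq = ℤ.∣i∣≡0⇒i≡0 eq
    go (suc m) eq = ⊥-elim (ℕ.<-irrefl refl (ℕ.<-≤-trans lt
      (subst (n ℕ.≤_) (sym (trans (ℤ.abs-* k N) (cong (ℕ._* n) eq))) (ℕ.m≤m+n n (m ℕ.* n)))))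

  ≁-suc : ∀ {x} → ¬ x ~ x + + 1
  ≁-suc {x} (k , e) = ℕ.<-irrefl refl (ℕ.<-≤-trans 2≤n (ℕD.∣⇒≤
    (subst (ℕD._∣_ n) (cong ∣_∣ eq) (ℕD.divides {n} ∣ k ∣ (ℤ.abs-* k N)))))
    where
    lem : ∀ x k N → k * N ≡ - (x - (x + + 1 + k * N)) - + 1
    lem = solve-∀
    eq : k * N ≡ -[1+ 0 ]
    eq = trans (lem x k N) (trans (cong (λ w → - (x - w) - + 1) (sym e)) (lem₂ x))
      where
      lem₂ : ∀ x → - (x - x) - + 1 ≡ -[1+ 0 ]
      lem₂ = solve-∀

  opaque
    swap : ℤ → ℤ → ℤ → ℤ
    swap = t n

    swap-is-t : ∀ i j → swap i j ≗ t n i j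
    swap-is-t i j x = refl

    swap-at-i : ∀ i j k → swap i j (i + k * N) ≡ j + k * N
    swap-at-i i j k with n ℕD.∣? ∣ i + k * N - i ∣
    ... | yes _ = lem i j k N
      where
      lem : ∀ i j k N → i + k * N + (j - i) ≡ j + k * N
      lem = solve-∀
    ... | no ¬d = ⊥-elim (¬d (~⇒∣ {y = i} (~-shift k)))

    swap-at-j : ∀ {i j} → ¬ i ~ j → ∀ k → swap i j (j + k * N) ≡ i + k * N
    swap-at-j {i} {j} i≁j k with n ℕD.∣? ∣ j + k * N - i ∣
    ... | yes d = ⊥-elim (i≁j (~-trans (~-sym (∣⇒~ d)) (~-shift k)))
    ... | no _ with n ℕD.∣? ∣ j + k * N - j ∣
    ...   | yes _ = lem i j k N
      where
      lem : ∀ i j k N → j + k * N - (j - i) ≡ i + k * N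
      lem = solve-∀
    ...   | no ¬d = ⊥-elim (¬d (~⇒∣ {y = j} (~-shift k)))

    swap-off : ∀ {i j x} → ¬ x ~ i → ¬ x ~ j → swap i j x ≡ x
    swap-off {i} {j} {x} x≁i x≁j with n ℕD.∣? ∣ x - i ∣
    ... | yes d = ⊥-elim (x≁i (∣⇒~ d))
    ... | no _ with n ℕD.∣? ∣ x - j ∣
    ...   | yes d = ⊥-elim (x≁j (∣⇒~ d))
    ...   | no _ = refl

  data SwapView (i j x : ℤ) : Set where
    at-i : ∀ k → x ≡ i + k * N → swap i j x ≡ j + k * N → SwapView i j x
    at-j : ∀ k → x ≡ j + k * N → swap i j x ≡ i + k * N → SwapView i j x
    off  : ¬ x ~ i → ¬ x ~ j → swap i j x ≡ x → SwapView i j x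

  swap-view : ∀ {i j} → ¬ i ~ j → ∀ x → SwapView i j x
  swap-view {i} {j} i≁j x with x ~? i
  ... | yes (k , refl) = at-i k refl (swap-at-i i j k)
  ... | no x≁i with x ~? j
  ...   | yes (k , refl) = at-j k refl (swap-at-j i≁j k)
  ...   | no x≁j = off x≁i x≁j (swap-off x≁i x≁j)

  swap-sym : ∀ {i j} → ¬ i ~ j → swap i j ≗ swap j i
  swap-sym {i} {j} i≁j x with swap-view i≁j x
  ... | at-i k refl e = trans e (sym (swap-at-j (i≁j ∘ ~-sym) k))
  ... | at-j k refl e = trans e (sym (swap-at-i j i k))
  ... | off a b e = trans e (sym (swap-off b a))

  swap-involutive : ∀ {i j} → ¬ i ~ j → ∀ x → swap i j (swap i j x) ≡ x
  swap-involutive {i} {j} i≁j x with swap-view i≁j x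
  ... | at-i k refl e = trans (cong (swap i j) e) (swap-at-j i≁j k)
  ... | at-j k refl e = trans (cong (swap i j) e) (swap-at-i i j k)
  ... | off a b e = trans (cong (swap i j) e) e

  swap-i : ∀ i j → swap i j i ≡ j
  swap-i i j = subst₂ (λ a b → swap i j a ≡ b) (sym (shift (~-refl {i}))) (sym (shift (~-refl {j}))) (swap-at-i i j (+ 0))

  swap-j : ∀ {i j} → ¬ i ~ j → swap i j j ≡ i
  swap-j {i} {j} i≁j = subst₂ (λ a b → swap i j a ≡ b) (sym (shift (~-refl {j}))) (sym (shift (~-refl {i}))) (swap-at-j i≁j (+ 0))

  -- Periodic injections of ℤ.

  record Affine (f : ℤ → ℤ) : Set where
    field
      periodic  : ∀ x k → f (x + k * N) ≡ f x + k * N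
      injective : ∀ {x y} → f x ≡ f y → x ≡ y

    ~-cong : ∀ {x y} → x ~ y → f x ~ f y
    ~-cong {y = y} (k , refl) = k , periodic y k

    ~-cancel : ∀ {x y} → f x ~ f y → x ~ y
    ~-cancel {y = y} (k , e) = k , injective (trans e (sym (periodic y k)))

    ≁-cong : ∀ {x y} → ¬ x ~ y → ¬ f x ~ f y
    ≁-cong x≁y = x≁y ∘ ~-cancel

    -- The identity f t_{ij} f⁻¹ = t_{f(i) f(j)}, phrased without an inverse because `Affine`
    -- carries none.
    conj-swap : ∀ {i j} → ¬ i ~ j → ∀ x → f (swap i j x) ≡ swap (f i) (f j) (f x)
    conj-swap {i} {j} i≁j x with swap-view i≁j x
    ... | at-i k refl e = trans (cong f e) (trans (periodic j k)
            (sym (trans (cong (swap (f i) (f j)) (periodic i k)) (swap-at-i (f i) (f j) k))))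
    ... | at-j k refl e = trans (cong f e) (trans (periodic i k)
            (sym (trans (cong (swap (f i) (f j)) (periodic j k)) (swap-at-j (≁-cong i≁j) k))))
    ... | off a b e = trans (cong f e) (sym (swap-off (≁-cong a) (≁-cong b)))

  open Affine public

  swap-affine : ∀ {i j} → ¬ i ~ j → Affine (swap i j)
  swap-affine {i} {j} i≁j .injective {x} {y} e =
    trans (sym (swap-involutive i≁j x)) (trans (cong (swap i j) e) (swap-involutive i≁j y))
  swap-affine {i} {j} i≁j .periodic x k with swap-view i≁j x
  ... | at-i l refl e = trans (cong (swap i j) (lem i k l N)) (trans (swap-at-i i j (l + k))
          (sym (trans (cong (_+ k * N) e) (lem j k l N))))
    where
    lem : ∀ i k l N → i + l * N + k * N ≡ i + (l + k) * N
    lem = solve-∀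
  ... | at-j l refl e = trans (cong (swap i j) (lem j k l N)) (trans (swap-at-j i≁j (l + k))
          (sym (trans (cong (_+ k * N) e) (lem i k l N))))
    where
    lem : ∀ i k l N → i + l * N + k * N ≡ i + (l + k) * N
    lem = solve-∀
  ... | off a b e = trans (swap-off (a ∘ ~-trans (~-sym (~-shift k))) (b ∘ ~-trans (~-sym (~-shift k))))
          (cong (_+ k * N) (sym e))

  ∘-affine : ∀ {f g} → Affine f → Affine g → Affine (f ∘ g)
  ∘-affine {f} {g} F G .periodic x k = trans (cong f (periodic G x k)) (periodic F (g x) k)
  ∘-affine F G .injective e = injective G (injective F e)

  id-affine : Affine id
  id-affine .periodic _ _ = refl
  id-affine .injective e = e

  ≗-affine : ∀ {f g} → f ≗ g → Affine f → Affine g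
  ≗-affine e F .periodic x k = trans (sym (e _)) (trans (periodic F x k) (cong (_+ k * N) (e x)))
  ≗-affine e F .injective {x} {y} p = injective F (trans (e x) (trans p (sym (e y))))

  swap-shift : ∀ {i j} → ¬ i ~ j → ∀ k → swap (i + k * N) (j + k * N) ≗ swap i j
  swap-shift {i} {j} i≁j k x with swap-view i≁j x
  ... | at-i l refl e = trans (cong (swap _ _) (lem i k l N)) (trans (swap-at-i (i + k * N) (j + k * N) (l - k))
                          (trans (sym (lem j k l N)) (sym e)))
    where
    lem : ∀ i k l N → i + l * N ≡ i + k * N + (l - k) * N
    lem = solve-∀
  ... | at-j l refl e = trans (cong (swap _ _) (lem j k l N)) (trans (swap-at-j (i≁j ∘ λ p → ~-trans (~-sym (~-shift k)) (~-trans p (~-shift k))) (l - k))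
                          (trans (sym (lem i k l N)) (sym e)))
    where
    lem : ∀ i k l N → i + l * N ≡ i + k * N + (l - k) * N
    lem = solve-∀
  ... | off a b e = trans (swap-off (λ p → a (~-trans p (~-shift k))) (λ p → b (~-trans p (~-shift k)))) (sym e)

  periodic-from-step : ∀ {f} → (∀ x → f (x + N) ≡ f x + N) → ∀ x k → f (x + k * N) ≡ f x + k * N
  periodic-from-step {f} per x (+ m) = nonneg m x
    where
    lem₁ : ∀ x k N → x + (+ 1 + k) * N ≡ x + N + k * N
    lem₁ = solve-∀
    nonneg : ∀ m x → f (x + + m * N) ≡ f x + + m * N
    nonneg zero x = trans (cong f (sym (shift (~-refl {x})))) (shift ~-refl)
    nonneg (suc m) x = begin
      f (x + + suc m * N)   ≡⟨ cong f (lem₁ x (+ m) N) ⟩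
      f (x + N + + m * N)   ≡⟨ nonneg m (x + N) ⟩
      f (x + N) + + m * N   ≡⟨ cong (_+ + m * N) (per x) ⟩
      f x + N + + m * N     ≡⟨ lem₁ (f x) (+ m) N ⟨
      f x + + suc m * N     ∎
      where open ≡-Reasoning
  periodic-from-step {f} per x k@(-[1+ m ]) =
    trans (shift-back (+ suc m) (trans (cong f x≡) (periodic-from-step {f} per (x + k * N) (+ suc m)))) refl
    where
    x≡ : x ≡ x + k * N + + suc m * N
    x≡ = shift-back k refl

  affine-from-perm : ∀ {f} → IsAffPerm n f → Affine f
  affine-from-perm {f} (per , _) .periodic = periodic-from-step {f} per
  affine-from-perm (_ , (g , gf , _) , _) .injective {x} {y} e = trans (sym (gf x)) (trans (cong g e) (gf y))

  instance
    n-nonZero : ℕ.NonZero n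
    n-nonZero = ℕ.>-nonZero (ℕ.<-≤-trans ℕ.z<s 2≤n)

  pred-suc : ∀ x → x - + 1 + + 1 ≡ x
  pred-suc = solve-∀

  suc-pred : ∀ x → x + + 1 - + 1 ≡ x
  suc-pred = solve-∀

  ~-pred : ∀ {x y} → x - + 1 ~ y → x ~ y + + 1
  ~-pred {x} p = ~-trans (~-reflexive (sym (pred-suc x))) (~-+ (+ 1) p)

  pred-~ : ∀ {x y} → x ~ y + + 1 → x - + 1 ~ y
  pred-~ {y = y} p = ~-trans (~-+ (- + 1) p) (~-reflexive (suc-pred y))

  suc≤ : ∀ {x z} → x < z → x + + 1 ≤ z
  suc≤ {x} {z} p = subst (_≤ z) (ℤ.+-comm (+ 1) x) (ℤ.i<j⇒suc[i]≤j p)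

  x<x+1 : ∀ x → x < x + + 1
  x<x+1 x = ℤ.suc[i]≤j⇒i<j (ℤ.≤-reflexive (ℤ.+-comm (+ 1) x))

  <suc : ∀ {x z} → x < z + + 1 → x ≤ z
  <suc {x} {z} p = subst₂ _≤_ (suc-pred x) (suc-pred z) (ℤ.+-monoˡ-≤ (- + 1) (suc≤ p))

  no-between : ∀ {x z} → x < z → z < x + + 1 → ⊥
  no-between p q = ℤ.<-irrefl refl (ℤ.<-≤-trans p (<suc q))

  x-1<x : ∀ x → x - + 1 < x
  x-1<x x = subst (x - + 1 <_) (pred-suc x) (x<x+1 (x - + 1))

  +-cancelʳ-< : ∀ c {x z} → x + c < z + c → x < z
  +-cancelʳ-< c {x} {z} p = subst₂ _<_ (lem x c) (lem z c) (ℤ.+-monoˡ-< (- c) p)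
    where
    lem : ∀ x c → x + c + (- c) ≡ x
    lem = solve-∀

  opaque
    -- Representatives 1, ..., n rather than 0, ..., n - 1, to match `IsGenWord`; hence the shift by
    -- one in `res`.
    letter : Fin n → ℤ
    letter r = + suc (toℕ r)

    res : ℤ → Fin n
    res x = fromℕ< (ℤDM.n%ℕd<d (x - + 1) n)

    letter-res : ∀ x → letter (res x) ~ x
    letter-res x = ~-sym (q , trans (lem x) (trans (cong (_+_ (+ 1)) (ℤDM.a≡a%ℕn+[a/ℕn]*n (x - + 1) n))
        (trans (lem₂ (+ r) q N) (cong (λ m → + suc m + q * N) (sym (Fin.toℕ-fromℕ< (ℤDM.n%ℕd<d (x - + 1) n)))))))
      where
      r : ℕ
      r = (x - + 1) ℤ.%ℕ n
      q : ℤ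
      q = (x - + 1) ℤ./ℕ n
      lem : ∀ x → x ≡ + 1 + (x - + 1)
      lem = solve-∀
      lem₂ : ∀ r q N → + 1 + (r + q * N) ≡ + 1 + r + q * N
      lem₂ = solve-∀

    letter-injective : ∀ {a b} → letter a ~ letter b → a ≡ b
    letter-injective {a} {b} (k , e) = Fin.toℕ-injective (ℕ.suc-injective (ℤ.+-injective
        (trans e (trans (cong (λ k → letter b + k * N) k≡0) (sym (shift ~-refl))))))
      where
      lem : ∀ y k N → y + k * N - y ≡ k * N
      lem = solve-∀
      k≡0 : k ≡ + 0
      k≡0 = small-multiple k (subst (λ w → ∣ w ∣ ℕ.< n) (trans (cong (_- letter b) e) (lem (letter b) k N))
              (ℕ.≤-<-trans bound (ℕ.⊔-lub (Fin.toℕ<n a) (Fin.toℕ<n b))))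
        where
        bound : ∣ letter a - letter b ∣ ℕ.≤ toℕ a ℕ.⊔ toℕ b
        bound = subst (λ w → ∣ w ∣ ℕ.≤ toℕ a ℕ.⊔ toℕ b) (sym (trans (lem₂ (+ toℕ a) (+ toℕ b)) (ℤ.m-n≡m⊖n (toℕ a) (toℕ b))))
                  (ℤ.∣m⊝n∣≤m⊔n (toℕ a) (toℕ b))
          where
          lem₂ : ∀ a b → (+ 1 + a) - (+ 1 + b) ≡ a - b
          lem₂ = solve-∀

  res-cong : ∀ {x y} → x ~ y → res x ≡ res y
  res-cong {x} {y} p = letter-injective (~-trans (letter-res x) (~-trans p (~-sym (letter-res y))))

  res-letter : ∀ r → res (letter r) ≡ r
  res-letter r = letter-injective (letter-res (letter r))

  res-≡⇒~ : ∀ {x y} → res x ≡ res y → x ~ y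
  res-≡⇒~ {x} {y} e = ~-trans (~-sym (letter-res x)) (~-trans (~-reflexive (cong letter e)) (letter-res y))

  data SView (b x : ℤ) : Set where
    up   : x ~ b → swap b (b + + 1) x ≡ x + + 1 → SView b x
    down : x ~ b + + 1 → swap b (b + + 1) x ≡ x - + 1 → SView b x
    stay : ¬ x ~ b → ¬ x ~ b + + 1 → swap b (b + + 1) x ≡ x → SView b x

  s-view : ∀ b x → SView b x
  s-view b x with swap-view {b} {b + + 1} ≁-suc x
  ... | at-i k refl e = up (k , refl) (trans e (+-shift b (+ 1) k))
  ... | at-j k refl e = down (k , refl) (trans e (lem b k N))
    where
    lem : ∀ b k N → b + k * N ≡ b + + 1 + k * N - + 1
    lem = solve-∀
  ... | off p q e = stay p q e

  -- A simple reflection moves every integer by at most one, so it can only invert neighbours; the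
  -- one consistent case is x moving up and z moving down.
  s-flip : ∀ b {x z} → x < z → swap b (b + + 1) z < swap b (b + + 1) x → x ~ b × z ≡ x + + 1
  s-flip b {x} {z} x<z q with s-view b x | s-view b z
  ... | up p e | up _ e′ = ⊥-elim (ℤ.<-asym x<z (+-cancelʳ-< (+ 1) (subst₂ _<_ e′ e q)))
  ... | up p e | down _ e′ = p , ℤ.≤-antisym (<suc (subst₂ _<_ (pred-suc z) refl (ℤ.+-monoˡ-< (+ 1) (subst₂ _<_ e′ e q)))) (suc≤ x<z)
  ... | up p e | stay _ _ e′ = ⊥-elim (no-between x<z (subst₂ _<_ e′ e q))
  ... | down p e | up _ e′ = ⊥-elim (ℤ.<-asym x<z (ℤ.<-trans (x<x+1 z) (ℤ.<-trans (subst₂ _<_ e′ e q) (x-1<x x))))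
  ... | down p e | down _ e′ = ⊥-elim (ℤ.<-asym x<z (+-cancelʳ-< (- + 1) (subst₂ _<_ e′ e q)))
  ... | down p e | stay _ _ e′ = ⊥-elim (ℤ.<-asym x<z (ℤ.<-trans (subst₂ _<_ e′ e q) (x-1<x x)))
  ... | stay _ _ e | up _ e′ = ⊥-elim (ℤ.<-asym x<z (ℤ.<-trans (x<x+1 z) (subst₂ _<_ e′ e q)))
  ... | stay _ _ e | down _ e′ = ⊥-elim (no-between x<z (subst (_< x + + 1) (pred-suc z) (ℤ.+-monoˡ-< (+ 1) (subst₂ _<_ e′ e q))))
  ... | stay _ _ e | stay _ _ e′ = ⊥-elim (ℤ.<-asym x<z (subst₂ _<_ e′ e q))

  -- Words, roots and the strong exchange property.

  Word : Set
  Word = List (Fin n)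

  σ : Fin n → ℤ → ℤ
  σ b = swap (letter b) (letter b + + 1)

  ev : Word → ℤ → ℤ
  ev [] = id
  ev (b ∷ ws) = σ b ∘ ev ws

  iv : Word → ℤ → ℤ
  iv [] = id
  iv (b ∷ ws) = iv ws ∘ σ b

  ev-is-evalWord : ∀ ws → ev ws ≗ evalWord n (map letter ws)
  ev-is-evalWord [] x = refl
  ev-is-evalWord (b ∷ ws) x = trans (swap-is-t _ _ _) (cong (s n (letter b)) (ev-is-evalWord ws x))

  σ-affine : ∀ b → Affine (σ b)
  σ-affine b = swap-affine ≁-suc

  σ-involutive : ∀ b x → σ b (σ b x) ≡ x
  σ-involutive b = swap-involutive ≁-suc

  ev-affine : ∀ ws → Affine (ev ws)
  ev-affine [] = id-affine
  ev-affine (b ∷ ws) = ∘-affine (σ-affine b) (ev-affine ws)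

  iv-affine : ∀ ws → Affine (iv ws)
  iv-affine [] = id-affine
  iv-affine (b ∷ ws) = ∘-affine (iv-affine ws) (σ-affine b)

  ev-iv : ∀ ws x → ev ws (iv ws x) ≡ x
  ev-iv [] x = refl
  ev-iv (b ∷ ws) x = trans (cong (σ b) (ev-iv ws (σ b x))) (σ-involutive b x)

  iv-ev : ∀ ws x → iv ws (ev ws x) ≡ x
  iv-ev [] x = refl
  iv-ev (b ∷ ws) x = trans (cong (iv ws) (σ-involutive b (ev ws x))) (iv-ev ws x)

  ev-++ : ∀ xs ys x → ev (xs ++ ys) x ≡ ev xs (ev ys x)
  ev-++ [] ys x = refl
  ev-++ (b ∷ xs) ys x = cong (σ b) (ev-++ xs ys x)

  iv-++ : ∀ xs ys x → iv (xs ++ ys) x ≡ iv ys (iv xs x)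
  iv-++ [] ys x = refl
  iv-++ (b ∷ xs) ys x = iv-++ xs ys (σ b x)

  iv-reverse : ∀ ws → iv ws ≗ ev (reverse ws)
  iv-reverse [] x = refl
  iv-reverse (b ∷ ws) x = trans (iv-reverse ws (σ b x))
    (trans (sym (ev-++ (reverse ws) (b ∷ []) x)) (cong (λ w → ev w x) (sym (L.unfold-reverse b ws))))

  root₁ root₂ : Fin n → Word → ℤ
  root₁ c ys = iv ys (letter c)
  root₂ c ys = iv ys (letter c + + 1)

  root-≁ : ∀ c ys → ¬ root₁ c ys ~ root₂ c ys
  root-≁ c ys = ≁-cong (iv-affine ys) ≁-suc

  -- Moving s_c to the right past `ys` turns it into the reflection ys⁻¹ s_c ys, which depends on
  -- `c` and `ys` but not on `xs`.
  ev-insert : ∀ xs c ys x → ev (xs ++ c ∷ ys) x ≡ ev (xs ++ ys) (swap (root₁ c ys) (root₂ c ys) x)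
  ev-insert xs c ys x = begin
    ev (xs ++ c ∷ ys) x  ≡⟨ ev-++ xs (c ∷ ys) x ⟩
    ev xs (σ c (ev ys x))  ≡⟨ cong (ev xs) (cong₂ (λ i j → swap i j (ev ys x)) (sym (ev-iv ys _)) (sym (ev-iv ys _))) ⟩
    ev xs (swap (ev ys (root₁ c ys)) (ev ys (root₂ c ys)) (ev ys x))
                                                 ≡⟨ cong (ev xs) (conj-swap (ev-affine ys) (root-≁ c ys) x) ⟨
    ev xs (ev ys (swap (root₁ c ys) (root₂ c ys) x)) ≡⟨ ev-++ xs ys _ ⟨
    ev (xs ++ ys) (swap (root₁ c ys) (root₂ c ys) x) ∎
    where open ≡-Reasoning

  ev-delete : ∀ xs c ys x → ev (xs ++ ys) x ≡ ev (xs ++ c ∷ ys) (swap (root₁ c ys) (root₂ c ys) x)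
  ev-delete xs c ys x = sym (trans (ev-insert xs c ys _) (cong (ev (xs ++ ys)) (swap-involutive (root-≁ c ys) x)))

  record Deletion (ws : Word) (f : ℤ → ℤ) : Set where
    constructor deletion
    field
      {before after} : Word
      {letter′} : Fin n
      split : ws ≡ before ++ letter′ ∷ after
      value : ev (before ++ after) ≗ f

  -- Read from the right, some letter b is the first to invert the images of x and z. By `s-flip`
  -- these images are then b and b + 1 up to a common shift, so that letter is the reflection t_{xz}
  -- carried past the letters to its right, and deleting it multiplies by t_{xz}.
  exchange : ∀ ws {x z} → ¬ x ~ z → x < z → ev ws z < ev ws x → Deletion ws (ev ws ∘ swap x z)
  exchange [] _ x<z z<x = ⊥-elim (ℤ.<-asym x<z z<x)
  exchange (b ∷ ws) {x} {z} x≁z x<z flip with ℤ.<-cmp (ev ws x) (ev ws z)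
  ... | tri> _ _ gt with exchange ws x≁z x<z gt
  ...   | deletion {xs} {ys} {a} refl v = deletion {before = b ∷ xs} refl (λ u → cong (σ b) (v u))
  exchange (b ∷ ws) {x} {z} x≁z x<z flip | tri≈ _ eq _ = ⊥-elim (ℤ.<-irrefl (injective (ev-affine ws) eq) x<z)
  exchange (b ∷ ws) {x} {z} x≁z x<z flip | tri< lt _ _ with s-flip (letter b) lt flip
  ... | (k , e₁) , e₂ = deletion {before = []} refl λ u → begin
    ev ws u  ≡⟨ σ-involutive b (ev ws u) ⟨
    σ b (σ b (ev ws u))  ≡⟨ cong (σ b) (swap-shift {letter b} {letter b + + 1} ≁-suc k (ev ws u)) ⟨
    σ b (swap (letter b + k * N) (letter b + + 1 + k * N) (ev ws u))
      ≡⟨ cong (σ b) (cong₂ (λ i j → swap i j (ev ws u)) (sym e₁) (trans (+-shift (letter b) (+ 1) k) (trans (cong (_+ + 1) (sym e₁)) (sym e₂)))) ⟩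
    σ b (swap (ev ws x) (ev ws z) (ev ws u)) ≡⟨ cong (σ b) (conj-swap (ev-affine ws) x≁z u) ⟨
    σ b (ev ws (swap x z u))  ∎
    where
    open ≡-Reasoning

  -- Fixed-point-free involutions and their conjugates by reflections.

  record FPF (y : ℤ → ℤ) : Set where
    field
      affine     : Affine y
      involutive : ∀ x → y (y x) ≡ x
      fixfree    : ∀ x → ¬ y x ~ x

    transpose : ∀ {x z} → x ~ y z → y x ~ z
    transpose {z = z} p = ~-trans (~-cong affine p) (~-reflexive (involutive z))
  open FPF public

  no-double-turn : ∀ {x k} → x + k * N + k * N ≡ x → k ≡ + 0
  no-double-turn {x} {k} e = half k (small-multiple (k + k) (subst (λ w → ∣ w ∣ ℕ.< n) (sym kN) (ℕ.<-≤-trans ℕ.z<s 2≤n)))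
    where
    lem : ∀ x k N → (k + k) * N ≡ x + k * N + k * N - x
    lem = solve-∀
    lem₂ : ∀ x → x - x ≡ + 0
    lem₂ = solve-∀
    kN : (k + k) * N ≡ + 0
    kN = trans (lem x k N) (trans (cong (_- x) e) (lem₂ x))
    half : ∀ k → k + k ≡ + 0 → k ≡ + 0
    half (+ zero) _ = refl

  -- If y x = x + kn, applying y again gives x = x + 2kn and so k = 0. Thus an involution without
  -- fixed points fixes no residue class either.
  fpf-from : ∀ {y} → Affine y → (∀ x → y (y x) ≡ x) → (∀ x → y x ≢ x) → FPF y
  fpf-from Y inv nofix .affine = Y
  fpf-from Y inv nofix .involutive = inv
  fpf-from {y} Y inv nofix .fixfree x (k , e) = nofix x
    (trans e (trans (cong (λ k → x + k * N) (no-double-turn {x} {k}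
      (trans (cong (_+ k * N) (sym e)) (trans (sym (periodic Y x k)) (trans (cong y (sym e)) (inv x))))))
      (sym (shift ~-refl))))

  fpf-from-IsFPF : ∀ {y} → IsFPF n y → FPF y
  fpf-from-IsFPF (perm , inv , nofix) = fpf-from (affine-from-perm perm) inv nofix

  record Conjugates (Θ w z : ℤ → ℤ) : Set where
    constructor conjugates
    field
      commutes : Θ ∘ w ≗ w ∘ z
  open Conjugates public

  conjugates-≗ : ∀ {Θ w w′ z z′} → w ≗ w′ → z ≗ z′ → Conjugates Θ w z → Conjugates Θ w′ z′
  conjugates-≗ {Θ} {w} {z = z} {z′} e f c .commutes x = trans (cong Θ (sym (e x))) (trans (commutes c x) (trans (cong w (f x)) (e (z′ x))))

  fpf-conjugate : ∀ {Θ z} ws → FPF Θ → Conjugates Θ (ev ws) z → FPF z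
  fpf-conjugate {Θ} {z} ws F c = fpf-from aff inv λ x e → fixfree F (ev ws x) (~-reflexive (trans (commutes c x) (cong (ev ws) e)))
    where
    inv : ∀ x → z (z x) ≡ x
    inv x = injective (ev-affine ws) (trans (sym (commutes c (z x))) (trans (cong Θ (sym (commutes c x))) (involutive F (ev ws x))))
    aff : Affine z
    aff = ≗-affine (λ x → trans (cong (iv ws) (commutes c x)) (iv-ev ws (z x))) (∘-affine (iv-affine ws) (∘-affine (affine F) (ev-affine ws)))

  twist : (ℤ → ℤ) → ℤ → ℤ → ℤ → ℤ
  twist y x z = swap x z ∘ y ∘ swap x z

  conjugates-twist : ∀ {Θ w w′ y x z} → ¬ x ~ z → Conjugates Θ w y → w′ ≗ w ∘ swap x z → Conjugates Θ w′ (twist y x z)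
  conjugates-twist {Θ} {w} {w′} {y} {x} {z} x≁z c e .commutes v = begin
    Θ (w′ v)  ≡⟨ cong Θ (e v) ⟩
    Θ (w (swap x z v))  ≡⟨ commutes c _ ⟩
    w (y (swap x z v))  ≡⟨ cong w (swap-involutive x≁z _) ⟨
    w (swap x z (twist y x z v))  ≡⟨ e _ ⟨
    w′ (twist y x z v)  ∎
    where open ≡-Reasoning

  conjugates-unique : ∀ {Θ z z′} ws → Conjugates Θ (ev ws) z → Conjugates Θ (ev ws) z′ → z ≗ z′
  conjugates-unique ws c c′ x = injective (ev-affine ws) (trans (sym (commutes c x)) (commutes c′ x))

  twist-≗ : ∀ {y y′ x z} → y ≗ y′ → twist y x z ≗ twist y′ x z
  twist-≗ {x = x} {z} e v = cong (swap x z) (e _)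

  twist-involutive : ∀ {y x z} → ¬ x ~ z → twist (twist y x z) x z ≗ y
  twist-involutive {y} {x} {z} x≁z v = trans (swap-involutive x≁z _) (cong y (swap-involutive x≁z v))

  twist-sym : ∀ {y x z} → ¬ x ~ z → twist y x z ≗ twist y z x
  twist-sym {y} {x} {z} x≁z v = trans (swap-sym x≁z _) (cong (swap z x ∘ y) (swap-sym x≁z v))

  -- The side condition in Π⁻ and Π⁺. For a fixed-point-free involution y it makes x, z, y x, y z
  -- represent four different residue classes.
  record Generic (y : ℤ → ℤ) (x z : ℤ) : Set where
    constructor generic
    field
      apart   : ¬ x ~ z
      unpaired : ¬ z ~ y x
  open Generic public

  generic-sym : ∀ {y x z} → FPF y → Generic y x z → Generic y z x
  generic-sym F (generic a b) = generic (a ∘ ~-sym) (λ p → b (~-sym (transpose F p)))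

  generic-image : ∀ {y x z} → FPF y → Generic y x z → Generic y (y x) (y z)
  generic-image {y} {x} {z} F (generic a b) = generic (≁-cong (affine F) a) (≁-cong (affine F) b)

  -- Here τ′ = y τ y, and τ commutes with τ′ because the four classes are distinct. Therefore τ′ y
  -- τ′ = τ′ τ y = τ τ′ y = τ y τ.
  twist-image : ∀ {y x z} → FPF y → Generic y x z → twist y (y x) (y z) ≗ twist y x z
  twist-image {y} {x} {z} F G v = begin
    τ′ (y (τ′ v))   ≡⟨ cong τ′ (conj-swap (affine F) a′ v) ⟩
    τ′ (swap (y (y x)) (y (y z)) (y v)) ≡⟨ cong τ′ (cong₂ (λ i j → swap i j (y v)) (involutive F x) (involutive F z)) ⟩
    τ′ (τ (y v))    ≡⟨ conj-swap (swap-affine a′) a (y v) ⟩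
    swap (τ′ x) (τ′ z) (τ′ (y v)) ≡⟨ cong₂ (λ i j → swap i j (τ′ (y v))) τ′x τ′z ⟩
    τ (τ′ (y v))    ≡⟨ cong τ (conj-swap (affine F) a v) ⟨
    τ (y (τ v))     ∎
    where
    open ≡-Reasoning
    τ  = swap x z
    τ′ = swap (y x) (y z)
    a  = apart G
    a′ = apart (generic-image F G)
    τ′x : τ′ x ≡ x
    τ′x = swap-off (λ p → fixfree F x (~-sym p)) (λ p → unpaired (generic-sym F G) p)
    τ′z : τ′ z ≡ z
    τ′z = swap-off (unpaired G) (λ p → fixfree F z (~-sym p))

  -- The exchange property for conjugates of Θ.

  record Base (Θ : ℤ → ℤ) : Set where
    field
      base-fpf : FPF Θ
      adjacent : ∀ x → Θ x ≡ x + + 1 ⊎ Θ x ≡ x - + 1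
  open Base public

  -- Steps of size one can reverse x < z only if x moves up and z = x + 1 moves down; then z = Θ x,
  -- which genericity forbids.
  base-monotone : ∀ {Θ x z} → Base Θ → Generic Θ x z → x < z → Θ x < Θ z
  base-monotone {Θ} {x} {z} B G x<z with ℤ.<-cmp (Θ x) (Θ z)
  ... | tri< lt _ _ = lt
  ... | tri≈ _ eq _ = ⊥-elim (ℤ.<-irrefl (injective (affine (base-fpf B)) eq) x<z)
  ... | tri> _ _ gt with adjacent B x | adjacent B z
  ...   | inj₁ e | inj₁ e′ = ⊥-elim (ℤ.<-asym x<z (+-cancelʳ-< (+ 1) (subst₂ _<_ e′ e gt)))
  ...   | inj₁ e | inj₂ e′ = ⊥-elim (unpaired G (~-reflexive (trans (ℤ.≤-antisym (<suc (subst₂ _<_ (pred-suc z) refl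
                                (ℤ.+-monoˡ-< (+ 1) (subst₂ _<_ e′ e gt)))) (suc≤ x<z)) (sym e))))
  ...   | inj₂ e | inj₁ e′ = ⊥-elim (ℤ.<-asym x<z (ℤ.<-trans (x<x+1 z) (ℤ.<-trans (subst₂ _<_ e′ e gt) (x-1<x x))))
  ...   | inj₂ e | inj₂ e′ = ⊥-elim (ℤ.<-asym x<z (+-cancelʳ-< (- + 1) (subst₂ _<_ e′ e gt)))

  record TwistedDeletion (Θ : ℤ → ℤ) (ws : Word) (z : ℤ → ℤ) : Set where
    constructor twisted-deletion
    field
      {before after} : Word
      {letter′} : Fin n
      split : ws ≡ before ++ letter′ ∷ after
      conj  : Conjugates Θ (ev (before ++ after)) z

  length-insert : ∀ (xs : Word) c ys → length (xs ++ c ∷ ys) ≡ suc (length (xs ++ ys))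
  length-insert [] c ys = refl
  length-insert (_ ∷ xs) c ys = cong suc (length-insert xs c ys)

  length-insert₂ : ∀ (xs ys : Word) c zs → length (xs ++ ys ++ c ∷ zs) ≡ suc (length (xs ++ ys ++ zs))
  length-insert₂ xs ys c zs = trans (cong length (sym (L.++-assoc xs ys _)))
    (trans (length-insert (xs ++ ys) c zs) (cong (suc ∘ length) (L.++-assoc xs ys zs)))

  generic-conj : ∀ {Θ y x z} ws → Conjugates Θ (ev ws) y → Generic y x z → Generic Θ (ev ws x) (ev ws z)
  generic-conj {x = x} ws c (generic a b) = generic (≁-cong (ev-affine ws) a)
    (λ p → b (~-cancel (ev-affine ws) (~-trans p (~-reflexive (commutes c x)))))

  -- Θ cannot reverse the order of a generic pair, so if y reverses the pair (x , z)
  -- then ev ws reverses (x , z) or (y z , y x).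
  twisted-exchange : ∀ {Θ y} ws {x z} → Base Θ → Conjugates Θ (ev ws) y → Generic y x z
    → x < z → y z < y x → TwistedDeletion Θ ws (twist y x z)
  twisted-exchange {Θ} {y} ws {x} {z} B c G x<z yz<yx with ℤ.<-cmp (ev ws x) (ev ws z)
  ... | tri≈ _ eq _ = ⊥-elim (ℤ.<-irrefl (injective (ev-affine ws) eq) x<z)
  ... | tri> _ _ gt with exchange ws (apart G) x<z gt
  ...   | deletion sp v = twisted-deletion sp (conjugates-twist (apart G) c v)
  twisted-exchange {Θ} {y} ws {x} {z} B c G x<z yz<yx | tri< lt _ _
    with exchange ws (apart G′) yz<yx (subst₂ _<_ (commutes c x) (commutes c z) (base-monotone B (generic-conj ws c G) lt))
    where
    G′ : Generic y (y z) (y x)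
    G′ = generic-image (fpf-conjugate ws (base-fpf B) c) (generic-sym (fpf-conjugate ws (base-fpf B) c) G)
  ... | deletion sp v = twisted-deletion sp (conjugates-≗ (λ _ → refl)
          (λ u → trans (twist-image F (generic-sym F G) u) (sym (twist-sym {y} (apart G) u)))
          (conjugates-twist (apart (generic-image F (generic-sym F G))) c v))
    where F = fpf-conjugate ws (base-fpf B) c

  turn≥2 : ∀ m → + 2 ≤ + suc m * N
  turn≥2 m = subst (+ 2 ≤_) (ℤ.pos-* (suc m) n) (+≤+ (ℕ.≤-trans 2≤n (ℕ.m≤m+n n (m ℕ.* n))))

  -- Here (b , b + 1) need not be generic. If y(b) = b + 1 + kn, then for k = 0 conjugation by s_b
  -- fixes y, for k > 0 the word itself inverts (b , b + 1), and k < 0 contradicts the assumed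
  -- descent.
  descent : ∀ {Θ y} ws b → Base Θ → Conjugates Θ (ev ws) y → y (letter b + + 1) < y (letter b)
    → ∃ λ ws′ → length ws′ ℕ.≤ length ws × Conjugates Θ (ev ws′) (twist y (letter b) (letter b + + 1))
  descent {Θ} {y} ws b B c lt with letter b + + 1 ~? y (letter b)
  ... | no ¬p with twisted-exchange ws B c (generic ≁-suc ¬p) (x<x+1 (letter b)) lt
  ...   | twisted-deletion {xs} {ys} {a} refl c′ = xs ++ ys , ℕ.≤-trans (ℕ.n≤1+n _) (ℕ.≤-reflexive (sym (length-insert xs a ys))) , c′
  descent {Θ} {y} ws b B c lt | yes p = go (~-sym p)
    where
    x = letter b
    F = fpf-conjugate ws (base-fpf B) c
    ylow : ∀ k → y x ≡ x + + 1 + k * N → y (x + + 1) ≡ x + (- k) * N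
    ylow k e = trans (shift-back k (trans (sym (involutive F x)) (trans (cong y e) (periodic (affine F) (x + + 1) k)))) refl
    Goal : Set
    Goal = ∃ λ ws′ → length ws′ ℕ.≤ length ws × Conjugates Θ (ev ws′) (twist y x (x + + 1))
    go : y x ~ x + + 1 → Goal
    go (+ zero , e) = ws , ℕ.≤-refl , conjugates-≗ (λ _ → refl) fixed c
      where
      e₁ : y x ≡ x + + 1
      e₁ = trans e (sym (shift ~-refl))
      e₂ : y (x + + 1) ≡ x
      e₂ = trans (cong y (sym e₁)) (involutive F x)
      fixed : y ≗ twist y x (x + + 1)
      fixed v = sym (trans (cong (swap x (x + + 1)) (trans (conj-swap (affine F) ≁-suc v) (trans (cong₂ (λ i j → swap i j (y v)) e₁ e₂)
        (sym (swap-sym ≁-suc (y v)))))) (swap-involutive ≁-suc (y v)))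
    go (+ suc m , e) with exchange ws ≁-suc (x<x+1 x) below
      where
      M = + suc m * N
      e′ : Θ (ev ws x) ≡ ev ws (x + + 1) + M
      e′ = trans (commutes c x) (trans (cong (ev ws) e) (periodic (ev-affine ws) (x + + 1) (+ suc m)))
      bound : ∀ {u} → Θ u ≡ u + + 1 ⊎ Θ u ≡ u - + 1 → Θ u < u + + 2
      bound {u} (inj₁ e) = subst (_< u + + 2) (sym e) (ℤ.+-monoʳ-< u (+<+ (ℕ.s<s ℕ.z<s)))
      bound {u} (inj₂ e) = subst (_< u + + 2) (sym e) (ℤ.+-monoʳ-< u ℤ.-<+)
      -- With w for `ev ws`: w(x + 1) + 2 ≤ w(x + 1) + M = Θ(w x) < w x + 2.
      below : ev ws (x + + 1) < ev ws x
      below = +-cancelʳ-< (+ 2) (ℤ.≤-<-trans (ℤ.+-monoʳ-≤ (ev ws (x + + 1)) (turn≥2 m))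
                (subst (_< ev ws x + + 2) e′ (bound (adjacent B (ev ws x)))))
    ... | deletion {xs} {ys} {a} refl v = xs ++ ys , ℕ.≤-trans (ℕ.n≤1+n _) (ℕ.≤-reflexive (sym (length-insert xs a ys))) ,
            conjugates-twist ≁-suc c v
    go (k@(-[1+ m ]) , e) = ⊥-elim (ℤ.<-asym lt (ℤ.<-trans (subst₂ _<_ (sym e) refl below) (subst₂ _<_ refl (sym (ylow k e)) above)))
      where
      M = + suc m * N
      above : x < x + M
      above = subst (_< x + M) (ℤ.+-identityʳ x) (ℤ.+-monoʳ-< x (ℤ.<-≤-trans (+<+ ℕ.z<s) (turn≥2 m)))
      lem : ∀ x M N → x + + 1 + (- M) * N ≡ x + (+ 1 - M * N)
      lem = solve-∀
      below : x + + 1 + k * N < x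
      below = subst₂ _<_ (sym (lem x (+ suc m) N)) (ℤ.+-identityʳ x) (ℤ.+-monoʳ-< x
        (ℤ.≤-<-trans (ℤ.+-monoʳ-≤ (+ 1) (ℤ.neg-mono-≤ (turn≥2 m))) ℤ.-<+))

  -- An atom together with a reduced word for it: `least` competes with every word of every
  -- conjugator at once.
  record Minimal (Θ : ℤ → ℤ) (ws : Word) (z : ℤ → ℤ) : Set where
    constructor minimal
    field
      conj  : Conjugates Θ (ev ws) z
      least : ∀ ws′ → Conjugates Θ (ev ws′) z → length ws ℕ.≤ length ws′

  minimal-≗ : ∀ {Θ ws z z′} → z ≗ z′ → Minimal Θ ws z → Minimal Θ ws z′
  minimal-≗ e (minimal c l) = minimal (conjugates-≗ (λ _ → refl) e c)
    (λ ws′ c′ → l ws′ (conjugates-≗ (λ _ → refl) (sym ∘ e) c′))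

  minimal-transfer : ∀ {Θ ws ws′ z} → ev ws ≗ ev ws′ → length ws ≡ length ws′ → Minimal Θ ws z → Minimal Θ ws′ z
  minimal-transfer e l (minimal c m) = minimal (conjugates-≗ e (λ _ → refl) c) (λ v cv → subst (ℕ._≤ _) l (m v cv))

  minimal-reduced : ∀ {Θ ws ws′ z} → Minimal Θ ws z → ev ws′ ≗ ev ws → length ws ℕ.≤ length ws′
  minimal-reduced {ws′ = ws′} (minimal c l) e = l ws′ (conjugates-≗ (sym ∘ e) (λ _ → refl) c)

  -- If the root were negative, `ys` would invert the pair, and `exchange` would express s_c ys by
  -- `ys` with one letter deleted, saving two letters.
  root-positive : ∀ {Θ z} xs c ys → Minimal Θ (xs ++ c ∷ ys) z → root₁ c ys < root₂ c ys
  root-positive {Θ} xs c ys M with ℤ.<-cmp (root₁ c ys) (root₂ c ys)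
  ... | tri< lt _ _ = lt
  ... | tri≈ _ eq _ = ⊥-elim (root-≁ c ys (~-reflexive eq))
  ... | tri> _ _ gt with exchange ys (root-≁ c ys ∘ ~-sym) gt
                           (subst₂ _<_ (sym (ev-iv ys _)) (sym (ev-iv ys _)) (x<x+1 (letter c)))
  ...   | deletion {as} {bs} {a} refl v = ⊥-elim (ℕ.<-irrefl refl (ℕ.<-≤-trans short
            (minimal-reduced {ws′ = xs ++ (as ++ bs)} M same)))
    where
    same : ev (xs ++ (as ++ bs)) ≗ ev (xs ++ c ∷ as ++ a ∷ bs)
    same u = begin
      ev (xs ++ (as ++ bs)) u ≡⟨ ev-++ xs (as ++ bs) u ⟩
      ev xs (ev (as ++ bs) u) ≡⟨ cong (ev xs) (v u) ⟩
      ev xs (ev ys (swap (root₂ c ys) (root₁ c ys) u)) ≡⟨ cong (ev xs ∘ ev ys) (sym (swap-sym (root-≁ c ys) u)) ⟩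
      ev xs (ev ys (swap (root₁ c ys) (root₂ c ys) u)) ≡⟨ ev-++ xs ys _ ⟨
      ev (xs ++ ys) (swap (root₁ c ys) (root₂ c ys) u) ≡⟨ ev-insert xs c ys u ⟨
      ev (xs ++ c ∷ ys) u ∎
      where open ≡-Reasoning
    short : length (xs ++ (as ++ bs)) ℕ.< length (xs ++ c ∷ as ++ a ∷ bs)
    short = ℕ.≤-trans (ℕ.n<1+n _) (ℕ.≤-trans (ℕ.n≤1+n _) (ℕ.≤-reflexive (sym
      (trans (length-insert xs c _) (cong suc (length-insert₂ xs as a bs))))))

  -- When two reflections conjugate y to the same involution.

  data Related (y : ℤ → ℤ) (x z x′ z′ : ℤ) : Set where
    same       : ∀ k → x ≡ x′ + k * N → z ≡ z′ + k * N → Related y x z x′ z′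
    flip       : ∀ k → x ≡ z′ + k * N → z ≡ x′ + k * N → Related y x z x′ z′
    same-image : ∀ k → y x ≡ x′ + k * N → y z ≡ z′ + k * N → Related y x z x′ z′
    flip-image : ∀ k → y x ≡ z′ + k * N → y z ≡ x′ + k * N → Related y x z x′ z′

  twist-left : ∀ {y x z} → FPF y → Generic y x z → twist y x z x ≡ y z
  twist-left {y} {x} {z} F G = trans (cong (swap x z ∘ y) (swap-i x z))
    (swap-off (λ p → unpaired (generic-sym F G) (~-sym p)) (fixfree F z))

  twist-right : ∀ {y x z} → FPF y → Generic y x z → twist y x z z ≡ y x
  twist-right {y} {x} {z} F G = trans (cong (swap x z ∘ y) (swap-j (apart G)))
    (swap-off (fixfree F x) (λ p → unpaired G (~-sym p)))

  -- Evaluating both sides at x gives y z = τ (y (z′ + kn)) with τ = t_{x′z′}. Genericity rules out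
  -- that τ moves y z, so τ and then y can be cancelled.
  parallel-if-congruent : ∀ {y x z x′ z′} → FPF y → Generic y x z → ¬ x′ ~ z′ → twist y x z ≗ twist y x′ z′
    → ((k , _) : x ~ x′) → z ≡ z′ + k * N
  parallel-if-congruent {y} {x} {z} {x′} {z′} F G a e p@(k , refl) with swap-view a (y z)
  ... | at-i l q _ = ⊥-elim (unpaired (generic-sym F G) (~-sym (~-trans (l , q) (~-sym p))))
  ... | at-j l q r = ⊥-elim (apart G (~-trans p (~-trans x′~ (transpose F (~-sym (l , q))))))
    where
    x′~ : x′ ~ y z′
    x′~ = ~-trans (~-sym (~-shift l)) (~-trans (~-reflexive (trans (sym r)
      (trans (cong (swap x′ z′) (trans (sym (twist-left F G)) (trans (e x) (cong (swap x′ z′ ∘ y) (swap-at-i x′ z′ k)))))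
        (swap-involutive a _)))) (~-trans (~-reflexive (periodic (affine F) z′ k)) (~-shift k)))
  ... | off _ _ r = injective (affine F) (trans (sym r) (trans (cong (swap x′ z′)
          (trans (sym (twist-left F G)) (trans (e x) (cong (swap x′ z′ ∘ y) (swap-at-i x′ z′ k))))) (swap-involutive a _)))

  -- If neither x nor y x meets the classes of x′ and z′, the second twist agrees with y at x, while
  -- the first sends x to y z. The remaining cases reduce to `parallel-if-congruent` by the
  -- symmetries `twist-sym` and `twist-image`.
  related : ∀ {y x z x′ z′} → FPF y → Generic y x z → ¬ x′ ~ z′ → twist y x z ≗ twist y x′ z′ → Related y x z x′ z′
  related {y} {x} {z} {x′} {z′} F G a e with x ~? x′ | x ~? z′ | y x ~? x′ | y x ~? z′
  ... | yes p@(k , q) | _ | _ | _ = same k q (parallel-if-congruent F G a e p)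
  ... | no _ | yes p@(k , q) | _ | _ = flip k q (parallel-if-congruent F G (a ∘ ~-sym) (λ v → trans (e v) (twist-sym {y} a v)) p)
  ... | no _ | no _ | yes p@(k , q) | _ = same-image k q
          (parallel-if-congruent F (generic-image F G) a (λ v → trans (twist-image F G v) (e v)) p)
  ... | no _ | no _ | no _ | yes p@(k , q) = flip-image k q
          (parallel-if-congruent F (generic-image F G) (a ∘ ~-sym) (λ v → trans (twist-image F G v) (trans (e v) (twist-sym {y} a v))) p)
  ... | no p₁ | no p₂ | no p₃ | no p₄ = ⊥-elim (apart G (~-reflexive (injective (affine F)
          (sym (trans (sym (twist-left F G)) (trans (e x) (trans (cong (swap x′ z′ ∘ y) (swap-off p₁ p₂)) (swap-off p₃ p₄))))))))

  generic-twist : ∀ {y x z} → FPF y → Generic y x z → Generic (twist y x z) x z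
  generic-twist F G = generic (apart G) (λ p → fixfree F _ (~-sym (~-trans p (~-reflexive (twist-left F G)))))

  -- The new involution reverses (x , z), so `twisted-exchange` deletes a letter from any of its
  -- words and arrives at a word for y.
  raise-bound : ∀ {Θ y ws x z} → Base Θ → Minimal Θ ws y → Generic y x z → x < z → y x < y z
    → ∀ vs → Conjugates Θ (ev vs) (twist y x z) → suc (length ws) ℕ.≤ length vs
  raise-bound {Θ} {y} {ws} {x} {z} B (minimal c l) G x<z yx<yz vs cv = bound (twisted-exchange vs B cv (generic-twist F G) x<z lowers)
    where
    F : FPF y
    F = fpf-conjugate ws (base-fpf B) c
    lowers : twist y x z z < twist y x z x
    lowers = subst₂ _<_ (sym (twist-right F G)) (sym (twist-left F G)) yx<yz
    bound : TwistedDeletion Θ vs (twist (twist y x z) x z) → suc (length ws) ℕ.≤ length vs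
    bound (twisted-deletion {xs} {ys} {a} refl c′) = subst (suc (length ws) ℕ.≤_) (sym (length-insert xs a ys))
          (ℕ.s≤s (l (xs ++ ys) (conjugates-≗ (λ _ → refl) (twist-involutive {y} (apart G)) c′)))

  -- Insertions and deletions in a conjugating word.

  conjugates-insert : ∀ {Θ y} xs c ys → Conjugates Θ (ev (xs ++ ys)) y
    → Conjugates Θ (ev (xs ++ c ∷ ys)) (twist y (root₁ c ys) (root₂ c ys))
  conjugates-insert xs c ys C = conjugates-twist (root-≁ c ys) C (ev-insert xs c ys)

  conjugates-delete : ∀ {Θ y} xs c ys → Conjugates Θ (ev (xs ++ c ∷ ys)) y
    → Conjugates Θ (ev (xs ++ ys)) (twist y (root₁ c ys) (root₂ c ys))
  conjugates-delete xs c ys C = conjugates-twist (root-≁ c ys) C (ev-delete xs c ys)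

  conjugates-word : ∀ {Θ y ws ws′} → ws ≡ ws′ → Conjugates Θ (ev ws) y → Conjugates Θ (ev ws′) y
  conjugates-word refl C = C

  -- The root of b depends only on us, so b acts by the same reflection with and without c.
  delete-both : ∀ {Θ y Z} xs c ys b us
    → Conjugates Θ (ev (xs ++ ys ++ b ∷ us)) y
    → Conjugates Θ (ev (xs ++ c ∷ ys ++ us)) y
    → Conjugates Θ (ev (xs ++ c ∷ ys ++ b ∷ us)) Z
    → Conjugates Θ (ev (xs ++ ys ++ us)) Z
  delete-both {y = y} xs c ys b us C₁ C₂ C = conjugates-≗ (λ _ → refl)
    (conjugates-unique ((xs ++ c ∷ ys) ++ b ∷ us)
      (conjugates-insert (xs ++ c ∷ ys) b us (conjugates-word (sym (L.++-assoc xs (c ∷ ys) us)) C₂))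
      (conjugates-word (sym (L.++-assoc xs (c ∷ ys) (b ∷ us))) C))
    (conjugates-word (L.++-assoc xs ys us)
      (conjugates-delete (xs ++ ys) b us (conjugates-word (sym (L.++-assoc xs ys (b ∷ us))) C₁)))

  -- By `delete-both`, deleting b and c, or a and c, leads back to Z. So in the word without c,
  -- which gives y, deleting a or b gives Z; deleting both then gives y again, two letters below its
  -- minimum.
  delete-three : ∀ {Θ y Z} xs a ys b zs c us
    → Minimal Θ (xs ++ ys ++ b ∷ zs ++ c ∷ us) y
    → Conjugates Θ (ev (xs ++ a ∷ ys ++ zs ++ c ∷ us)) y
    → Conjugates Θ (ev (xs ++ a ∷ ys ++ b ∷ zs ++ us)) y
    → Conjugates Θ (ev (xs ++ a ∷ ys ++ b ∷ zs ++ c ∷ us)) Z → ⊥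
  delete-three {Θ} {y} {Z} xs a ys b zs c us (minimal C₁ least) C₂ C₃ C = ℕ.<-irrefl refl (ℕ.<-≤-trans short (least (xs ++ ys ++ zs ++ us) all))
    where
    bc : Conjugates Θ (ev ((xs ++ a ∷ ys) ++ zs ++ us)) Z
    bc = delete-both (xs ++ a ∷ ys) b zs c us
           (conjugates-word (sym (L.++-assoc xs (a ∷ ys) _)) C₂)
           (conjugates-word (sym (L.++-assoc xs (a ∷ ys) _)) C₃)
           (conjugates-word (sym (L.++-assoc xs (a ∷ ys) _)) C)
    ac : Conjugates Θ (ev (xs ++ (ys ++ b ∷ zs) ++ us)) Z
    ac = delete-both xs a (ys ++ b ∷ zs) c us
           (conjugates-word (cong (xs ++_) (sym (L.++-assoc ys (b ∷ zs) _))) C₁)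
           (conjugates-word (cong (λ w → xs ++ a ∷ w) (sym (L.++-assoc ys (b ∷ zs) _))) C₃)
           (conjugates-word (cong (λ w → xs ++ a ∷ w) (sym (L.++-assoc ys (b ∷ zs) _))) C)
    all : Conjugates Θ (ev (xs ++ ys ++ zs ++ us)) y
    all = delete-both xs a ys b (zs ++ us)
            (conjugates-word (cong (xs ++_) (L.++-assoc ys (b ∷ zs) us)) ac)
            (conjugates-word (L.++-assoc xs (a ∷ ys) (zs ++ us)) bc)
            C₃
    short : length (xs ++ ys ++ zs ++ us) ℕ.< length (xs ++ ys ++ b ∷ zs ++ c ∷ us)
    short = ℕ.<-≤-trans (ℕ.n<1+n _) (ℕ.≤-trans (ℕ.n≤1+n _) (ℕ.≤-reflexive (sym
      (trans (length-insert₂ xs ys b (zs ++ c ∷ us)) (cong suc (trans (cong length (sym (L.++-assoc xs ys _)))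
        (trans (length-insert₂ (xs ++ ys) zs c us) (cong (suc ∘ length) (L.++-assoc xs ys _)))))))))

  record MinimalSplit (Θ y : ℤ → ℤ) (W : Word) : Set where
    constructor minimal-split
    field
      {before after} : Word
      {letter′} : Fin n
      split : W ≡ before ++ letter′ ∷ after
      min   : Minimal Θ (before ++ after) y

    position : ℕ
    position = length before

  split-order : ∀ (xs : Word) {c ys} xs′ {c′ ys′} → xs ++ c ∷ ys ≡ xs′ ++ c′ ∷ ys′ → length xs ℕ.< length xs′
    → ∃ λ m → xs′ ≡ xs ++ c ∷ m × ys ≡ m ++ c′ ∷ ys′
  split-order [] (x ∷ xs′) refl _ = xs′ , refl , refl
  split-order (x ∷ xs) (x′ ∷ xs′) e (ℕ.s≤s lt) with L.∷-injective e
  ... | refl , e′ with split-order xs xs′ e′ lt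
  ...   | m , refl , q = m , refl , q

  split-equal : ∀ (xs : Word) {c ys} xs′ {c′ ys′} → xs ++ c ∷ ys ≡ xs′ ++ c′ ∷ ys′ → length xs ≡ length xs′
    → xs ≡ xs′ × c ≡ c′ × ys ≡ ys′
  split-equal [] [] refl _ = refl , refl , refl
  split-equal (x ∷ xs) (x′ ∷ xs′) e l with L.∷-injective e
  ... | refl , e′ with split-equal xs xs′ e′ (ℕ.suc-injective l)
  ...   | refl , refl , refl = refl , refl , refl

  no-three-splits : ∀ {Θ y Z W} → Conjugates Θ (ev W) Z → (s₁ s₂ s₃ : MinimalSplit Θ y W) → let open MinimalSplit in
    position s₁ ℕ.< position s₂ → position s₂ ℕ.< position s₃ → ⊥
  no-three-splits C (minimal-split {xs} refl M₁) (minimal-split {xs₂} e₂ M₂) (minimal-split {xs₃} e₃ M₃) l₁₂ l₂₃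
    with split-order xs xs₂ e₂ l₁₂
  ... | ys , refl , refl with split-order (xs ++ _ ∷ ys) xs₃ (trans (L.++-assoc xs (_ ∷ ys) _) e₃) l₂₃
  ...   | zs , refl , refl = delete-three xs _ ys _ zs _ _ M₁
            (conjugates-word (L.++-assoc xs (_ ∷ ys) _) (Minimal.conj M₂))
            (conjugates-word (trans (L.++-assoc (xs ++ _ ∷ ys) (_ ∷ zs) _) (L.++-assoc xs (_ ∷ ys) _)) (Minimal.conj M₃))
            C

  minimal-word : ∀ {Θ y ws ws′} → ws ≡ ws′ → Minimal Θ ws y → Minimal Θ ws′ y
  minimal-word refl M = M

  -- From two deletable letters `delete-both` would make a word for Z with two letters fewer.
  unique-split : ∀ {Θ y Z W} → Minimal Θ W Z → (s₁ s₂ : MinimalSplit Θ y W) → let open MinimalSplit in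
    ¬ position s₁ ℕ.< position s₂
  unique-split (minimal C least) (minimal-split {xs} {ys₁} {c} refl M₁) (minimal-split {xs₂} {us} {b} e₂ M₂) l₁₂
    with split-order xs xs₂ e₂ l₁₂
  ... | ys , refl , refl = ℕ.<-irrefl refl (ℕ.<-≤-trans short (least (xs ++ ys ++ us)
          (delete-both xs c ys b us (Minimal.conj M₁) (conjugates-word (L.++-assoc xs (c ∷ ys) us) (Minimal.conj M₂)) C)))
    where
    short : length (xs ++ ys ++ us) ℕ.< length (xs ++ c ∷ ys ++ b ∷ us)
    short = ℕ.<-≤-trans (ℕ.n<1+n _) (ℕ.≤-trans (ℕ.n≤1+n _) (ℕ.≤-reflexive (sym
      (trans (length-insert xs c _) (cong suc (length-insert₂ xs ys b us))))))

  root-skip : ∀ b us v → swap (root₁ b us) (root₂ b us) (iv us v) ≡ iv us (σ b v)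
  root-skip b us v = sym (conj-swap (iv-affine us) ≁-suc v)

  data Reversed (y : ℤ → ℤ) (x z x′ z′ : ℤ) : Set where
    flip       : ∀ k → x ≡ z′ + k * N → z ≡ x′ + k * N → Reversed y x z x′ z′
    flip-image : ∀ k → y x ≡ z′ + k * N → y z ≡ x′ + k * N → Reversed y x z x′ z′

  shift-cancel-< : ∀ k {x z} → x + k * N < z + k * N → x < z
  shift-cancel-< k = +-cancelʳ-< (k * N)

  -- Both roots conjugate y to Z, so `related` applies and the two unreversed cases must be
  -- excluded. In `same`, deleting b would make the root of c negative. In `same-image`, the root of
  -- b and its image under y are both increasing, so `raise-bound` makes every word for Z longer
  -- than the minimal words for y, whereas `delete-both` yields a shorter one.
  splits-reversed : ∀ {Θ y Z} → Base Θ → ∀ xs c ys b us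
    → Minimal Θ (xs ++ ys ++ b ∷ us) y
    → Minimal Θ (xs ++ c ∷ ys ++ us) y
    → Conjugates Θ (ev (xs ++ c ∷ ys ++ b ∷ us)) Z
    → Generic y (root₁ c (ys ++ b ∷ us)) (root₂ c (ys ++ b ∷ us))
    → Reversed y (root₁ c (ys ++ b ∷ us)) (root₂ c (ys ++ b ∷ us)) (root₁ b us) (root₂ b us)
  splits-reversed {Θ} {y} {Z} B xs c ys b us M₁ M₂ C G = cases (related F G (root-≁ b us) λ v → trans (sym (Z₁ v)) (Z₂ v))
    where
    W = xs ++ c ∷ ys ++ b ∷ us
    F = fpf-conjugate (xs ++ ys ++ b ∷ us) (base-fpf B) (Minimal.conj M₁)
    x  = root₁ c (ys ++ b ∷ us)
    z  = root₂ c (ys ++ b ∷ us)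
    x′ = root₁ b us
    z′ = root₂ b us
    Z₁ : Z ≗ twist y x z
    Z₁ = conjugates-unique W C (conjugates-insert xs c (ys ++ b ∷ us) (Minimal.conj M₁))
    Z₂ : Z ≗ twist y x′ z′
    Z₂ = conjugates-unique ((xs ++ c ∷ ys) ++ b ∷ us)
      (conjugates-word (sym (L.++-assoc xs (c ∷ ys) _)) C)
      (conjugates-insert (xs ++ c ∷ ys) b us (conjugates-word (sym (L.++-assoc xs (c ∷ ys) us)) (Minimal.conj M₂)))
    x′<z′ : x′ < z′
    x′<z′ = root-positive (xs ++ ys) b us (minimal-word (sym (L.++-assoc xs ys _)) M₁)
    τ = swap x′ z′
    skip : ∀ v → iv (ys ++ us) v ≡ τ (iv (ys ++ b ∷ us) v)
    skip v = begin
      iv (ys ++ us) v  ≡⟨ iv-++ ys us v ⟩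
      iv us (iv ys v)  ≡⟨ cong (iv us) (σ-involutive b (iv ys v)) ⟨
      iv us (σ b (σ b (iv ys v)))     ≡⟨ root-skip b us (σ b (iv ys v)) ⟨
      τ (iv us (σ b (iv ys v)))  ≡⟨ cong τ (iv-++ ys (b ∷ us) v) ⟨
      τ (iv (ys ++ b ∷ us) v)  ∎
      where open ≡-Reasoning
    τx<τz : τ x < τ z
    τx<τz = subst₂ _<_ (skip (letter c)) (skip (letter c + + 1)) (root-positive xs c (ys ++ us) M₂)
    cases : Related y x z x′ z′ → Reversed y x z x′ z′
    cases (flip k p q) = flip k p q
    cases (flip-image k p q) = flip-image k p q
    cases (same k p q) = ⊥-elim (ℤ.<-asym x′<z′ (shift-cancel-< k (subst₂ _<_
      (trans (cong τ p) (swap-at-i x′ z′ k)) (trans (cong τ q) (swap-at-j (root-≁ b us) k)) τx<τz)))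
    cases (same-image k p q) = ⊥-elim (ℕ.<-irrefl refl (ℕ.<-≤-trans short (raise-bound B M₁ G′ x′<z′ yx′<yz′ (xs ++ ys ++ us)
        (conjugates-≗ (λ _ → refl) Z₂ (delete-both xs c ys b us (Minimal.conj M₁) (Minimal.conj M₂) C)))))
      where
      p~ : y x ~ x′
      p~ = k , p
      q~ : y z ~ z′
      q~ = k , q
      τx : τ x ≡ x
      τx = swap-off (λ r → fixfree F x (~-trans p~ (~-sym r))) (λ r → unpaired (generic-sym F G) (~-trans r (~-sym q~)))
      τz : τ z ≡ z
      τz = swap-off (λ r → unpaired G (~-trans r (~-sym p~))) (λ r → fixfree F z (~-trans q~ (~-sym r)))
      yx′ : y x′ ≡ x + (- k) * N
      yx′ = shift-back k (trans (sym (involutive F x)) (trans (cong y p) (periodic (affine F) x′ k)))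
      yz′ : y z′ ≡ z + (- k) * N
      yz′ = shift-back k (trans (sym (involutive F z)) (trans (cong y q) (periodic (affine F) z′ k)))
      yx′<yz′ : y x′ < y z′
      yx′<yz′ = subst₂ _<_ (sym yx′) (sym yz′) (ℤ.+-monoˡ-< ((- k) * N) (subst₂ _<_ τx τz τx<τz))
      G′ : Generic y x′ z′
      G′ = generic (root-≁ b us) λ r → unpaired G (~-trans (~-sym (~-trans (~-reflexive yz′) (~-shift (- k))))
             (~-trans (transpose F r) (~-sym p~)))
      short : length (xs ++ ys ++ us) ℕ.< suc (length (xs ++ ys ++ b ∷ us))
      short = ℕ.s≤s (ℕ.≤-trans (ℕ.n≤1+n _) (ℕ.≤-reflexive (sym (length-insert₂ xs ys b us))))

  -- A second deletable letter for every unreduced insertion.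

  restrict : (ℤ → ℤ) → Word → ℤ → ℤ
  restrict Θ ws = iv ws ∘ Θ ∘ ev ws

  conjugates-restrict : ∀ Θ ws → Conjugates Θ (ev ws) (restrict Θ ws)
  conjugates-restrict Θ ws .commutes x = sym (ev-iv ws (Θ (ev ws x)))

  -- In w⁻¹Θw the leftmost letters of w conjugate first, so y is ys⁻¹ Y ys for the involution Y
  -- reached after `xs`.
  restrict-commutes : ∀ {Θ y} xs ys → Conjugates Θ (ev (xs ++ ys)) y → restrict Θ xs ∘ ev ys ≗ ev ys ∘ y
  restrict-commutes {Θ} {y} xs ys C v = begin
    iv xs (Θ (ev xs (ev ys v)))  ≡⟨ cong (iv xs ∘ Θ) (ev-++ xs ys v) ⟨
    iv xs (Θ (ev (xs ++ ys) v))  ≡⟨ cong (iv xs) (commutes C v) ⟩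
    iv xs (ev (xs ++ ys) (y v))  ≡⟨ cong (iv xs) (ev-++ xs ys (y v)) ⟩
    iv xs (ev xs (ev ys (y v)))  ≡⟨ iv-ev xs _ ⟩
    ev ys (y v)  ∎
    where open ≡-Reasoning

  conjugates-then : ∀ {Θ w Y w′ y} → Conjugates Θ w Y → Y ∘ w′ ≗ w′ ∘ y → Conjugates Θ (w ∘ w′) y
  conjugates-then {w = w} {w′ = w′} C e .commutes v = trans (commutes C (w′ v)) (cong w (e v))

  -- By `raise-bound` the insertion can fail to be minimal only if its root is negative or y
  -- reverses it. A negative root is handled by `exchange` in `ys`. If y reverses the root, the
  -- order of Y at (c , c + 1), with Y the involution reached after `xs`, tells whether the second
  -- letter lies in `xs` or in `ys`.
  another-split : ∀ {Θ y} → Base Θ → ∀ xs c ys → Minimal Θ (xs ++ ys) y → Generic y (root₁ c ys) (root₂ c ys)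
    → ¬ Minimal Θ (xs ++ c ∷ ys) (twist y (root₁ c ys) (root₂ c ys))
    → ∃ λ (s : MinimalSplit Θ y (xs ++ c ∷ ys)) → MinimalSplit.position s ≢ length xs
  another-split {Θ} {y} B xs c ys M G ¬min = cases (ℤ.<-cmp x z) (ℤ.<-cmp (y x) (y z)) (ℤ.<-cmp (Y i) (Y (i + + 1)))
    where
    open ≡-Reasoning
    i = letter c
    x = root₁ c ys
    z = root₂ c ys
    C : Conjugates Θ (ev (xs ++ ys)) y
    C = Minimal.conj M
    F : FPF y
    F = fpf-conjugate (xs ++ ys) (base-fpf B) C
    Y = restrict Θ xs
    Goal : Set
    Goal = ∃ λ (s : MinimalSplit Θ y (xs ++ c ∷ ys)) → MinimalSplit.position s ≢ length xs

    later : ∀ as b bs → ys ≡ as ++ b ∷ bs → Conjugates Θ (ev (xs ++ c ∷ as ++ bs)) y → Goal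
    later as b bs refl C′ = minimal-split {before = xs ++ c ∷ as} {after = bs} (sym (L.++-assoc xs (c ∷ as) (b ∷ bs)))
        (minimal-word (sym (L.++-assoc xs (c ∷ as) bs)) (minimal C′ λ ws′ c′ → ℕ.≤-trans (ℕ.≤-reflexive len) (Minimal.least M ws′ c′))) ,
      λ e → ℕ.<-irrefl (trans (sym e) (L.length-++ xs)) (ℕ.m<m+n (length xs) ℕ.z<s)
      where
      len : length (xs ++ c ∷ as ++ bs) ≡ length (xs ++ as ++ b ∷ bs)
      len = trans (length-insert xs c (as ++ bs)) (sym (length-insert₂ xs as b bs))

    earlier : ∀ as b bs → xs ≡ as ++ b ∷ bs → Conjugates Θ (ev (as ++ bs ++ c ∷ ys)) y → Goal
    earlier as b bs refl C′ = minimal-split {before = as} {after = bs ++ c ∷ ys} (L.++-assoc as (b ∷ bs) (c ∷ ys))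
        (minimal C′ λ ws′ c′ → ℕ.≤-trans (ℕ.≤-reflexive len) (Minimal.least M ws′ c′)) ,
      λ e → ℕ.<-irrefl (trans e (L.length-++ as)) (ℕ.m<m+n (length as) ℕ.z<s)
      where
      len : length (as ++ bs ++ c ∷ ys) ≡ length ((as ++ b ∷ bs) ++ ys)
      len = trans (length-insert₂ as bs c ys)
        (sym (trans (cong length (L.++-assoc as (b ∷ bs) ys)) (length-insert as b (bs ++ ys))))

    inside : ∀ {f} as bs → ev (as ++ bs) ≗ ev ys ∘ f → ev (xs ++ c ∷ as ++ bs) ≗ ev (xs ++ c ∷ ys) ∘ f
    inside {f} as bs e v = begin
      ev (xs ++ c ∷ as ++ bs) v      ≡⟨ ev-++ xs (c ∷ as ++ bs) v ⟩
      ev xs (σ c (ev (as ++ bs) v))  ≡⟨ cong (ev xs ∘ σ c) (e v) ⟩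
      ev xs (σ c (ev ys (f v)))      ≡⟨ ev-++ xs (c ∷ ys) (f v) ⟨
      ev (xs ++ c ∷ ys) (f v)  ∎

    negative : z < x → Deletion ys (ev ys ∘ swap z x) → Goal
    negative _ (deletion {as} {bs} {b} e v) = later as b bs e (conjugates-≗ (λ u → sym (begin
      ev (xs ++ c ∷ as ++ bs) u  ≡⟨ inside as bs v u ⟩
      ev (xs ++ c ∷ ys) (swap z x u)  ≡⟨ cong (ev (xs ++ c ∷ ys)) (swap-sym (root-≁ c ys) u) ⟨
      ev (xs ++ c ∷ ys) (swap x z u)  ≡⟨ ev-delete xs c ys u ⟨
      ev (xs ++ ys) u  ∎)) (λ _ → refl) C)

    G′ : Generic y (y z) (y x)
    G′ = generic-image F (generic-sym F G)

    -- Since Y is increasing at (c , c + 1) and `ys` carries y to Y, the word `ys` inverts the pair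
    -- (y z , y x), whose twist is the one of (x , z).
    ascending : Deletion ys (ev ys ∘ swap (y z) (y x)) → Goal
    ascending (deletion {as} {bs} {b} e v) = later as b bs e (conjugates-≗ (λ _ → refl)
        (λ u → trans (twist-≗ {x = y z} {y x} same-twist u) (twist-involutive {y} (apart G′) u))
        (conjugates-twist (apart G′) (conjugates-insert xs c ys C) (inside as bs v)))
      where
      same-twist : twist y x z ≗ twist y (y z) (y x)
      same-twist u = trans (twist-sym {y} (apart G) u) (sym (twist-image F (generic-sym F G) u))

    Yev : ∀ v → Y (ev ys v) ≡ ev ys (y v)
    Yev = restrict-commutes xs ys C

    Y-image : ∀ v → Y v ≡ ev ys (y (iv ys v))
    Y-image v = trans (cong Y (sym (ev-iv ys v))) (Yev (iv ys v))

    -- Deleting a letter of `xs` turns Y into s_c Y s_c, and the inserted c turns it back into Y.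
    descending : TwistedDeletion Θ xs (twist Y i (i + + 1)) → Goal
    descending (twisted-deletion {as} {bs} {b} e C′) = earlier as b bs e
        (conjugates-≗ {w = ev (as ++ bs) ∘ ev (c ∷ ys)} {z = y} (λ u → trans (sym (ev-++ (as ++ bs) (c ∷ ys) u)) (cong (λ w → ev w u) (L.++-assoc as bs (c ∷ ys))))
          (λ _ → refl) (conjugates-then C′ λ u → cong (σ c) (trans (cong Y (σ-involutive c (ev ys u))) (Yev u))))

    cases : _ → _ → _ → Goal
    cases (tri≈ _ e _) _ _ = ⊥-elim (root-≁ c ys (~-reflexive e))
    cases (tri> _ _ z<x) _ _ = negative z<x (exchange ys (root-≁ c ys ∘ ~-sym) z<x
      (subst₂ _<_ (sym (ev-iv ys _)) (sym (ev-iv ys _)) (x<x+1 i)))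
    cases (tri< x<z _ _) (tri≈ _ e _) _ = ⊥-elim (apart G (~-reflexive (injective (affine F) e)))
    cases (tri< x<z _ _) (tri< yx<yz _ _) _ = ⊥-elim (¬min (minimal (conjugates-insert xs c ys C)
      λ ws′ c′ → subst (ℕ._≤ length ws′) (sym (length-insert xs c ys)) (raise-bound B M G x<z yx<yz ws′ c′)))
    cases (tri< x<z _ _) (tri> _ _ yz<yx) (tri> _ _ gt) = descending (twisted-exchange xs B (conjugates-restrict Θ xs)
      (generic ≁-suc λ p → unpaired G (~-trans (~-cong (iv-affine ys) p)
         (~-reflexive (trans (cong (iv ys) (Y-image i)) (iv-ev ys _))))) (x<x+1 i) gt)
    cases (tri< x<z _ _) (tri> _ _ yz<yx) (tri≈ _ e _) = ⊥-elim (apart G (~-reflexive (injective (affine F)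
      (injective (ev-affine ys) (trans (sym (Y-image i)) (trans e (Y-image (i + + 1))))))))
    cases (tri< x<z _ _) (tri> _ _ yz<yx) (tri< lt _ _) = ascending (exchange ys (apart G′) yz<yx
      (subst₂ _<_ (Y-image i) (Y-image (i + + 1)) lt))

  -- Coxeter length and its relation to minimal words.

  opaque
    unfolding letter

    gen-word : ∀ ws → IsGenWord n (map letter ws)
    gen-word [] = []
    gen-word (r ∷ ws) = (+≤+ (ℕ.s≤s ℕ.z≤n) , +≤+ (Fin.toℕ<n r)) ∷ gen-word ws

    gen-lift : ∀ {ws} → IsGenWord n ws → ∃ λ vs → map letter vs ≡ ws
    gen-lift [] = [] , refl
    gen-lift {+ suc m ∷ ws} ((_ , +≤+ lt) ∷ g) with gen-lift g
    ... | vs , e = fromℕ< lt ∷ vs , cong₂ _∷_ (cong (λ m → + suc m) (Fin.toℕ-fromℕ< lt)) e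
    gen-lift {+ zero ∷ ws} ((+≤+ () , _) ∷ g)
    gen-lift { -[1+ _ ] ∷ ws} ((() , _) ∷ g)

  record Length (f : ℤ → ℤ) (k : ℕ) : Set where
    field
      word  : Word
      value : ev word ≗ f
      size  : length word ≡ k
      least : ∀ ws → ev ws ≗ f → k ℕ.≤ length ws
  open Length public

  length⇒Len : ∀ {f k} → Length f k → Len n f k
  length⇒Len ℓ = (map letter (word ℓ) , gen-word (word ℓ) , (λ x → trans (sym (ev-is-evalWord (word ℓ) x)) (value ℓ x)) ,
      trans (L.length-map letter (word ℓ)) (size ℓ)) , bound
    where
    bound : ∀ ws → IsGenWord n ws → evalWord n ws ≗ _ → _
    bound ws g e with gen-lift g
    ... | vs , refl = subst (_ ℕ.≤_) (sym (L.length-map letter vs)) (least ℓ vs (λ x → trans (ev-is-evalWord vs x) (e x)))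

  Len⇒length : ∀ {f k} → Len n f k → Length f k
  Len⇒length {f} {k} ((ws , g , e , l) , m) with gen-lift g
  ... | vs , refl = record
    { word = vs ; value = λ x → trans (ev-is-evalWord vs x) (e x)
    ; size = trans (sym (L.length-map letter vs)) l
    ; least = λ us e′ → subst (k ℕ.≤_) (L.length-map letter us)
        (m (map letter us) (gen-word us) (λ x → trans (sym (ev-is-evalWord us x)) (e′ x))) }

  length-≤ : ∀ {f g j k} → f ≗ g → Length f j → Length g k → j ℕ.≤ k
  length-≤ e ℓ ℓ′ = subst (_ ℕ.≤_) (size ℓ′) (least ℓ (word ℓ′) (λ x → trans (value ℓ′ x) (sym (e x))))

  length-unique : ∀ {f g j k} → f ≗ g → Length f j → Length g k → j ≡ k
  length-unique e ℓ ℓ′ = ℕ.≤-antisym (length-≤ e ℓ ℓ′) (length-≤ (sym ∘ e) ℓ′ ℓ)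

  length-≗ : ∀ {f g k} → f ≗ g → Length f k → Length g k
  length-≗ e ℓ = record { word = word ℓ ; value = λ x → trans (value ℓ x) (e x) ; size = size ℓ
                        ; least = λ ws e′ → least ℓ ws (λ x → trans (e′ x) (sym (e x))) }

  -- `P` is not assumed decidable, so the minimum is found only up to double negation. Its uses end
  -- in a contradiction or in a decidable relation between natural numbers.
  shortest : (P : Word → Set) → ∀ ws → P ws
    → ¬ ¬ (∃ λ vs → P vs × length vs ℕ.≤ length ws × (∀ us → P us → length vs ℕ.≤ length us))
  shortest P ws p = go (length ws) ws p ℕ.≤-refl
    where
    go : ∀ m ws → P ws → length ws ℕ.≤ m
      → ¬ ¬ (∃ λ vs → P vs × length vs ℕ.≤ length ws × (∀ us → P us → length vs ℕ.≤ length us))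
    go m ws p le none = none (ws , p , ℕ.≤-refl , bound m le)
      where
      bound : ∀ m → length ws ℕ.≤ m → ∀ us → P us → length ws ℕ.≤ length us
      bound m le us q with length ws ℕ.≤? length us
      ... | yes ok = ok
      bound zero le us q | no ¬ok = ⊥-elim (¬ok (ℕ.≤-trans le ℕ.z≤n))
      bound (suc m) le us q | no ¬ok = ⊥-elim (go m us q (ℕ.≤-pred (ℕ.≤-trans (ℕ.≰⇒> ¬ok) le))
          λ (vs , r , l , s) → none (vs , r , ℕ.≤-trans l (ℕ.<⇒≤ (ℕ.≰⇒> ¬ok)) , s))

  length-exists : ∀ {f} ws → ev ws ≗ f → ¬ ¬ (∃ λ k → Length f k × k ℕ.≤ length ws)
  length-exists {f} ws e none = shortest (λ ws → ev ws ≗ f) ws e λ (vs , v , l , m) →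
    none (length vs , record { word = vs ; value = v ; size = refl ; least = m } , l)

  minimal-exists : ∀ {Θ y} ws → Conjugates Θ (ev ws) y → ¬ ¬ (∃ λ vs → Minimal Θ vs y)
  minimal-exists {Θ} {y} ws c none = shortest (λ ws → Conjugates Θ (ev ws) y) ws c λ (vs , v , _ , m) → none (vs , minimal v m)

  -- Every word for f s_b inverts (b , b + 1), so by `exchange` it loses a letter and becomes a word
  -- for f.
  length-step : ∀ {f k} b → Length f k → f (letter b) < f (letter b + + 1) → Length (f ∘ σ b) (suc k)
  length-step {f} {k} b ℓ lt = record
    { word = word ℓ ++ b ∷ []
    ; value = λ x → trans (ev-++ (word ℓ) (b ∷ []) x) (value ℓ (σ b x))
    ; size = trans (L.length-++ (word ℓ)) (trans (ℕ.+-comm _ 1) (cong suc (size ℓ)))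
    ; least = λ ws e → bound ws e (exchange ws ≁-suc (x<x+1 (letter b)) (subst₂ _<_
        (trans (cong f (sym (swap-j ≁-suc))) (sym (e _))) (trans (cong f (sym (swap-i _ _))) (sym (e _))) lt)) }
    where
    bound : ∀ ws → ev ws ≗ f ∘ σ b → Deletion ws (ev ws ∘ swap (letter b) (letter b + + 1)) → suc k ℕ.≤ length ws
    bound ws e (deletion {xs} {ys} {a} refl v) = subst (suc k ℕ.≤_) (sym (length-insert xs a ys)) (ℕ.s≤s
      (least ℓ (xs ++ ys) λ u → trans (v u) (trans (e _) (cong f (σ-involutive b u)))))

  length-inverse : ∀ {f h k} → f ∘ h ≗ id → h ∘ f ≗ id → Length f k → Length h k
  length-inverse {f} {h} {k} fh hf ℓ = record
    { word = reverse (word ℓ)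
    ; value = λ x → trans (sym (iv-reverse (word ℓ) x)) (trans (cong (iv (word ℓ)) (trans (sym (fh x)) (sym (value ℓ (h x))))) (iv-ev (word ℓ) (h x)))
    ; size = trans (L.length-reverse (word ℓ)) (size ℓ)
    ; least = λ ws e → subst (k ℕ.≤_) (L.length-reverse ws) (least ℓ (reverse ws)
        λ x → trans (sym (iv-reverse ws x)) (trans (cong (iv ws) (trans (sym (hf x)) (sym (e (f x))))) (iv-ev ws (f x)))) }

  -- Apply `length-step` twice, passing to the inverse in between to multiply on the other side. The
  -- second ascent fails only if s_b inverts Y(b) < Y(b + 1), and then `s-flip` gives Y(b) ~ b.
  length-twist : ∀ {Y k} b → FPF Y → Length Y k → Y (letter b) < Y (letter b + + 1)
    → Length (twist Y (letter b) (letter b + + 1)) (2 ℕ.+ k)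
  length-twist {Y} {k} b F ℓ lt = length-step b
    (length-inverse (λ x → trans (cong Y (σ-involutive b (Y x))) (involutive F x))
      (λ x → trans (cong (σ b) (involutive F (σ b x))) (σ-involutive b x)) (length-step b ℓ lt)) lt′
    where
    lt′ : σ b (Y (letter b)) < σ b (Y (letter b + + 1))
    lt′ with ℤ.<-cmp (σ b (Y (letter b))) (σ b (Y (letter b + + 1)))
    ... | tri< r _ _ = r
    ... | tri≈ _ e _ = ⊥-elim (≁-suc (~-reflexive (injective (∘-affine (σ-affine b) (affine F)) e)))
    ... | tri> _ _ r = ⊥-elim (fixfree F (letter b) (proj₁ (s-flip (letter b) lt r)))

  -- If b were a descent of the involution reached after `xs`, then `descent` would reach y by a
  -- word no longer than `xs`.
  last-step : ∀ {Θ y} → Base Θ → ∀ xs b → Minimal Θ (xs ++ b ∷ []) y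
    → Minimal Θ xs (restrict Θ xs) × restrict Θ xs (letter b) < restrict Θ xs (letter b + + 1)
      × twist (restrict Θ xs) (letter b) (letter b + + 1) ≗ y
  last-step {Θ} {y} B xs b (minimal C m) = minimal C′ shorter , up′ , ty
    where
    Y = restrict Θ xs
    C′ : Conjugates Θ (ev xs) Y
    C′ = conjugates-restrict Θ xs
    append : ∀ ws → Conjugates Θ (ev ws) Y → Conjugates Θ (ev (ws ++ b ∷ [])) (twist Y (letter b) (letter b + + 1))
    append ws c = conjugates-twist ≁-suc c (ev-++ ws (b ∷ []))
    ty : twist Y (letter b) (letter b + + 1) ≗ y
    ty = conjugates-unique (xs ++ b ∷ []) (append xs C′) C
    len : ∀ ws → length (ws ++ b ∷ []) ≡ suc (length ws)
    len ws = trans (L.length-++ ws) (ℕ.+-comm _ 1)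
    shorter : ∀ ws′ → Conjugates Θ (ev ws′) Y → length xs ℕ.≤ length ws′
    shorter ws c = ℕ.≤-pred (subst₂ ℕ._≤_ (len xs) (len ws) (m (ws ++ b ∷ []) (conjugates-≗ (λ _ → refl) ty (append ws c))))
    up′ : Y (letter b) < Y (letter b + + 1)
    up′ with ℤ.<-cmp (Y (letter b)) (Y (letter b + + 1))
    ... | tri< lt _ _ = lt
    ... | tri≈ _ e _ = ⊥-elim (≁-suc (~-reflexive (injective (affine (fpf-conjugate xs (base-fpf B) C′)) e)))
    ... | tri> _ _ gt = ⊥-elim (contra (descent xs b B C′ gt))
      where
      contra : (∃ λ ws′ → length ws′ ℕ.≤ length xs × Conjugates Θ (ev ws′) (twist Y (letter b) (letter b + + 1))) → ⊥
      contra (ws′ , l , c) = ℕ.<-irrefl refl (ℕ.≤-trans (subst (ℕ._≤ length ws′) (len xs) (m ws′ (conjugates-≗ (λ _ → refl) ty c))) l)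

  -- Each letter of a minimal word raises the Coxeter length by exactly two. This translates ℓ(z) =
  -- ℓ(y) + 2 in `CoversVia` into minimal words whose lengths differ by one.
  length-minimal : ∀ {Θ k₀} → Base Θ → Length Θ k₀ → ∀ ws {y} → Minimal Θ ws y → Length y (k₀ ℕ.+ 2 ℕ.* length ws)
  length-minimal {Θ} {k₀} B ℓ ws M = go (length ws) ws refl M
    where
    go : ∀ m ws {y} → length ws ≡ m → Minimal Θ ws y → Length y (k₀ ℕ.+ 2 ℕ.* m)
    go zero [] refl (minimal C _) = subst (Length _) (sym (ℕ.+-identityʳ k₀)) (length-≗ (commutes C) ℓ)
    go (suc m) ws l M with L.initLast ws
    go (suc m) .(xs ++ b ∷ []) l M | xs L.∷ʳ′ b with last-step B xs b M
    ... | M′ , lt , e = subst (Length _) eq (length-≗ e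
            (length-twist b (fpf-conjugate xs (base-fpf B) (Minimal.conj M′)) (go m xs l′ M′) lt))
      where
      l′ : length xs ≡ m
      l′ = ℕ.suc-injective (trans (ℕ.+-comm 1 _) (trans (sym (L.length-++ xs)) l))
      eq : 2 ℕ.+ (k₀ ℕ.+ 2 ℕ.* m) ≡ k₀ ℕ.+ 2 ℕ.* suc m
      eq = trans (sym (ℕ.+-assoc 2 k₀ _)) (trans (cong (ℕ._+ 2 ℕ.* m) (ℕ.+-comm 2 k₀)) (trans (ℕ.+-assoc k₀ 2 _) (cong (k₀ ℕ.+_) (sym (ℕ.*-suc 2 m)))))

  σ-res : ∀ i → swap i (i + + 1) ≗ σ (res i)
  σ-res i x with letter-res i
  ... | k , e = trans (sym (swap-shift ≁-suc k x)) (cong₂ (λ a b → swap a b x) (sym e) (trans (+-shift i (+ 1) k) (cong (_+ + 1) (sym e))))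

  -- Conjugation by s_{j-1} lowers j by one, until i and j are neighbours. The resulting word is
  -- appended to a word for z in order to reach y.
  swap-word : ∀ {i j} → ¬ i ~ j → i < j → ∃ λ ws → ev ws ≗ swap i j
  -- The invariant j < i + m is strict, hence the extra one. It is kept with a smaller m because j
  -- drops by one and i never drops.
  swap-word {i} {j} i≁j i<j = go (∣ j - i ∣ ℕ.+ 1) i j i≁j i<j (bound i<j)
    where
    bound : ∀ {i j} → i < j → j < i + + (∣ j - i ∣ ℕ.+ 1)
    bound {i} {j} i<j = subst (j <_) (trans (lem i j) (cong (λ w → i + (w + + 1)) (sym (ℤ.0≤i⇒+∣i∣≡i (ℤ.i≤j⇒0≤j-i (ℤ.<⇒≤ i<j)))))) (x<x+1 j)
      where
      lem : ∀ i j → j + + 1 ≡ i + (j - i + + 1)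
      lem = solve-∀
    go : ∀ m i j → ¬ i ~ j → i < j → j < i + + m → ∃ λ ws → ev ws ≗ swap i j
    go zero i j _ i<j j< = ⊥-elim (ℤ.<-asym i<j (subst (j <_) (ℤ.+-identityʳ i) j<))
    go (suc m) i j i≁j i<j j< = step (ℤ.<-cmp (i + + 1) j)
      where
      step : _ → ∃ λ ws → ev ws ≗ swap i j
      step (tri≈ _ refl _) = res i ∷ [] , sym ∘ σ-res i
      step (tri> _ _ gt) = ⊥-elim (no-between i<j gt)
      step (tri< lt _ _) = conjugated (go m (τ i) (τ j) (≁-cong τ-affine i≁j) (proj₁ τi) (proj₂ τi))
        where
        b = j - + 1
        τ = swap b (b + + 1)
        τ-affine : Affine τ
        τ-affine = swap-affine ≁-suc
        τj : τ j ≡ b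
        τj = trans (cong τ (sym (pred-suc j))) (swap-j ≁-suc)
        i<b : i < b
        i<b = +-cancelʳ-< (+ 1) (subst (i + + 1 <_) (sym (pred-suc j)) lt)
        b<i+m : b < i + + m
        b<i+m = +-cancelʳ-< (+ 1) (subst₂ _<_ (sym (pred-suc j)) (lem₂ i (+ m)) j<)
          where
          lem₂ : ∀ i m → i + (+ 1 + m) ≡ i + m + + 1
          lem₂ = solve-∀
        τi : τ i < τ j × τ j < τ i + + m
        τi with s-view b i
        ... | up i~b e = subst₂ _<_ (sym e) (sym τj) (ℤ.≤∧≢⇒< (suc≤ i<b) (λ q → ≁-suc {i} (~-trans i~b (~-reflexive (sym q))))) ,
              subst₂ (λ a c → a < c + + m) (sym τj) (sym e) (ℤ.<-trans b<i+m (ℤ.+-monoˡ-< (+ m) (x<x+1 i)))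
        ... | down p e = ⊥-elim (i≁j (~-trans p (~-reflexive (pred-suc j))))
        ... | stay _ _ e = subst₂ _<_ (sym e) (sym τj) i<b , subst₂ (λ a c → a < c + + m) (sym τj) (sym e) b<i+m
        conjugated : (∃ λ ws → ev ws ≗ swap (τ i) (τ j)) → ∃ λ ws → ev ws ≗ swap i j
        conjugated (ws , e) = res b ∷ ws ++ res b ∷ [] , λ v → begin
          σ (res b) (ev (ws ++ res b ∷ []) v)   ≡⟨ σ-res b _ ⟨
          τ (ev (ws ++ res b ∷ []) v)  ≡⟨ cong τ (ev-++ ws (res b ∷ []) v) ⟩
          τ (ev ws (σ (res b) v))  ≡⟨ cong (τ ∘ ev ws) (σ-res b v) ⟨
          τ (ev ws (τ v))  ≡⟨ cong τ (e (τ v)) ⟩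
          τ (swap (τ i) (τ j) (τ v))  ≡⟨ cong τ (conj-swap τ-affine i≁j v) ⟨
          τ (τ (swap i j v))  ≡⟨ swap-involutive ≁-suc _ ⟩
          swap i j v  ∎
          where open ≡-Reasoning

  +-cancelʳ-≡ : ∀ c {x z} → x + c ≡ z + c → x ≡ z
  +-cancelʳ-≡ c {x} {z} e = trans (lem x c) (trans (cong (_- c) e) (sym (lem z c)))
    where
    lem : ∀ x c → x ≡ x + c - c
    lem = solve-∀

  evalWord-res : ∀ is → evalWord n is ≗ ev (map res is)
  evalWord-res [] x = refl
  evalWord-res (i ∷ is) x = trans (cong (s n i) (evalWord-res is x)) (trans (sym (swap-is-t _ _ _)) (σ-res i _))

  -- Words preserve the sum over n consecutive integers.

  window : (ℤ → ℤ) → ℤ → ℕ → ℤ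
  window f m zero = + 0
  window f m (suc l) = f m + window f (m + + 1) l

  window-cong : ∀ {f g} m l → (∀ k → k ℕ.< l → f (m + + k) ≡ g (m + + k)) → window f m l ≡ window g m l
  window-cong m zero e = refl
  window-cong {f} {g} m (suc l) e = cong₂ _+_
    (subst (λ w → f w ≡ g w) (ℤ.+-identityʳ m) (e 0 ℕ.z<s))
    (window-cong (m + + 1) l λ k lt → subst (λ w → f w ≡ g w) (lem m (+ k)) (e (suc k) (ℕ.s<s lt)))
    where
    lem : ∀ m k → m + (+ 1 + k) ≡ m + + 1 + k
    lem = solve-∀

  window-slide : ∀ f m l → window f (m + + 1) l + f m ≡ window f m l + f (m + + l)
  window-slide f m zero = cong (λ w → + 0 + f w) (sym (ℤ.+-identityʳ m))
  window-slide f m (suc l) = begin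
    f (m + + 1) + window f (m + + 1 + + 1) l + f m  ≡⟨ lem (f (m + + 1)) (window f (m + + 1 + + 1) l) (f m) ⟩
    f m + (window f (m + + 1 + + 1) l + f (m + + 1))  ≡⟨ cong (_+_ (f m)) (window-slide f (m + + 1) l) ⟩
    f m + (window f (m + + 1) l + f (m + + 1 + + l))  ≡⟨ lem₂ (f m) (window f (m + + 1) l) (f (m + + 1 + + l)) ⟩
    f m + window f (m + + 1) l + f (m + + 1 + + l)  ≡⟨ cong (λ w → f m + window f (m + + 1) l + f w) (lem₃ m (+ l)) ⟩
    f m + window f (m + + 1) l + f (m + + suc l)  ∎
    where
    open ≡-Reasoning
    lem : ∀ a b c → a + b + c ≡ c + (b + a)
    lem = solve-∀
    lem₂ : ∀ a b c → a + (b + c) ≡ a + b + c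
    lem₂ = solve-∀
    lem₃ : ∀ m l → m + + 1 + l ≡ m + (+ 1 + l)
    lem₃ = solve-∀

  window-step : ∀ {f} → Affine f → ∀ m → window f (m + + 1) n ≡ window f m n + N
  window-step {f} F m = +-cancelʳ-≡ (f m) (trans (window-slide f m n)
      (trans (cong (_+_ (window f m n)) (trans (cong f (lem m N)) (trans (periodic F m (+ 1)) (lem′ (f m) N))))
        (lem₂ (window f m n) (f m) N)))
    where
    lem : ∀ m N → m + N ≡ m + + 1 * N
    lem = solve-∀
    lem′ : ∀ m N → m + + 1 * N ≡ m + N
    lem′ = solve-∀
    lem₂ : ∀ w f N → w + (f + N) ≡ w + N + f
    lem₂ = solve-∀

  offset-≁ : ∀ x {c} → 0 ℕ.< c → c ℕ.< n → ¬ x + + c ~ x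
  offset-≁ x {c} 0<c c<n (k , e) = ℕ.<-irrefl (sym c≡0) 0<c
    where
    c≡kN : + c ≡ k * N
    c≡kN = trans (lem x (+ c)) (trans (cong (_- x) e) (lem₂ x (k * N)))
      where
      lem : ∀ x c → c ≡ x + c - x
      lem = solve-∀
      lem₂ : ∀ x c → x + c - x ≡ c
      lem₂ = solve-∀
    c≡0 : c ≡ 0
    c≡0 = ℤ.+-injective (trans c≡kN (cong (_* N) (small-multiple k (subst (λ w → ∣ w ∣ ℕ.< n) c≡kN c<n))))

  window-swap-at : ∀ {f} b → window (f ∘ swap b (b + + 1)) b n ≡ window f b n
  window-swap-at {f} b = go n 2≤n (λ _ → id)
    where
    τ = swap b (b + + 1)
    lem : ∀ a b c → a + (b + c) ≡ b + (a + c)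
    lem = solve-∀
    go : ∀ l → 2 ℕ.≤ l → (∀ k → k ℕ.< l → k ℕ.< n) → window (f ∘ τ) b l ≡ window f b l
    go (suc zero) (ℕ.s≤s ()) _
    go (suc (suc l)) _ bnd = trans (cong₂ _+_ (cong f (swap-i b (b + + 1))) (cong₂ _+_ (cong f (swap-j ≁-suc))
        (window-cong {f ∘ τ} {f} (b + + 1 + + 1) l λ k lt → cong f (fixed k lt))))
        (lem (f (b + + 1)) (f b) (window f (b + + 1 + + 1) l))
      where
      fixed : ∀ k → k ℕ.< l → τ (b + + 1 + + 1 + + k) ≡ b + + 1 + + 1 + + k
      fixed k lt = swap-off
        (λ p → offset-≁ b {2 ℕ.+ k} ℕ.z<s (bnd _ (ℕ.s<s (ℕ.s<s lt))) (~-trans (~-reflexive (lem₂ b (+ k))) p))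
        (λ p → offset-≁ (b + + 1) {1 ℕ.+ k} ℕ.z<s (bnd _ (ℕ.s<s (ℕ.m<n⇒m<1+n lt))) (~-trans (~-reflexive (lem₃ b (+ k))) p))
        where
        lem₂ : ∀ b k → b + (+ 1 + (+ 1 + k)) ≡ b + + 1 + + 1 + k
        lem₂ = solve-∀
        lem₃ : ∀ b k → b + + 1 + (+ 1 + k) ≡ b + + 1 + + 1 + k
        lem₃ = solve-∀

  -- Sliding the window by one adds n to both sums, so the exchanged pair can be brought to the
  -- start of the window, where its first two summands merely trade places.
  window-swap : ∀ {f} → Affine f → ∀ m l → window (f ∘ swap (m + + l) (m + + l + + 1)) m n ≡ window f m n
  window-swap {f} F m zero = subst (λ b → window (f ∘ swap b (b + + 1)) m n ≡ window f m n) (sym (ℤ.+-identityʳ m)) (window-swap-at m)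
  window-swap {f} F m (suc l) = +-cancelʳ-≡ N (begin
    window (f ∘ τ) m n + N  ≡⟨ window-step (∘-affine F (swap-affine ≁-suc)) m ⟨
    window (f ∘ τ) (m + + 1) n     ≡⟨ cong (λ b → window (f ∘ swap b (b + + 1)) (m + + 1) n) (lem m (+ l)) ⟩
    window (f ∘ swap (m + + 1 + + l) (m + + 1 + + l + + 1)) (m + + 1) n ≡⟨ window-swap F (m + + 1) l ⟩
    window f (m + + 1) n  ≡⟨ window-step F m ⟩
    window f m n + N  ∎)
    where
    open ≡-Reasoning
    τ = swap (m + + suc l) (m + + suc l + + 1)
    lem : ∀ m l → m + (+ 1 + l) ≡ m + + 1 + l
    lem = solve-∀

  sum-window : ∀ f → sumℤ (map f (oneTo n)) ≡ window f (+ 1) n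
  sum-window f = go n id (+ 1) (λ _ → refl)
    where
    go : ∀ l (g : ℕ → ℕ) m → (∀ k → + suc (g k) ≡ m + + k) → sumℤ (map f (map (λ k → + suc k) (L.applyUpTo g l))) ≡ window f m l
    go zero g m e = refl
    go (suc l) g m e = cong₂ _+_ (cong f (trans (e 0) (ℤ.+-identityʳ m))) (go l (g ∘ suc) (m + + 1) λ k → trans (e (suc k)) (lem m (+ k)))
      where
      lem : ∀ m k → m + (+ 1 + k) ≡ m + + 1 + k
      lem = solve-∀

  opaque
    unfolding letter

    sum-σ : ∀ {f} → Affine f → ∀ b → sumℤ (map (f ∘ σ b) (oneTo n)) ≡ sumℤ (map f (oneTo n))
    sum-σ {f} F b = trans (sum-window (f ∘ σ b)) (trans (window-swap F (+ 1) (toℕ b)) (sym (sum-window f)))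

  sum-ev : ∀ {f} → Affine f → ∀ ws → sumℤ (map (f ∘ ev ws) (oneTo n)) ≡ sumℤ (map f (oneTo n))
  sum-ev F [] = refl
  sum-ev {f} F (b ∷ ws) = trans (sum-ev (∘-affine F (σ-affine b)) ws) (sum-σ F b)

  ev-perm : ∀ ws → IsAffPerm n (ev ws)
  ev-perm ws = (λ i → trans (cong (ev ws) (lem i N)) (trans (periodic (ev-affine ws) i (+ 1)) (sym (lem (ev ws i) N)))) ,
      (iv ws , iv-ev ws , ev-iv ws) , trans (sum-ev id-affine ws) (cong sumℤ (L.map-id (oneTo n)))
    where
    lem : ∀ i N → i + N ≡ i + + 1 * N
    lem = solve-∀

  perm-≗ : ∀ {f g} → f ≗ g → IsAffPerm n f → IsAffPerm n g
  perm-≗ {f} {g} e (per , (h , hf , fh) , su) =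
    (λ i → trans (sym (e (i + N))) (trans (per i) (cong (_+ N) (e i)))) ,
    (h , (λ i → trans (cong h (sym (e i))) (hf i)) , (λ i → trans (sym (e (h i))) (fh i))) ,
    trans (cong sumℤ (L.map-cong (sym ∘ e) (oneTo n))) su

  ~-cancel-+ : ∀ c {x y} → x + c ~ y + c → x ~ y
  ~-cancel-+ c {x} {y} (k , e) = k , +-cancelʳ-≡ c (trans e (+-shift y c k))

  -- The base involutions Θ⁺ and Θ⁻.

  Far : ℤ → ℤ → Set
  Far i j = ¬ i ~ j × ¬ i + + 1 ~ j × ¬ i ~ j + + 1

  -- The letters of Θ± commute and cover ℤ by the disjoint pairs {i , i + 1}.
  far-word : ∀ is → AllPairs Far is → ∀ x
    → (Any (x ~_) is → evalWord n is x ≡ x + + 1)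
    × (Any (λ i → x ~ i + + 1) is → evalWord n is x ≡ x - + 1)
    × (¬ Any (λ i → x ~ i ⊎ x ~ i + + 1) is → evalWord n is x ≡ x)
  far-word [] _ x = (λ ()) , (λ ()) , λ _ → refl
  far-word (i ∷ is) (far ∷ fars) x = raised , lowered , unmoved
    where
    ih = far-word is fars x
    τ : ∀ {u v} → swap i (i + + 1) u ≡ v → s n i u ≡ v
    τ {u} e = trans (sym (swap-is-t _ _ u)) e
    up≡ : ∀ u → u ~ i → s n i u ≡ u + + 1
    up≡ u (k , refl) = τ (trans (swap-at-i i (i + + 1) k) (+-shift i (+ 1) k))
    down≡ : ∀ u → u ~ i + + 1 → s n i u ≡ u - + 1
    down≡ u (k , refl) = τ (trans (swap-at-j ≁-suc k) (lem i k N))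
      where
      lem : ∀ i k N → i + k * N ≡ i + + 1 + k * N - + 1
      lem = solve-∀
    stay≡ : ∀ u → ¬ u ~ i → ¬ u ~ i + + 1 → s n i u ≡ u
    stay≡ u p q = τ (swap-off p q)
    clash : ∀ is → All (Far i) is → x ~ i ⊎ x ~ i + + 1 → ¬ Any (λ j → x ~ j ⊎ x ~ j + + 1) is
    clash (j ∷ is) ((a , b , c) ∷ _) (inj₁ p) (here (inj₁ q)) = a (~-trans (~-sym p) q)
    clash (j ∷ is) ((a , b , c) ∷ _) (inj₁ p) (here (inj₂ q)) = c (~-trans (~-sym p) q)
    clash (j ∷ is) ((a , b , c) ∷ _) (inj₂ p) (here (inj₁ q)) = b (~-trans (~-sym p) q)
    clash (j ∷ is) ((a , b , c) ∷ _) (inj₂ p) (here (inj₂ q)) = a (~-cancel-+ (+ 1) (~-trans (~-sym p) q))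
    clash (j ∷ is) (_ ∷ fs) p (there q) = clash is fs p q
    raised : Any (x ~_) (i ∷ is) → s n i (evalWord n is x) ≡ x + + 1
    raised (here p) = trans (cong (s n i) (proj₂ (proj₂ ih) (clash is far (inj₁ p)))) (up≡ x p)
    raised (there p) = trans (cong (s n i) (proj₁ ih p)) (stay≡ (x + + 1) (away p far) (away′ p far))
      where
      away : ∀ {is} → Any (x ~_) is → All (Far i) is → ¬ x + + 1 ~ i
      away (here q) ((a , b , c) ∷ _) r = c (~-trans (~-sym r) (~-+ (+ 1) q))
      away (there q) (_ ∷ fs) r = away q fs r
      away′ : ∀ {is} → Any (x ~_) is → All (Far i) is → ¬ x + + 1 ~ i + + 1
      away′ (here q) ((a , b , c) ∷ _) r = a (~-trans (~-sym (~-cancel-+ (+ 1) r)) q)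
      away′ (there q) (_ ∷ fs) r = away′ q fs r
    lowered : Any (λ i → x ~ i + + 1) (i ∷ is) → s n i (evalWord n is x) ≡ x - + 1
    lowered (here p) = trans (cong (s n i) (proj₂ (proj₂ ih) (clash is far (inj₂ p)))) (down≡ x p)
    lowered (there p) = trans (cong (s n i) (proj₁ (proj₂ ih) p)) (stay≡ (x - + 1) (away p far) (away′ p far))
      where
      away : ∀ {is} → Any (λ j → x ~ j + + 1) is → All (Far i) is → ¬ x - + 1 ~ i
      away (here q) ((a , b , c) ∷ _) r = a (~-trans (~-sym r) (pred-~ q))
      away (there q) (_ ∷ fs) r = away q fs r
      away′ : ∀ {is} → Any (λ j → x ~ j + + 1) is → All (Far i) is → ¬ x - + 1 ~ i + + 1
      away′ (here q) ((a , b , c) ∷ _) r = b (~-trans (~-sym r) (pred-~ q))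
      away′ (there q) (_ ∷ fs) r = away′ q fs r
    unmoved : ¬ Any (λ j → x ~ j ⊎ x ~ j + + 1) (i ∷ is) → s n i (evalWord n is x) ≡ x
    unmoved none = trans (cong (s n i) (proj₂ (proj₂ ih) (none ∘ there)))
      (stay≡ x (λ p → none (here (inj₁ p))) (λ p → none (here (inj₂ p))))

  base-far : ∀ is → AllPairs Far is → (∀ x → Any (x ~_) is ⊎ Any (λ i → x ~ i + + 1) is) → Base (evalWord n is)
  base-far is fars cover = record
    { base-fpf = fpf-from (≗-affine (λ x → sym (evalWord-res is x)) (ev-affine (map res is))) inv nofix
    ; adjacent = adj }
    where
    Θ = evalWord n is
    up≡ : ∀ x → Any (x ~_) is → Θ x ≡ x + + 1
    up≡ x = proj₁ (far-word is fars x)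
    down≡ : ∀ x → Any (λ i → x ~ i + + 1) is → Θ x ≡ x - + 1
    down≡ x = proj₁ (proj₂ (far-word is fars x))
    adj : ∀ x → Θ x ≡ x + + 1 ⊎ Θ x ≡ x - + 1
    adj x with cover x
    ... | inj₁ p = inj₁ (up≡ x p)
    ... | inj₂ p = inj₂ (down≡ x p)
    nofix : ∀ x → Θ x ≢ x
    nofix x e with adj x
    ... | inj₁ e′ = ℤ.<-irrefl (trans (sym e) e′) (x<x+1 x)
    ... | inj₂ e′ = ℤ.<-irrefl (trans (sym e′) e) (x-1<x x)
    inv : ∀ x → Θ (Θ x) ≡ x
    inv x with cover x
    ... | inj₁ p = trans (cong Θ (up≡ x p)) (trans (down≡ (x + + 1) (Any.map (~-+ (+ 1)) p)) (suc-pred x))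
    ... | inj₂ p = trans (cong Θ (down≡ x p)) (trans (up≡ (x - + 1)
            (Any.map pred-~ p)) (pred-suc x))

  module Bases (2∣n : 2 ℕD.∣ n) where
    half : ℕ
    half = n ℕDM./ 2

    n≡2half : n ≡ 2 ℕ.* half
    n≡2half = sym (trans (ℕ.*-comm 2 half) (ℕDM.m/n*n≡m 2∣n))

    letters : (ℕ → ℤ) → List ℤ
    letters f = map f (L.upTo half)

    pairs-far : ∀ {f} o → (∀ k → f k ≡ + (o ℕ.+ 2 ℕ.* k)) → AllPairs Far (letters f)
    pairs-far {f} o f≡ = AllPairs.map⁺ (AllPairs.applyUpTo⁺₁ id half far)
      where
      far : ∀ {k l} → k ℕ.< l → l ℕ.< half → Far (f k) (f l)
      far {k} {l} k<l l<half = (λ p → beyond 0 c<n (~-trans (~-reflexive (sym j≡)) (~-sym p))) ,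
          (λ p → offset-≁ (f k + + 1) {suc c′} ℕ.z<s (ℕ.<-trans (ℕ.n<1+n _) c<n) (~-trans (~-reflexive (trans (lem (f k) (+ c′)) (sym j≡))) (~-sym p))) ,
          (λ p → beyond 1 c+1<n (~-trans (~-reflexive (trans (lem₂ (f k) (+ c)) (cong (_+ + 1) (sym j≡)))) (~-sym p)))
        where
        -- The gap between the two letters is c = 2(l - k), at most n - 2. The three congruences to
        -- refute concern c, c - 1 and c + 1, all strictly between 0 and n.
        d = l ℕ.∸ suc k
        c′ = 2 ℕ.* d
        c = 2 ℕ.+ c′
        beyond : ∀ e → e ℕ.+ c ℕ.< n → ¬ f k + + (e ℕ.+ c) ~ f k
        beyond e lt = offset-≁ (f k) (ℕ.<-≤-trans ℕ.z<s (ℕ.m≤n+m c e)) lt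
        l≡ : l ≡ suc k ℕ.+ d
        l≡ = sym (ℕ.m+[n∸m]≡n k<l)
        j≡ : f l ≡ f k + + c
        j≡ = trans (f≡ l) (trans (cong +_ (trans (cong (λ w → o ℕ.+ 2 ℕ.* w) l≡) (nat o k d))) (cong (_+ + c) (sym (f≡ k))))
          where
          nat : ∀ o k d → o ℕ.+ 2 ℕ.* (suc k ℕ.+ d) ≡ o ℕ.+ 2 ℕ.* k ℕ.+ (2 ℕ.+ 2 ℕ.* d)
          nat = ℕR.solve-∀
        2l : 2 ℕ.* l ≡ c ℕ.+ 2 ℕ.* k
        2l = trans (cong (2 ℕ.*_) l≡) (nat k d)
          where
          nat : ∀ k d → 2 ℕ.* (suc k ℕ.+ d) ≡ 2 ℕ.+ 2 ℕ.* d ℕ.+ 2 ℕ.* k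
          nat = ℕR.solve-∀
        c+1<n : suc c ℕ.< n
        c+1<n = subst (suc c ℕ.<_) (sym n≡2half) (ℕ.<-≤-trans (ℕ.s<s (ℕ.s≤s (ℕ.m≤m+n c (2 ℕ.* k))))
          (ℕ.≤-trans (ℕ.≤-reflexive (cong (2 ℕ.+_) (sym 2l))) (ℕ.≤-trans (ℕ.≤-reflexive (sym (ℕ.*-suc 2 l))) (ℕ.*-monoʳ-≤ 2 l<half))))
        c<n : c ℕ.< n
        c<n = ℕ.<-trans (ℕ.n<1+n c) c+1<n
        lem : ∀ i c → i + + 1 + (+ 1 + c) ≡ i + (+ 2 + c)
        lem = solve-∀
        lem₂ : ∀ i c → i + (+ 1 + c) ≡ i + c + + 1
        lem₂ = solve-∀

    pairs-cover : ∀ {f} o → (∀ k → f k ≡ + (o ℕ.+ 2 ℕ.* k)) → ∀ x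
      → Any (x ~_) (letters f) ⊎ Any (λ i → x ~ i + + 1) (letters f)
    pairs-cover {f} o f≡ x = cases (r ℕDM.% 2) (ℕDM.m%n<n r 2) refl
      where
      r = (x - + o) ℤ.%ℕ n
      q = (x - + o) ℤ./ℕ n
      k = r ℕDM./ 2
      k<half : k ℕ.< half
      k<half = ℕDM.m<n*o⇒m/o<n (subst (r ℕ.<_) (trans n≡2half (ℕ.*-comm 2 half)) (ℤDM.n%ℕd<d (x - + o) n))
      r≡ : ∀ e → r ℕDM.% 2 ≡ e → x ~ f k + + e
      r≡ e p = q , trans (lem x (+ o)) (trans (cong (_+_ (+ o)) (trans (ℤDM.a≡a%ℕn+[a/ℕn]*n (x - + o) n)
          (cong (λ w → + w + q * N) (trans (ℕDM.m≡m%n+[m/n]*n r 2) (cong₂ ℕ._+_ p (ℕ.*-comm k 2))))))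
          (trans (lem₂ (+ o) (+ e) (+ (2 ℕ.* k)) (q * N)) (cong (λ w → w + + e + q * N) (sym (f≡ k)))))
        where
        lem : ∀ x o → x ≡ o + (x - o)
        lem = solve-∀
        lem₂ : ∀ o e k w → o + (e + k + w) ≡ o + k + e + w
        lem₂ = solve-∀
      mem : ∀ {P : ℤ → Set} → P (f k) → Any P (letters f)
      mem p = Any.map⁺ (Any.applyUpTo⁺ id p k<half)
      cases : ∀ e → e ℕ.< 2 → r ℕDM.% 2 ≡ e → Any (x ~_) (letters f) ⊎ Any (λ i → x ~ i + + 1) (letters f)
      cases 0 _ e = inj₁ (mem (~-trans (r≡ 0 e) (~-reflexive (ℤ.+-identityʳ (f k)))))
      cases 1 _ e = inj₂ (mem (r≡ 1 e))
      cases (suc (suc _)) (ℕ.s≤s (ℕ.s≤s ())) _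

    Θ : Bool → ℤ → ℤ
    Θ true  = Θ⁺ n
    Θ false = Θ⁻ n

    θ : Bool → List ℤ
    θ true  = letters (λ k → + suc (2 ℕ.* k))
    θ false = letters (λ k → + (2 ℕ.* suc k))

    Θ-base : ∀ e → Base (Θ e)
    Θ-base true  = base-far (θ true) (pairs-far 1 (λ _ → refl)) (pairs-cover 1 (λ _ → refl))
    Θ-base false = base-far (θ false) (pairs-far 2 (λ k → cong +_ (ℕ.*-suc 2 k))) (pairs-cover 2 (λ k → cong +_ (ℕ.*-suc 2 k)))

    Θ-word : ∀ e → Θ e ≗ ev (map res (θ e))
    Θ-word true = evalWord-res (θ true)
    Θ-word false = evalWord-res (θ false)

    -- Compare at 1: it goes to 2 under s_1 in Θ⁺, and to 0 under s_n in Θ⁻.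
    Θ-distinct : ¬ Θ true ≗ Θ false
    Θ-distinct eq = absurd (trans (sym raised) (trans (eq (+ 1)) lowered))
      where
      0<half : 0 ℕ.< half
      0<half = ℕDM.m≥n⇒m/n>0 2≤n
      raised : Θ true (+ 1) ≡ + 2
      raised = proj₁ (far-word (θ true) (pairs-far 1 (λ _ → refl)) (+ 1)) (Any.map⁺ (Any.applyUpTo⁺ id ~-refl 0<half))
      last≡ : 2 ℕ.* suc (ℕ.pred half) ≡ n
      last≡ = trans (cong (2 ℕ.*_) (ℕ.suc-pred half {{ℕ.>-nonZero 0<half}})) (sym n≡2half)
      lowered : Θ false (+ 1) ≡ + 0
      lowered = proj₁ (proj₂ (far-word (θ false) (pairs-far 2 (λ k → cong +_ (ℕ.*-suc 2 k))) (+ 1)))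
        (Any.map⁺ (Any.applyUpTo⁺ id (~-trans wrap (~-reflexive (cong (λ w → + w + + 1) (sym last≡)))) (ℕ.≤-reflexive (ℕ.suc-pred half {{ℕ.>-nonZero 0<half}}))))
        where
        lem : ∀ N → + 1 ≡ N + + 1 + (- + 1) * N
        lem = solve-∀
        wrap : + 1 ~ N + + 1
        wrap = - + 1 , lem N
      absurd : + 2 ≢ + 0
      absurd ()

  -- Proper subsets of ℤ/n and their decreasing words.

  Subset : Set
  Subset = Vec Bool n

  _∈ˢ_ _∉ˢ_ : Fin n → Subset → Set
  r ∈ˢ A = V.lookup A r ≡ true
  r ∉ˢ A = V.lookup A r ≡ false

  ∈ˢ-∉ˢ : ∀ {r A} → r ∈ˢ A → r ∉ˢ A → ⊥
  ∈ˢ-∉ˢ p q with trans (sym p) q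
  ... | ()

  ¬∈ˢ⇒∉ˢ : ∀ {r A} → ¬ r ∈ˢ A → r ∉ˢ A
  ¬∈ˢ⇒∉ˢ {r} {A} p with V.lookup A r
  ... | true = ⊥-elim (p refl)
  ... | false = refl

  subset-ext : ∀ {A B : Subset} → (∀ r → r ∈ˢ A → r ∈ˢ B) → (∀ r → r ∈ˢ B → r ∈ˢ A) → A ≡ B
  subset-ext {A} {B} f g = trans (sym (V.tabulate∘lookup A)) (trans (V.tabulate-cong eq) (V.tabulate∘lookup B))
    where
    bool : ∀ {a b : Bool} → (a ≡ true → b ≡ true) → (b ≡ true → a ≡ true) → a ≡ b
    bool {true} f g = sym (f refl)
    bool {false} {true} f g = g refl
    bool {false} {false} f g = refl
    eq : ∀ r → V.lookup A r ≡ V.lookup B r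
    eq r = bool (f r) (g r)

  insert remove : Fin n → Subset → Subset
  insert c A = A V.[ c ]≔ true
  remove c A = A V.[ c ]≔ false

  ∈-insert : ∀ c A → c ∈ˢ insert c A
  ∈-insert c A = V.lookup∘update c A true

  insert-other : ∀ {c r} A → r ≢ c → V.lookup (insert c A) r ≡ V.lookup A r
  insert-other A r≢c = V.lookup∘update′ r≢c A true

  ∈-insert⁻ : ∀ {c r} A → r ∈ˢ insert c A → r ≢ c → r ∈ˢ A
  ∈-insert⁻ A p r≢c = trans (sym (insert-other A r≢c)) p

  ∈-insert⁺ : ∀ {c r A} → r ∈ˢ A → r ∈ˢ insert c A
  ∈-insert⁺ {c} {r} {A} p with r Fin.≟ c
  ... | yes refl = ∈-insert c A
  ... | no r≢c = trans (insert-other A r≢c) p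

  ∉-remove : ∀ c A → c ∉ˢ remove c A
  ∉-remove c A = V.lookup∘update c A false

  insert-remove : ∀ {c A} → c ∈ˢ A → insert c (remove c A) ≡ A
  insert-remove {c} {A} p = trans (V.[]≔-idempotent A c) (trans (cong (A V.[ c ]≔_) (sym p)) (V.[]≔-lookup A c))

  remove-insert : ∀ {c A} → c ∉ˢ A → remove c (insert c A) ≡ A
  remove-insert {c} {A} p = trans (V.[]≔-idempotent A c) (trans (cong (A V.[ c ]≔_) (sym p)) (V.[]≔-lookup A c))

  Proper : Subset → Set
  Proper A = ∃ λ r → r ∉ˢ A

  proper? : ∀ A → Dec (Proper A)
  proper? A = Fin.any? (λ r → V.lookup A r Bool.≟ false)

  -- The order condition of `CycDec` with distinctness of letters added; for reduced words
  -- `reduced-distinct` supplies the latter.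
  Later : Fin n → Fin n → Set
  Later a b = a ≢ b × ¬ letter b ~ letter a + + 1

  Decreasing : Word → Set
  Decreasing = AllPairs Later

  record Next (ws : Word) (x e : ℤ) : Set where
    constructor next
    field
      reach : x ≤ e
      stop  : ¬ res e ∈ ws
      run   : ∀ i → x ≤ i → i < e → res i ∈ ws
  open Next public

  next-self : ∀ {ws x e} → Next ws x e → ¬ res x ∈ ws → e ≡ x
  next-self {ws} {x} {e} (next r _ run) x∉ with ℤ.<-cmp x e
  ... | tri< lt _ _ = ⊥-elim (x∉ (run x ℤ.≤-refl lt))
  ... | tri≈ _ eq _ = sym eq
  ... | tri> _ _ gt = ⊥-elim (ℤ.<-irrefl refl (ℤ.≤-<-trans r gt))

  res-~ : ∀ {x r} → res x ≡ r → x ~ letter r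
  res-~ {x} refl = ~-sym (letter-res x)

  ~-res : ∀ {x r} → x ~ letter r → res x ≡ r
  ~-res {x} {r} p = trans (res-cong p) (res-letter r)

  -- A decreasing product moves x down by one if it contains s_{x-1}, and otherwise
  -- up to the next position whose generator is missing.
  ev-decreasing : ∀ {ws} → Decreasing ws → ∀ x
    → (res (x - + 1) ∈ ws → ev ws x ≡ x - + 1) × (¬ res (x - + 1) ∈ ws → Next ws x (ev ws x))
  ev-decreasing [] x = (λ ()) , λ _ → next ℤ.≤-refl (λ ()) (λ i p q → ⊥-elim (ℤ.<-irrefl refl (ℤ.≤-<-trans p q)))
  ev-decreasing {a ∷ ws} (later ∷ d) x = lower , raise
    where
    i = letter a
    a∉ : ¬ a ∈ ws
    a∉ p = proj₁ (All.lookup later p) refl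
    a+1∉ : ∀ {u} → u ~ i + + 1 → ¬ res u ∈ ws
    a+1∉ {u} q p = proj₂ (All.lookup later p) (~-trans (letter-res u) q)
    pred∉ : ∀ {u} → u ~ i + + 1 → ¬ res (u - + 1) ∈ ws
    pred∉ q p = a∉ (subst (_∈ ws) (~-res (pred-~ q)) p)
    stays : ∀ {u} → u ~ i + + 1 → ev ws u ≡ u
    stays {u} q = next-self (proj₂ (ev-decreasing d u) (pred∉ q)) (a+1∉ q)
    σ-down : ∀ {u} → u ~ i + + 1 → σ a u ≡ u - + 1
    σ-down {u} q with s-view i u
    ... | up p _ = ⊥-elim (≁-suc (~-trans (~-sym p) q))
    ... | down _ e = e
    ... | stay _ p _ = ⊥-elim (p q)
    σ-stay : ∀ {u} → res u ∈ ws → σ a u ≡ u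
    σ-stay {u} m = swap-off (λ p → a∉ (subst (_∈ ws) (~-res p) m)) (λ p → a+1∉ p m)
    lower : res (x - + 1) ∈ a ∷ ws → σ a (ev ws x) ≡ x - + 1
    lower (here p) = trans (cong (σ a) (stays (~-pred (res-~ p)))) (σ-down (~-pred (res-~ p)))
    lower (there p) = trans (cong (σ a) (proj₁ (ev-decreasing d x) p)) (σ-stay p)
    raise : ¬ res (x - + 1) ∈ a ∷ ws → Next (a ∷ ws) x (σ a (ev ws x))
    raise x-1∉ = go (proj₂ (ev-decreasing d x) (x-1∉ ∘ there)) (s-view i (ev ws x))
      where
      e = ev ws x
      go : Next ws x e → SView i e → Next (a ∷ ws) x (σ a e)
      go (next r st run) (up p eq) = subst (Next (a ∷ ws) x) (sym eq)
          (next (ℤ.≤-trans r (ℤ.<⇒≤ (x<x+1 e))) stop′ run′)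
        where
        stop′ : ¬ res (e + + 1) ∈ a ∷ ws
        stop′ (here q) = ≁-suc (~-trans (~-sym (res-~ q)) (~-+ (+ 1) p))
        stop′ (there q) = a+1∉ (~-+ (+ 1) p) q
        run′ : ∀ j → x ≤ j → j < e + + 1 → res j ∈ a ∷ ws
        run′ j x≤j j<e+1 with ℤ.<-cmp j e
        ... | tri< lt _ _ = there (run j x≤j lt)
        ... | tri≈ _ refl _ = here (~-res p)
        ... | tri> _ _ gt = ⊥-elim (no-between gt j<e+1)
      go _ (down p eq) = ⊥-elim (x-1∉ (here (~-res (pred-~ (~-cancel (ev-affine ws)
          (~-trans p (~-reflexive (sym (stays ~-refl)))))))))
      go (next r st run) (stay p q eq) = subst (Next (a ∷ ws) x) (sym eq) (next r stop′ λ j h k → there (run j h k))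
        where
        stop′ : ¬ res e ∈ a ∷ ws
        stop′ (here m) = p (res-~ m)
        stop′ (there m) = st m

  next-unique : ∀ {ws ws′ x e e′} → (∀ r → r ∈ ws → r ∈ ws′) → (∀ r → r ∈ ws′ → r ∈ ws)
    → Next ws x e → Next ws′ x e′ → e ≡ e′
  next-unique {e = e} {e′} f g (next r st run) (next r′ st′ run′) with ℤ.<-cmp e e′
  ... | tri< lt _ _ = ⊥-elim (st (g _ (run′ e r lt)))
  ... | tri≈ _ eq _ = eq
  ... | tri> _ _ gt = ⊥-elim (st′ (f _ (run e′ r′ gt)))

  _∈?_ : ∀ (r : Fin n) ws → Dec (r ∈ ws)
  r ∈? ws = Any.any? (r Fin.≟_) ws

  decreasing-unique : ∀ {ws ws′} → Decreasing ws → Decreasing ws′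
    → (∀ r → r ∈ ws → r ∈ ws′) → (∀ r → r ∈ ws′ → r ∈ ws) → ev ws ≗ ev ws′
  decreasing-unique {ws} d d′ f g x with res (x - + 1) ∈? ws
  ... | yes p = trans (proj₁ (ev-decreasing d x) p) (sym (proj₁ (ev-decreasing d′ x) (f _ p)))
  ... | no p = next-unique f g (proj₂ (ev-decreasing d x) p) (proj₂ (ev-decreasing d′ x) (p ∘ g _))

  -- By `ev-decreasing`, r occurs in a decreasing word exactly when r + 1 is moved down, so the
  -- value determines the set of letters.
  decreasing-letters : ∀ {ws ws′} → Decreasing ws → Decreasing ws′ → ev ws ≗ ev ws′ → ∀ r → r ∈ ws → r ∈ ws′
  decreasing-letters {ws} {ws′} d d′ e r p with r ∈? ws′
  ... | yes q = q
  ... | no q = ⊥-elim (ℤ.<-irrefl refl (ℤ.≤-<-trans (subst (x ≤_) ev≡ (reach (proj₂ (ev-decreasing d′ x) (q ∘ subst (_∈ ws′) x-1≡)))) (x-1<x x)))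
    where
    x = letter r + + 1
    x-1≡ : res (x - + 1) ≡ r
    x-1≡ = ~-res (pred-~ ~-refl)
    ev≡ : ev ws′ x ≡ x - + 1
    ev≡ = trans (sym (e x)) (proj₁ (ev-decreasing d x) (subst (_∈ ws) (sym x-1≡) p))

  next-missing : ∀ {ws} → Decreasing ws → ∀ {x} → ¬ res (x - + 1) ∈ ws → ¬ res (ev ws x) ∈ ws
  next-missing d p = stop (proj₂ (ev-decreasing d _) p)

  missing-next : ∀ {ws} → Decreasing ws → ∀ {x} → ¬ res (ev ws x) ∈ ws → ¬ res (x - + 1) ∈ ws
  missing-next {ws} d {x} p q = p (subst (λ w → res w ∈ ws) (sym (proj₁ (ev-decreasing d x) q)) q)

  decreasing-delete : ∀ l {c r} → Decreasing (l ++ c ∷ r) → Decreasing (l ++ r)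
  decreasing-delete [] (_ ∷ d) = d
  decreasing-delete (b ∷ l) (p ∷ d) = All.++⁺ (All.++⁻ˡ l p) (All.tail (All.++⁻ʳ l p)) ∷ decreasing-delete l d

  decreasing-before : ∀ l {c r} → Decreasing (l ++ c ∷ r) → All (λ b → Later b c) l
  decreasing-before [] d = []
  decreasing-before (b ∷ l) (p ∷ d) = All.head (All.++⁻ʳ l p) ∷ decreasing-before l d

  decreasing-after : ∀ l {c r} → Decreasing (l ++ c ∷ r) → All (Later c) r
  decreasing-after [] (p ∷ d) = p
  decreasing-after (b ∷ l) (_ ∷ d) = decreasing-after l d

  iv-before : ∀ {c} l → All (λ b → Later b c) l → iv l (letter c) ≡ letter c
  iv-before [] _ = refl
  iv-before (b ∷ l) ((p , q) ∷ ps) = trans (cong (iv l) (swap-off (λ e → p (letter-injective (~-sym e))) q)) (iv-before l ps)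

  iv-after : ∀ {c} r → All (Later c) r → iv r (letter c + + 1) ≡ letter c + + 1
  iv-after [] _ = refl
  iv-after (b ∷ r) ((p , q) ∷ ps) = trans (cong (iv r) (swap-off (λ e → q (~-sym e))
    (λ e → p (letter-injective (~-cancel-+ (+ 1) e))))) (iv-after r ps)

  -- Letters before c fix c, and letters after c fix c + 1. So the left end is a preimage of c under
  -- the whole remaining factor, while the right end ignores that factor (`decreasing-root₂`).
  -- Neither depends on where c stands inside the factor.
  decreasing-root₁ : ∀ l c r us → Decreasing (l ++ c ∷ r) → root₁ c (r ++ us) ≡ iv us (iv (l ++ r) (letter c))
  decreasing-root₁ l c r us d = trans (iv-++ r us _) (cong (iv us) (trans (cong (iv r) (sym (iv-before l (decreasing-before l d)))) (sym (iv-++ l r _))))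

  decreasing-root₂ : ∀ l c r us → Decreasing (l ++ c ∷ r) → root₂ c (r ++ us) ≡ iv us (letter c + + 1)
  decreasing-root₂ l c r us d = trans (iv-++ r us _) (cong (iv us) (iv-after r (decreasing-after l d)))

  -- The residues m - 1, m - 2, ..., m - n + 1: a decreasing word on everything but m. Filtering it
  -- serves every subset that misses m.
  cycle-from : ℤ → Word
  cycle-from m = map (λ j → res (m - + suc j)) (L.upTo (ℕ.pred n))

  cycle-decreasing : ∀ m → Decreasing (cycle-from m)
  cycle-decreasing m = AllPairs.map⁺ (AllPairs.applyUpTo⁺₁ id (ℕ.pred n) go)
    where
    go : ∀ {j k} → j ℕ.< k → k ℕ.< ℕ.pred n → Later (res (m - + suc j)) (res (m - + suc k))
    go {j} {k} j<k k<p = (λ e → offset-≁ y {suc d} ℕ.z<s (ℕ.<-trans (ℕ.n<1+n _) bound) (~-trans (~-reflexive y≡) (res-≡⇒~ e))) ,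
        λ e → offset-≁ y {suc (suc d)} ℕ.z<s bound (~-trans (~-reflexive (trans (lem y (+ d)) (cong (_+ + 1) y≡)))
          (~-trans (~-+ (+ 1) (~-sym (letter-res _))) (~-trans (~-sym e) (letter-res y))))
      where
      y = m - + suc k
      d = k ℕ.∸ suc j
      k≡ : k ≡ suc j ℕ.+ d
      k≡ = sym (ℕ.m+[n∸m]≡n j<k)
      y≡ : y + + suc d ≡ m - + suc j
      y≡ = trans (cong (λ k → m - + suc k + + suc d) k≡) (lem₁ m (+ j) (+ d))
        where
        lem₁ : ∀ m j d → m - (+ 1 + (+ 1 + j + d)) + (+ 1 + d) ≡ m - (+ 1 + j)
        lem₁ = solve-∀
      lem : ∀ y d → y + (+ 1 + (+ 1 + d)) ≡ y + (+ 1 + d) + + 1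
      lem = solve-∀
      bound : suc (suc d) ℕ.< n
      bound = ℕ.≤-trans (ℕ.s≤s (ℕ.s≤s (ℕ.≤-trans (ℕ.s≤s (ℕ.m≤n+m d j)) (ℕ.≤-reflexive (sym k≡)))))
        (ℕ.≤-trans (ℕ.s≤s k<p) (ℕ.≤-reflexive (ℕ.suc-pred n)))

  ∈-cycle : ∀ {m r} → r ≢ m → r ∈ cycle-from (letter m)
  ∈-cycle {m} {r} r≢m = Any.map⁺ (Any.applyUpTo⁺ id (sym (~-res (~-sym r~))) j<)
    where
    -- Entry j of the cycle is m - 1 - j, so r stands at j = (m - 1 - r) mod n; the excluded value j
    -- = n - 1 would mean r = m.
    u = letter m - + 1 - letter r
    j = u ℤ.%ℕ n
    q = u ℤ./ℕ n
    r~ : letter r ~ letter m - + suc j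
    r~ = - q , trans (lem (letter m) (letter r)) (trans (cong (λ w → letter m - + 1 - w) (ℤDM.a≡a%ℕn+[a/ℕn]*n u n)) (lem₂ (letter m) (+ j) q N))
      where
      lem : ∀ m r → r ≡ m - + 1 - (m - + 1 - r)
      lem = solve-∀
      lem₂ : ∀ m j q N → m - + 1 - (j + q * N) ≡ m - (+ 1 + j) + (- q) * N
      lem₂ = solve-∀
    j< : j ℕ.< ℕ.pred n
    j< = ℕ.≤∧≢⇒< (ℕ.≤-pred (subst (suc j ℕ.≤_) (sym (ℕ.suc-pred n)) (ℤDM.n%ℕd<d u n)))
      λ e → r≢m (letter-injective (~-trans r~ (- + 1 , trans (cong (λ w → letter m - + w) (trans (cong suc e) (ℕ.suc-pred n))) (lem (letter m) N))))
      where
      lem : ∀ m N → m - N ≡ m + (- + 1) * N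
      lem = solve-∀

  word-of : ∀ A → Dec (Proper A) → Word
  word-of A (yes (m , _)) = L.filter (λ r → V.lookup A r Bool.≟ true) (cycle-from (letter m))
  word-of A (no _) = []

  -- The full set has no decreasing word and gets the junk value [].
  subset-word : Subset → Word
  subset-word A = word-of A (proper? A)

  subset-word-decreasing : ∀ A → Decreasing (subset-word A)
  subset-word-decreasing A with proper? A
  ... | yes (m , _) = AllPairs.filter⁺ _ (cycle-decreasing (letter m))
  ... | no _ = []

  ∈-subset-word⁻ : ∀ {A r} → r ∈ subset-word A → r ∈ˢ A
  ∈-subset-word⁻ {A} {r} p with proper? A
  ... | yes (m , _) = proj₂ (∈P.∈-filter⁻ (λ r → V.lookup A r Bool.≟ true) {xs = cycle-from (letter m)} p)

  ∈-subset-word⁺ : ∀ {A r} → Proper A → r ∈ˢ A → r ∈ subset-word A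
  ∈-subset-word⁺ {A} {r} pr p with proper? A
  ... | yes (m , m∉) = ∈P.∈-filter⁺ (λ r → V.lookup A r Bool.≟ true) (∈-cycle (λ e → ∈ˢ-∉ˢ {A = A} p (subst (_∉ˢ A) (sym e) m∉))) p
  ... | no ¬pr = ⊥-elim (¬pr pr)

  subset-word-injective : ∀ {A B} → Proper A → Proper B → ev (subset-word A) ≗ ev (subset-word B) → A ≡ B
  subset-word-injective {A} {B} pA pB e = subset-ext
    (λ r p → ∈-subset-word⁻ (decreasing-letters (subset-word-decreasing A) (subset-word-decreasing B) e r (∈-subset-word⁺ pA p)))
    (λ r p → ∈-subset-word⁻ (decreasing-letters (subset-word-decreasing B) (subset-word-decreasing A) (sym ∘ e) r (∈-subset-word⁺ pB p)))

  -- A pigeonhole inequality for a relation instead of a map, since partners come from existence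
  -- statements. It suffices that each y is related to at most one x.
  related-length : ∀ {X Y : Set} (R : X → Y → Set) → (∀ {x x′ y} → R x y → R x′ y → x ≡ x′)
    → ∀ {xs} ys → AllPairs _≢_ xs → (∀ {x} → x ∈ xs → ∃ λ y → y ∈ ys × R x y) → length xs ℕ.≤ length ys
  related-length R inj ys [] f = ℕ.z≤n
  related-length {X} {Y} R inj {x ∷ xs} ys (x∉ ∷ u) f = go (f (here refl))
    where
    go : (∃ λ y → y ∈ ys × R x y) → suc (length xs) ℕ.≤ length ys
    go (y , y∈ , r) with ∈P.∈-∃++ y∈
    ... | as , bs , refl = subst (suc (length xs) ℕ.≤_) (sym (trans (L.length-++ as) (trans (ℕ.+-suc _ _) (cong suc (sym (L.length-++ as))))))
            (ℕ.s≤s (related-length R inj (as ++ bs) u restrict′))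
      where
      drop : ∀ {y′} as → y′ ∈ as ++ y ∷ bs → y′ ≢ y → y′ ∈ as ++ bs
      drop [] (here p) q = ⊥-elim (q p)
      drop [] (there p) q = p
      drop (a ∷ as) (here p) q = here p
      drop (a ∷ as) (there p) q = there (drop as p q)
      restrict′ : ∀ {x′} → x′ ∈ xs → ∃ λ y′ → y′ ∈ as ++ bs × R x′ y′
      restrict′ {x′} m with f (there m)
      ... | y′ , m′ , r′ = y′ , drop as m′ (λ { refl → All.lookup x∉ m (inj r r′) }) , r′

  decreasing-distinct : ∀ {ws} → Decreasing ws → AllPairs _≢_ ws
  decreasing-distinct = AllPairsB.map proj₁

  same-letters-length : ∀ {ws ws′} → Decreasing ws → (∀ r → r ∈ ws → r ∈ ws′) → length ws ℕ.≤ length ws′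
  same-letters-length d f = related-length _≡_ (λ p q → trans p (sym q)) _ (decreasing-distinct d) (λ {r} m → r , f r m , refl)

  record InsertionSplit (c : Fin n) (A : Subset) (l r : Word) : Set where
    constructor insertion-split
    field
      decreasing : Decreasing (l ++ c ∷ r)
      same-value : ev (l ++ r) ≗ ev (subset-word A)
      same-size  : length (l ++ r) ≡ length (subset-word A)

  insert-split : ∀ {c A} → Proper (insert c A) → ∃₂ λ l r → subset-word (insert c A) ≡ l ++ c ∷ r
  insert-split {c} {A} pr = ∈P.∈-∃++ (∈-subset-word⁺ pr (∈-insert c A))

  -- `l ++ r` and `subset-word A` can be different words, because `word-of` starts at whichever
  -- missing residue the search returns. Being decreasing on the same letters, they agree in value
  -- and length.
  insertion : ∀ {c A} → c ∉ˢ A → Proper (insert c A) → ∀ l r → subset-word (insert c A) ≡ l ++ c ∷ r → InsertionSplit c A l r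
  insertion {c} {A} c∉ pr l r e = insertion-split d (decreasing-unique d′ (subset-word-decreasing A) f g)
      (ℕ.≤-antisym (same-letters-length d′ f) (same-letters-length (subset-word-decreasing A) g))
    where
    pA : Proper A
    pA = c , c∉
    d : Decreasing (l ++ c ∷ r)
    d = subst Decreasing e (subset-word-decreasing (insert c A))
    d′ : Decreasing (l ++ r)
    d′ = decreasing-delete l d
    add : ∀ {b} l → b ∈ l ++ r → b ∈ l ++ c ∷ r
    add [] p = there p
    add (_ ∷ l) (here p) = here p
    add (_ ∷ l) (there p) = there (add l p)
    rem : ∀ {b} l → b ∈ l ++ c ∷ r → b ≢ c → b ∈ l ++ r
    rem [] (here p) q = ⊥-elim (q p)
    rem [] (there p) q = p
    rem (_ ∷ l) (here p) q = here p
    rem (_ ∷ l) (there p) q = there (rem l p q)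
    fresh : ∀ l → Decreasing (l ++ c ∷ r) → ¬ c ∈ l ++ r
    fresh [] (p ∷ _) m = proj₁ (All.lookup p m) refl
    fresh (b ∷ l) (p ∷ _) (here refl) = proj₁ (All.head (All.++⁻ʳ l p)) refl
    fresh (b ∷ l) (p ∷ d) (there m) = fresh l d m
    f : ∀ b → b ∈ l ++ r → b ∈ subset-word A
    f b m = ∈-subset-word⁺ pA (∈-insert⁻ A (∈-subset-word⁻ (subst (b ∈_) (sym e) (add l m))) (λ { refl → fresh l d m }))
    g : ∀ b → b ∈ subset-word A → b ∈ l ++ r
    g b m = rem l (subst (b ∈_) e (∈-subset-word⁺ pr (∈-insert⁺ {c} {b} {A} (∈-subset-word⁻ m))))
      (λ { refl → ∈ˢ-∉ˢ {A = A} (∈-subset-word⁻ m) c∉ })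

  length-insert-word : ∀ {c A} → c ∉ˢ A → Proper (insert c A) → length (subset-word (insert c A)) ≡ suc (length (subset-word A))
  length-insert-word {c} {A} c∉ pr with insert-split {c} {A} pr
  ... | l , r , e = trans (cong length e) (trans (length-insert l c r) (cong suc (InsertionSplit.same-size (insertion c∉ pr l r e))))

  unique-left : ∀ {c} l {r} l′ {r′} → Decreasing (l ++ c ∷ r) → l ++ c ∷ r ≡ l′ ++ c ∷ r′ → l ≡ l′
  unique-left {c} l {r} l′ {r′} d e with ℕ.<-cmp (length l) (length l′)
  ... | tri≈ _ eq _ = proj₁ (split-equal l l′ e eq)
  ... | tri< lt _ _ with split-order l l′ e lt
  ...   | m , _ , refl = ⊥-elim (proj₁ (All.lookup (decreasing-after l d) (∈P.∈-++⁺ʳ m (here refl))) refl)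
  unique-left {c} l {r} l′ {r′} d e | tri> _ _ gt with split-order l′ l (sym e) gt
  ... | m , refl , _ = ⊥-elim (proj₁ (All.lookup (decreasing-before (l′ ++ c ∷ m) d) (∈P.∈-++⁺ʳ l′ (here refl))) refl)

  letters-subset : Word → Subset
  letters-subset ws = V.tabulate (λ r → Dec.does (r ∈? ws))

  ∈-letters⁻ : ∀ {ws r} → r ∈ˢ letters-subset ws → r ∈ ws
  ∈-letters⁻ {ws} {r} p = dec (trans (sym (V.lookup∘tabulate _ r)) p)
    where
    dec : Dec.does (r ∈? ws) ≡ true → r ∈ ws
    dec e with r ∈? ws
    ... | yes m = m

  ∈-letters⁺ : ∀ {ws r} → r ∈ ws → r ∈ˢ letters-subset ws
  ∈-letters⁺ {ws} {r} m = trans (V.lookup∘tabulate _ r) (Dec.dec-true (r ∈? ws) m)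

  -- After a first letter a, the generator a + 1 is missing: later letters avoid it by the order
  -- condition, and a differs from it because n ≥ 2.
  decreasing-proper : ∀ {ws} → Decreasing ws → Proper (letters-subset ws)
  decreasing-proper {[]} d = res (+ 0) , ¬∈ˢ⇒∉ˢ {A = letters-subset []} λ p → absurd (∈-letters⁻ p)
    where
    absurd : ∀ {r : Fin n} → ¬ r ∈ []
    absurd ()
  decreasing-proper {a ∷ ws} (p ∷ d) = r , ¬∈ˢ⇒∉ˢ {A = letters-subset (a ∷ ws)} (missing ∘ ∈-letters⁻)
    where
    r = res (letter a + + 1)
    missing : ¬ r ∈ a ∷ ws
    missing (here e) = ≁-suc (~-sym (res-~ e))
    missing (there m) = proj₂ (All.lookup p m) (letter-res _)

  letters-word : ∀ {ws} → Decreasing ws → ev (subset-word (letters-subset ws)) ≗ ev ws × length (subset-word (letters-subset ws)) ≡ length ws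
  letters-word {ws} d = decreasing-unique d′ d f g , ℕ.≤-antisym (same-letters-length d′ f) (same-letters-length d g)
    where
    d′ = subset-word-decreasing (letters-subset ws)
    f : ∀ r → r ∈ subset-word (letters-subset ws) → r ∈ ws
    f r m = ∈-letters⁻ (∈-subset-word⁻ m)
    g : ∀ r → r ∈ ws → r ∈ subset-word (letters-subset ws)
    g r m = ∈-subset-word⁺ (decreasing-proper d) (∈-letters⁺ m)

  -- Cyclically decreasing elements are values of decreasing words.

  Reduced : Word → Set
  Reduced ws = ∀ ws′ → ev ws′ ≗ ev ws → length ws ℕ.≤ length ws′

  reduced-length : ∀ {ws} → Reduced ws → Length (ev ws) (length ws)
  reduced-length {ws} red = record { word = ws ; value = λ _ → refl ; size = refl ; least = red }

  reduced-middle : ∀ xs ys zs → Reduced (xs ++ ys ++ zs) → Reduced ys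
  reduced-middle xs ys zs red ys′ e = ℕ.+-cancelʳ-≤ (length zs) _ _ (ℕ.+-cancelˡ-≤ (length xs) _ _
    (subst₂ ℕ._≤_ (len ys) (len ys′) (red (xs ++ ys′ ++ zs) λ v → trans (val ys′ v) (trans (cong (ev xs) (e (ev zs v))) (sym (val ys v))))))
    where
    len : ∀ ws → length (xs ++ ws ++ zs) ≡ length xs ℕ.+ (length ws ℕ.+ length zs)
    len ws = trans (L.length-++ xs) (cong (length xs ℕ.+_) (L.length-++ ws))
    val : ∀ ws v → ev (xs ++ ws ++ zs) v ≡ ev xs (ev ws (ev zs v))
    val ws v = trans (ev-++ xs (ws ++ zs) v) (cong (ev xs) (ev-++ ws zs v))

  reduced-tail : ∀ {b ws} → Reduced (b ∷ ws) → Reduced ws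
  reduced-tail {b} red ws′ e = ℕ.≤-pred (red (b ∷ ws′) (λ v → cong (σ b) (e v)))

  s-next⇒~ : ∀ {a b} → s n (letter a + + 1) ≗ s n (letter b) → letter b ~ letter a + + 1
  s-next⇒~ {a} {b} e = go (s-view (letter a + + 1) (letter b))
    where
    moved : swap (letter a + + 1) (letter a + + 1 + + 1) (letter b) ≡ letter b + + 1
    moved = trans (swap-is-t _ _ _) (trans (e (letter b)) (trans (sym (swap-is-t _ _ _)) (swap-i (letter b) (letter b + + 1))))
    go : SView (letter a + + 1) (letter b) → letter b ~ letter a + + 1
    go (up p _) = p
    go (down _ q) = ⊥-elim (ℤ.<-asym (x-1<x (letter b)) (subst (letter b <_) (trans (sym moved) q) (x<x+1 (letter b))))
    go (stay _ _ q) = ⊥-elim (ℤ.<-irrefl (trans (sym q) moved) (x<x+1 (letter b)))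

  ~⇒s-next : ∀ {a b} → letter b ~ letter a + + 1 → s n (letter a + + 1) ≗ s n (letter b)
  ~⇒s-next {a} {b} p v = trans (sym (swap-is-t _ _ v)) (trans (σ-res (letter a + + 1) v)
    (trans (cong (λ r → σ r v) (~-res {letter a + + 1} {b} (~-sym p))) (swap-is-t _ _ v)))

  decreasing⇒CycDec : ∀ {ws} → Decreasing ws → Reduced ws → CycDec n (ev ws)
  decreasing⇒CycDec {ws} d red = map letter ws , gen-word ws , (λ x → sym (ev-is-evalWord ws x)) ,
    subst (Len n (ev ws)) (sym (L.length-map letter ws)) (length⇒Len (reduced-length {ws} red)) ,
    AllPairs.map⁺ (AllPairsB.map (λ {a} {b} (_ , q) e → q (s-next⇒~ {a} {b} e)) d)

  σ-commute : ∀ {a b} → ¬ letter a ~ letter b → ¬ letter b ~ letter a + + 1 → ¬ letter a ~ letter b + + 1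
    → σ a ∘ σ b ≗ σ b ∘ σ a
  σ-commute {a} {b} p q r v = trans (conj-swap (σ-affine a) ≁-suc v)
    (cong₂ (λ i j → swap i j (σ a v)) (swap-off (p ∘ ~-sym) q) (swap-off (r ∘ ~-sym) (λ m → p (~-sym (~-cancel-+ (+ 1) m)))))

  NoAscent : Word → Set
  NoAscent = AllPairs (λ a b → ¬ letter b ~ letter a + + 1)

  -- Between two occurrences of a there is neither a + 1 nor a - 1, so the two cancel.
  reduced-distinct : ∀ {ws} → NoAscent ws → Reduced ws → Decreasing ws
  reduced-distinct {[]} [] red = []
  reduced-distinct {a ∷ ws} (p ∷ na) red = All.zipWith id (All.tabulate fresh , p) ∷ d
    where
    d = reduced-distinct na (reduced-tail {a} {ws} red)
    fresh : ∀ {b} → b ∈ ws → a ≢ b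
    fresh b∈ refl = clash (∈P.∈-∃++ b∈)
      where
      clash : ¬ (∃₂ λ l r → ws ≡ l ++ L.[ a ] ++ r)
      clash (l , r , refl) = ℕ.<-irrefl refl (ℕ.<-≤-trans short (red (l ++ r) cancel))
        where
        short : length (l ++ r) ℕ.< length (a ∷ l ++ a ∷ r)
        short = ℕ.s≤s (subst (length (l ++ r) ℕ.≤_) (sym (length-insert l a r)) (ℕ.n≤1+n _))
        through : ∀ l → All (λ b → ¬ letter b ~ letter a + + 1) l → All (λ b → Later b a) l → σ a ∘ ev l ≗ ev l ∘ σ a
        through [] _ _ v = refl
        through (b ∷ l) (q ∷ qs) ((e , m) ∷ ms) v =
          trans (σ-commute (λ z → e (sym (letter-injective z))) q m (ev l v)) (cong (σ b) (through l qs ms v))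
        cancel : ev (l ++ r) ≗ ev (a ∷ l ++ a ∷ r)
        cancel v = sym (begin
          σ a (ev (l ++ a ∷ r) v)  ≡⟨ cong (σ a) (ev-++ l (a ∷ r) v) ⟩
          σ a (ev l (σ a (ev r v)))      ≡⟨ through l (All.++⁻ˡ l p) (decreasing-before l d) _ ⟩
          ev l (σ a (σ a (ev r v)))      ≡⟨ cong (ev l) (σ-involutive a (ev r v)) ⟩
          ev l (ev r v)  ≡⟨ ev-++ l r v ⟨
          ev (l ++ r) v  ∎)
          where open ≡-Reasoning

  CycDec⇒decreasing : ∀ {f k} → CycDec n f → Len n f k → ∃ λ ws → Decreasing ws × ev ws ≗ f × length ws ≡ k
  CycDec⇒decreasing {f} {k} (us , gen , val , len , asc) len′ = go (gen-lift gen)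
    where
    go : (∃ λ vs → map letter vs ≡ us) → ∃ λ ws → Decreasing ws × ev ws ≗ f × length ws ≡ k
    go (vs , refl) = vs , reduced-distinct (AllPairsB.map (λ {a} {b} h p → h (~⇒s-next {a} {b} p)) (AllPairs.map⁻ asc)) red , val′ ,
        trans (sym (L.length-map letter vs)) (length-unique (λ _ → refl) (Len⇒length len) (Len⇒length len′))
      where
      val′ : ev vs ≗ f
      val′ x = trans (ev-is-evalWord vs x) (val x)
      red : Reduced vs
      red ws e = subst (ℕ._≤ length ws) (L.length-map letter vs) (least (Len⇒length len) ws (λ x → trans (e x) (val′ x)))

  -- Finite enumeration and decidability of minimality.

  lists : ∀ {X : Set} → List X → ℕ → List (List X)
  lists xs zero = [] ∷ []
  lists xs (suc m) = [] ∷ L.cartesianProductWith _∷_ xs (lists xs m)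

  ∈-lists : ∀ {X : Set} {xs : List X} → (∀ x → x ∈ xs) → ∀ m l → length l ℕ.≤ m → l ∈ lists xs m
  ∈-lists all zero [] _ = here refl
  ∈-lists all (suc m) [] _ = here refl
  ∈-lists all (suc m) (x ∷ l) (ℕ.s≤s h) = there (∈P.∈-cartesianProductWith⁺ _∷_ (all x) (∈-lists all m l h))

  bools : List Bool
  bools = true ∷ false ∷ []

  ∈-bools : ∀ b → b ∈ bools
  ∈-bools true = here refl
  ∈-bools false = there (here refl)

  vectors : ∀ m → List (Vec Bool m)
  vectors zero = V.[] ∷ []
  vectors (suc m) = L.cartesianProductWith V._∷_ bools (vectors m)

  ∈-vectors : ∀ {m} (v : Vec Bool m) → v ∈ vectors m
  ∈-vectors V.[] = here refl
  ∈-vectors (b V.∷ v) = ∈P.∈-cartesianProductWith⁺ V._∷_ (∈-bools b) (∈-vectors v)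

  affine-≗? : ∀ {f g} → Affine f → Affine g → Dec (f ≗ g)
  affine-≗? {f} {g} F G = map′ extend (λ e r → e (letter r)) (Fin.all? (λ r → f (letter r) ℤ.≟ g (letter r)))
    where
    extend : (∀ r → f (letter r) ≡ g (letter r)) → f ≗ g
    extend e x with ~-sym (letter-res x)
    ... | k , x≡ = trans (cong f x≡) (trans (periodic F _ k) (trans (cong (_+ k * N) (e (res x)))
                     (trans (sym (periodic G _ k)) (cong g (sym x≡)))))

  conjugates? : ∀ {Θ y} → Affine Θ → Affine y → ∀ ws → Dec (Conjugates Θ (ev ws) y)
  conjugates? T Y ws = map′ conjugates commutes (affine-≗? (∘-affine T (ev-affine ws)) (∘-affine (ev-affine ws) Y))

  -- A better competitor has length at most that of `ws`, so a finite list of words has to be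
  -- tested.
  minimal? : ∀ {Θ y} → Affine Θ → Affine y → ∀ ws → Dec (Minimal Θ ws y)
  minimal? {Θ} {y} T Y ws with conjugates? T Y ws
  ... | no ¬c = no (¬c ∘ Minimal.conj)
  ... | yes c = map′ to from (All.all? (λ v → ¬-or-long v) (lists (L.allFin n) (length ws)))
    where
    Bad : Word → Set
    Bad v = Conjugates Θ (ev v) y → length ws ℕ.≤ length v
    ¬-or-long : ∀ v → Dec (Bad v)
    ¬-or-long v with conjugates? T Y v | length ws ℕ.≤? length v
    ... | no ¬c | _ = yes (⊥-elim ∘ ¬c)
    ... | yes _ | yes l = yes (λ _ → l)
    ... | yes c | no ¬l = no (λ f → ¬l (f c))
    to : All Bad (lists (L.allFin n) (length ws)) → Minimal Θ ws y
    to all = minimal c bound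
      where
      bound : ∀ v → Conjugates Θ (ev v) y → length ws ℕ.≤ length v
      bound v cv with ℕ.≤-total (length ws) (length v)
      ... | inj₁ l = l
      ... | inj₂ l = All.lookup all (∈-lists ∈P.∈-allFin (length ws) v l) cv
    from : Minimal Θ ws y → All Bad (lists (L.allFin n) (length ws))
    from M = All.tabulate (λ {v} _ → Minimal.least M v)

  length-filter-split : ∀ {X : Set} {P : X → Set} (P? : ∀ x → Dec (P x)) xs
    → length xs ≡ length (L.filter P? xs) ℕ.+ length (L.filter (λ x → ¬? (P? x)) xs)
  length-filter-split P? [] = refl
  length-filter-split P? (x ∷ xs) with P? x
  ... | yes _ = cong suc (length-filter-split P? xs)
  ... | no _ = trans (cong suc (length-filter-split P? xs)) (sym (ℕ.+-suc _ _))

  -- Locating a letter inside a factorization.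

  words : List Subset → Word
  words = L.concatMap subset-word

  words-++ : ∀ Bs Cs → words (Bs ++ Cs) ≡ words Bs ++ words Cs
  words-++ = L.concatMap-++ subset-word

  split-append : ∀ (as : Word) {bs} xs {c ys} → as ++ bs ≡ xs ++ c ∷ ys
    → (∃ λ r → as ≡ xs ++ c ∷ r × ys ≡ r ++ bs) ⊎ (∃ λ m → xs ≡ as ++ m × bs ≡ m ++ c ∷ ys)
  split-append [] xs e = inj₂ (xs , refl , e)
  split-append (a ∷ as) [] refl = inj₁ (as , refl , refl)
  split-append (a ∷ as) (x ∷ xs) e with L.∷-injective e
  ... | refl , e′ with split-append as xs e′
  ...   | inj₁ (r , refl , q) = inj₁ (r , refl , q)
  ...   | inj₂ (m , refl , q) = inj₂ (m , refl , q)

  split-words : ∀ Bs xs {c ys} → words Bs ≡ xs ++ c ∷ ys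
    → ∃ λ pre → ∃ λ B → ∃ λ post → ∃ λ l → ∃ λ r →
      Bs ≡ pre ++ B ∷ post × subset-word B ≡ l ++ c ∷ r × xs ≡ words pre ++ l × ys ≡ r ++ words post
  split-words [] [] ()
  split-words [] (_ ∷ _) ()
  split-words (B ∷ Bs) xs e with split-append (subset-word B) xs e
  ... | inj₁ (r , p , q) = [] , B , Bs , xs , r , refl , p , refl , q
  ... | inj₂ (m , refl , q) with split-words Bs m q
  ...   | pre , C , post , l , r , refl , e₁ , refl , e₃ =
          B ∷ pre , C , post , l , r , refl , e₁ , sym (L.++-assoc (subset-word B) (words pre) l) , e₃

  too-long : ∀ pre C l {c r} → subset-word C ≡ l ++ c ∷ r → ∀ l′ → length l ≢ length ((subset-word C ++ words pre) ++ l′)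
  too-long pre C l e l′ len = ℕ.<-irrefl len (ℕ.<-≤-trans (ℕ.m<m+n (length l) ℕ.z<s)
    (ℕ.≤-trans (ℕ.≤-reflexive (trans (sym (L.length-++ l)) (cong length (sym e))))
      (ℕ.≤-trans (ℕ.m≤m+n (length (subset-word C)) (length (words pre ++ l′)))
        (ℕ.≤-reflexive (trans (sym (L.length-++ (subset-word C))) (cong length (sym (L.++-assoc (subset-word C) (words pre) l′))))))))

  -- The position of a letter in the whole word determines its factor even when empty factors occur,
  -- because the factor must actually contain the letter.
  same-place : ∀ pre₁ {B₁ post₁} pre₂ {B₂ post₂ l₁ r₁ l₂ r₂ c₁ c₂} → pre₁ ++ B₁ ∷ post₁ ≡ pre₂ ++ B₂ ∷ post₂
    → subset-word B₁ ≡ l₁ ++ c₁ ∷ r₁ → subset-word B₂ ≡ l₂ ++ c₂ ∷ r₂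
    → length (words pre₁ ++ l₁) ≡ length (words pre₂ ++ l₂)
    → pre₁ ≡ pre₂ × B₁ ≡ B₂ × post₁ ≡ post₂ × c₁ ≡ c₂
  same-place [] [] {l₁ = l₁} {l₂ = l₂} refl e₁ e₂ len = refl , refl , refl , proj₁ (proj₂ (split-equal l₁ l₂ (trans (sym e₁) e₂) len))
  same-place (C ∷ pre₁) (C′ ∷ pre₂) e e₁ e₂ len with L.∷-injective e
  ... | refl , e′ with same-place pre₁ pre₂ e′ e₁ e₂ (ℕ.+-cancelˡ-≡ (length (subset-word C)) _ _
                         (trans (sym (assoc pre₁ _)) (trans len (assoc pre₂ _))))
    where
    assoc : ∀ pre l → length ((subset-word C ++ words pre) ++ l) ≡ length (subset-word C) ℕ.+ length (words pre ++ l)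
    assoc pre l = trans (cong length (L.++-assoc (subset-word C) (words pre) l)) (L.length-++ (subset-word C))
  ...   | refl , refl , refl , refl = refl , refl , refl , refl
  same-place [] (C ∷ pre₂) {l₁ = l₁} {r₁} {l₂} {c₁ = c₁} refl e₁ e₂ len = ⊥-elim (too-long pre₂ C l₁ e₁ l₂ len)
  same-place (C ∷ pre₁) [] {l₁ = l₁} {l₂ = l₂} {r₂} {c₂ = c₂} refl e₁ e₂ len = ⊥-elim (too-long pre₁ C l₂ e₂ l₁ (sym len))

  no-three-distinct-splits : ∀ {Θ y Z W} → Conjugates Θ (ev W) Z → (s₁ s₂ s₃ : MinimalSplit Θ y W) → let open MinimalSplit in
    position s₁ ≢ position s₂ → position s₂ ≢ position s₃ → position s₁ ≢ position s₃ → ⊥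
  no-three-distinct-splits C s₁ s₂ s₃ n₁₂ n₂₃ n₁₃
    with ℕ.<-cmp (position s₁) (position s₂) | ℕ.<-cmp (position s₂) (position s₃) | ℕ.<-cmp (position s₁) (position s₃)
    where open MinimalSplit
  ... | tri≈ _ e _ | _ | _ = n₁₂ e
  ... | _ | tri≈ _ e _ | _ = n₂₃ e
  ... | _ | _ | tri≈ _ e _ = n₁₃ e
  ... | tri< a _ _ | tri< b _ _ | _ = no-three-splits C s₁ s₂ s₃ a b
  ... | tri< a _ _ | tri> _ _ b | tri< c _ _ = no-three-splits C s₁ s₃ s₂ c b
  ... | tri< a _ _ | tri> _ _ b | tri> _ _ c = no-three-splits C s₃ s₁ s₂ c a
  ... | tri> _ _ a | tri< b _ _ | tri< c _ _ = no-three-splits C s₂ s₁ s₃ a c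
  ... | tri> _ _ a | tri< b _ _ | tri> _ _ c = no-three-splits C s₂ s₃ s₁ b c
  ... | tri> _ _ a | tri> _ _ b | _ = no-three-splits C s₃ s₂ s₁ b a

  ordered-splits-reversed : ∀ {Θ y Z} → Base Θ → ∀ W xs c ys xs′ c′ ys′ → W ≡ xs ++ c ∷ ys → W ≡ xs′ ++ c′ ∷ ys′
    → length xs ℕ.< length xs′ → Minimal Θ (xs ++ ys) y → Minimal Θ (xs′ ++ ys′) y
    → Conjugates Θ (ev W) Z → Generic y (root₁ c ys) (root₂ c ys)
    → Reversed y (root₁ c ys) (root₂ c ys) (root₁ c′ ys′) (root₂ c′ ys′)
  ordered-splits-reversed B W xs c ys xs′ c′ ys′ refl e lt M M′ C G with split-order xs xs′ e lt
  ... | m , refl , refl = splits-reversed B xs c m c′ ys′ M (minimal-word (L.++-assoc xs (c ∷ m) ys′) M′) C G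

  -- Factorizations with a distinguished letter, and their two pairings.

  module Count (2∣n : 2 ℕD.∣ n) {y : ℤ → ℤ} (Y : FPF y) (p q : ℤ) (yp : y p ≡ q) (a : List ℕ) where
    open Bases 2∣n

    Marked : ℤ → Set
    Marked v = v ~ p ⊎ v ~ q

    marked-~ : ∀ {u v} → u ~ v → Marked v → Marked u
    marked-~ r (inj₁ m) = inj₁ (~-trans r m)
    marked-~ r (inj₂ m) = inj₂ (~-trans r m)

    marked-image : ∀ {v} → Marked v → Marked (y v)
    marked-image (inj₁ m) = inj₂ (~-trans (~-cong (affine Y) m) (~-reflexive yp))
    marked-image (inj₂ m) = inj₁ (~-trans (~-cong (affine Y) m) (~-reflexive (trans (cong y (sym yp)) (involutive Y p))))

    marked-preimage : ∀ {v} → Marked (y v) → Marked v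
    marked-preimage {v} m = subst Marked (involutive Y v) (marked-image m)

    -- An item (e , pre , A , post , c) encodes the factorization pre ++ (A ∪ {c}) ∷ post of an
    -- atom relative to Θ e, together with the letter c whose deletion leads to y.
    Item : Set
    Item = Bool × List Subset × Subset × List Subset × Fin n

    sign : Item → Bool
    sign (e , _) = e

    filled : Item → List Subset
    filled (e , pre , A , post , c) = pre ++ insert c A ∷ post

    deleted : Item → Word
    deleted (e , pre , A , post , c) = words pre ++ subset-word A ++ words post

    total : Item → Word
    total i = words (filled i)

    -- The root of c in the form given by `decreasing-root₁` and `decreasing-root₂`. The left end,
    -- `true`, is the one tested for Π⁺, and the right end, `false`, the one tested for Π⁻.
    end : Bool → Item → ℤ
    end true  (e , pre , A , post , c) = iv (words post) (iv (subset-word A) (letter c))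
    end false (e , pre , A , post , c) = iv (words post) (letter c + + 1)

    target : Item → ℤ → ℤ
    target i = twist y (end true i) (end false i)

    sizes : List Subset → List ℕ
    sizes = map (length ∘ subset-word)

    Fresh : Item → Set
    Fresh (e , pre , A , post , c) = c ∉ˢ A

    -- Minimality is asked only of the word with the letter deleted, which stays the same when c
    -- slides; minimality of the total need not survive a slide.
    record Admissible (i : Item) : Set where
      field
        fresh  : Fresh i
        proper : All Proper (filled i)
        shape  : sizes (filled i) ≡ a
        min    : Minimal (Θ (sign i)) (deleted i) y
    open Admissible

    record Location (i : Item) (xs : Word) (c : Fin n) (ys : Word) : Set where
      field
        whole : total i ≡ xs ++ c ∷ ys
        min   : Minimal (Θ (sign i)) (xs ++ ys) y
        left  : root₁ c ys ≡ end true i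
        right : root₂ c ys ≡ end false i

    module _ {c A l r} (I : InsertionSplit c A l r) (us vs : Word) where
      open InsertionSplit I

      insertion-value : ev ((us ++ l) ++ (r ++ vs)) ≗ ev (us ++ subset-word A ++ vs)
      insertion-value v = begin
        ev ((us ++ l) ++ (r ++ vs)) v  ≡⟨ cong (λ w → ev w v) (trans (L.++-assoc us l _) (cong (us ++_) (sym (L.++-assoc l r vs)))) ⟩
        ev (us ++ (l ++ r) ++ vs) v  ≡⟨ trans (ev-++ us _ v) (cong (ev us) (ev-++ (l ++ r) vs v)) ⟩
        ev us (ev (l ++ r) (ev vs v))  ≡⟨ cong (ev us) (same-value (ev vs v)) ⟩
        ev us (ev (subset-word A) (ev vs v))    ≡⟨ trans (ev-++ us _ v) (cong (ev us) (ev-++ (subset-word A) vs v)) ⟨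
        ev (us ++ subset-word A ++ vs) v  ∎
        where open ≡-Reasoning

      insertion-size : length ((us ++ l) ++ (r ++ vs)) ≡ length (us ++ subset-word A ++ vs)
      insertion-size = begin
        length ((us ++ l) ++ (r ++ vs))  ≡⟨ cong length (trans (L.++-assoc us l _) (cong (us ++_) (sym (L.++-assoc l r vs)))) ⟩
        length (us ++ (l ++ r) ++ vs)  ≡⟨ trans (L.length-++ us) (cong (length us ℕ.+_) (L.length-++ (l ++ r))) ⟩
        length us ℕ.+ (length (l ++ r) ℕ.+ length vs) ≡⟨ cong (λ k → length us ℕ.+ (k ℕ.+ length vs)) same-size ⟩
        length us ℕ.+ (length (subset-word A) ℕ.+ length vs) ≡⟨ trans (L.length-++ us) (cong (length us ℕ.+_) (L.length-++ (subset-word A))) ⟨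
        length (us ++ subset-word A ++ vs)  ∎
        where open ≡-Reasoning

    total-split : ∀ {c A} pre post l r → subset-word (insert c A) ≡ l ++ c ∷ r
      → words (pre ++ insert c A ∷ post) ≡ (words pre ++ l) ++ c ∷ (r ++ words post)
    total-split {c} {A} pre post l r e = begin
      words (pre ++ insert c A ∷ post)  ≡⟨ words-++ pre (insert c A ∷ post) ⟩
      words pre ++ subset-word (insert c A) ++ words post ≡⟨ cong (λ w → words pre ++ w ++ words post) e ⟩
      words pre ++ (l ++ c ∷ r) ++ words post  ≡⟨ cong (words pre ++_) (L.++-assoc l (c ∷ r) _) ⟩
      words pre ++ l ++ c ∷ (r ++ words post)  ≡⟨ L.++-assoc (words pre) l _ ⟨
      (words pre ++ l) ++ c ∷ (r ++ words post)  ∎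
      where open ≡-Reasoning

    proper-at : ∀ pre {B post} → All Proper (pre ++ B ∷ post) → Proper B
    proper-at pre ps = All.head (All.++⁻ʳ pre ps)

    locate : ∀ {e pre A post c} → Admissible (e , pre , A , post , c) → ∀ l r → subset-word (insert c A) ≡ l ++ c ∷ r
      → Location (e , pre , A , post , c) (words pre ++ l) c (r ++ words post)
    locate {e} {pre} {A} {post} {c} ad l r eq = record
      { whole = total-split {c} {A} pre post l r eq
      ; min   = minimal-transfer (sym ∘ insertion-value I (words pre) (words post)) (sym (insertion-size I (words pre) (words post))) (min ad)
      ; left  = trans (decreasing-root₁ l c r (words post) decreasing) (cong (iv (words post)) iv-same)
      ; right = decreasing-root₂ l c r (words post) decreasing }
      where
      I : InsertionSplit c A l r
      I = insertion (fresh ad) (proper-at pre (proper ad)) l r eq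
      open InsertionSplit I
      iv-same : iv (l ++ r) (letter c) ≡ iv (subset-word A) (letter c)
      iv-same = injective (ev-affine (l ++ r)) (trans (ev-iv (l ++ r) _)
        (sym (trans (same-value _) (ev-iv (subset-word A) _))))

    place : ∀ {i} → Admissible i → ∃ λ xs → ∃ λ c → ∃ λ ys → Location i xs c ys
    place {e , pre , A , post , c} ad with insert-split {c} {A} (proper-at pre (proper ad))
    ... | l , r , eq = words pre ++ l , c , r ++ words post , locate ad l r eq

    position-of : ∀ {i} → Admissible i → ℕ
    position-of ad = length (proj₁ (place ad))

    position-split : ∀ {e pre A post c} (I : Admissible (e , pre , A , post , c)) → ∀ l r → subset-word (insert c A) ≡ l ++ c ∷ r
      → position-of I ≡ length (words pre ++ l)
    position-split {e} {pre} {A} {post} {c} I l r eq with insert-split {c} {A} (proper-at pre (proper I))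
    ... | l′ , r′ , eq′ = cong (λ l → length (words pre ++ l))
            (unique-left l′ l (subst Decreasing eq′ (subset-word-decreasing (insert c A))) (trans (sym eq′) eq))

    position-irrelevant : ∀ {i} (I J : Admissible i) → position-of I ≡ position-of J
    position-irrelevant {e , pre , A , post , c} I J with insert-split {c} {A} (proper-at pre (proper J))
    ... | l , r , eq = position-split I l r eq

    item-at : ∀ e Bs → All Proper Bs → sizes Bs ≡ a → ∀ xs c ys → words Bs ≡ xs ++ c ∷ ys → Minimal (Θ e) (xs ++ ys) y
      → ∃ λ i → Σ (Admissible i) λ I → sign i ≡ e × filled i ≡ Bs × Location i xs c ys × position-of I ≡ length xs
    item-at e Bs ps sz xs c ys eq M with split-words Bs xs eq
    ... | pre , B , post , l , r , refl , eB , refl , refl = i , ad , refl , refilled , locate ad l r eA , position-split ad l r eA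
      where
      A = remove c B
      i : Item
      i = e , pre , A , post , c
      c∈B : c ∈ˢ B
      c∈B = ∈-subset-word⁻ (subst (c ∈_) (sym eB) (∈P.∈-++⁺ʳ l (here refl)))
      full : insert c A ≡ B
      full = insert-remove {c} {B} c∈B
      refilled : filled i ≡ pre ++ B ∷ post
      refilled = cong (λ B → pre ++ B ∷ post) full
      eA : subset-word (insert c A) ≡ l ++ c ∷ r
      eA = trans (cong subset-word full) eB
      ps′ : All Proper (filled i)
      ps′ = subst (All Proper) (sym refilled) ps
      I : InsertionSplit c A l r
      I = insertion (∉-remove c B) (proper-at pre ps′) l r eA
      ad : Admissible i
      ad = record { fresh = ∉-remove c B ; proper = ps′ ; shape = trans (cong sizes refilled) sz
        ; min = minimal-transfer (insertion-value I (words pre) (words post)) (insertion-size I (words pre) (words post)) M }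

    item-unique : ∀ {i j} (I : Admissible i) (J : Admissible j) → sign i ≡ sign j → filled i ≡ filled j
      → position-of I ≡ position-of J → i ≡ j
    item-unique {e , pre , A , post , c} {.e , pre′ , A′ , post′ , c′} I J refl f len
      with insert-split {c} {A} (proper-at pre (proper I)) | insert-split {c′} {A′} (proper-at pre′ (proper J))
    ... | l , r , eq | l′ , r′ , eq′ with same-place pre pre′ f eq eq′ len
    ...   | refl , ins , refl , refl = cong (λ A → e , pre , A , post , c)
              (trans (sym (remove-insert {c} {A} (fresh I))) (trans (cong (remove c) ins) (remove-insert {c} {A′} (fresh J))))

    Partners : Item → Item → Set
    Partners i j = sign i ≡ sign j × filled i ≡ filled j × i ≢ j

    split-at : ∀ {i j} → sign i ≡ sign j → filled i ≡ filled j → (I : Admissible i) → MinimalSplit (Θ (sign j)) y (total j)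
    split-at {i} {j} e f I = minimal-split (trans (cong words (sym f)) (Location.whole ℓ)) (subst (λ e → Minimal (Θ e) _ y) e (Location.min ℓ))
      where
      ℓ = proj₂ (proj₂ (proj₂ (place I)))

    total-conjugates : ∀ {i} → Admissible i → Conjugates (Θ (sign i)) (ev (total i)) (target i)
    total-conjugates {i} I with place I
    ... | xs , c , ys , ℓ = conjugates-word (sym (Location.whole ℓ))
            (subst₂ (λ u v → Conjugates (Θ (sign i)) (ev (xs ++ c ∷ ys)) (twist y u v)) (Location.left ℓ) (Location.right ℓ)
              (conjugates-insert xs c ys (Minimal.conj (Location.min ℓ))))

    -- Otherwise i, i′ and j would mark three letters of one word, each of whose deletion leads to
    -- y.
    partners-injective : ∀ {i i′ j} → Admissible i → Admissible i′ → Admissible j → Partners i j → Partners i′ j → i ≡ i′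
    partners-injective {i} {i′} {j} I I′ J (e , f , ≢) (e′ , f′ , ≢′) with position-of I ℕ.≟ position-of I′
    ... | yes eq = item-unique I I′ (trans e (sym e′)) (trans f (sym f′)) eq
    ... | no neq = ⊥-elim (no-three-distinct-splits (total-conjugates J) (split-at e f I) (split-at e′ f′ I′) (split-at refl refl J)
            neq (λ p → ≢′ (item-unique I′ J e′ f′ p)) (λ p → ≢ (item-unique I J e f p)))

    Reduced-item : Item → Set
    Reduced-item i = Minimal (Θ (sign i)) (total i) (target i)

    partner-exists : ∀ {i} → Admissible i → Generic y (end true i) (end false i) → ¬ Reduced-item i
      → ∃ λ j → Admissible j × Partners i j
    partner-exists {i} I G ¬red = find (another-split (Θ-base (sign i)) xs c ys (Location.min ℓ)
        (subst₂ (Generic y) (sym (Location.left ℓ)) (sym (Location.right ℓ)) G)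
        (λ M → ¬red (minimal-word (sym (Location.whole ℓ))
          (subst₂ (λ u v → Minimal (Θ (sign i)) (xs ++ c ∷ ys) (twist y u v)) (Location.left ℓ) (Location.right ℓ) M))))
      where
      xs = proj₁ (place I)
      c  = proj₁ (proj₂ (place I))
      ys = proj₁ (proj₂ (proj₂ (place I)))
      ℓ : Location i xs c ys
      ℓ = proj₂ (proj₂ (proj₂ (place I)))
      find : (∃ λ (s : MinimalSplit (Θ (sign i)) y (xs ++ c ∷ ys)) → MinimalSplit.position s ≢ length xs) → ∃ λ j → Admissible j × Partners i j
      find (minimal-split {xs′} {ys′} {c′} sp M , ≢) with item-at (sign i) (filled i) (proper I) (shape I) xs′ c′ ys′ (trans (Location.whole ℓ) sp) M
      ... | j , J , e , f , ℓ′ , pos = j , J , sym e , sym f , λ { refl → ≢ (trans (sym pos) (position-irrelevant J I)) }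

    reversed-marks : ∀ {x z x′ z′} → Reversed y x z x′ z′ → (Marked x → Marked z′) × (Marked z → Marked x′)
      × (Marked z′ → Marked x) × (Marked x′ → Marked z)
    reversed-marks (flip k e f) = marked-~ (~-sym (k , e)) , marked-~ (~-sym (k , f)) , marked-~ (k , e) , marked-~ (k , f)
    reversed-marks (flip-image k e f) = (λ m → marked-~ (~-sym (k , e)) (marked-image m)) , (λ m → marked-~ (~-sym (k , f)) (marked-image m)) ,
      (λ m → marked-preimage (marked-~ (k , e) m)) , (λ m → marked-preimage (marked-~ (k , f) m))

    targets-agree : ∀ {i j} → Admissible i → Admissible j → sign i ≡ sign j → filled i ≡ filled j → target i ≗ target j
    targets-agree {i} {j} I J e f = conjugates-unique (total j)
      (subst₂ (λ s B → Conjugates (Θ s) (ev (words B)) (target i)) e f (total-conjugates I)) (total-conjugates J)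

    -- Partners have the same target, so `related` carries the ends of i to those of j by shifts,
    -- reversal and y, all of which preserve genericity.
    generic-partner : ∀ {i j} → Admissible i → Admissible j → Partners i j → Generic y (end true i) (end false i)
      → Generic y (end true j) (end false j)
    generic-partner {i} {j} I J (e , f , _) G = go (related Y G apart′ (targets-agree I J e f))
      where
      x = end true i
      z = end false i
      x′ = end true j
      z′ = end false j
      ℓ = proj₂ (proj₂ (proj₂ (place J)))
      apart′ : ¬ x′ ~ z′
      apart′ r = root-≁ (proj₁ (proj₂ (place J))) (proj₁ (proj₂ (proj₂ (place J)))) (~-trans (~-reflexive (Location.left ℓ)) (~-trans r (~-reflexive (sym (Location.right ℓ)))))
      transfer : ∀ {u v u′ v′} → Generic y u v → u ~ u′ → v ~ v′ → Generic y u′ v′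
      transfer (generic p r) m m′ = generic (λ o → p (~-trans m (~-trans o (~-sym m′))))
        (λ o → r (~-trans m′ (~-trans o (~-cong (affine Y) (~-sym m)))))
      go : Related y x z x′ z′ → Generic y x′ z′
      go (same k m m′) = transfer G (k , m) (k , m′)
      go (flip k m m′) = transfer (generic-sym Y G) (k , m′) (k , m)
      go (same-image k m m′) = transfer (generic-image Y G) (k , m) (k , m′)
      go (flip-image k m m′) = transfer (generic-sym Y (generic-image Y G)) (k , m′) (k , m)

    -- `splits-reversed` wants the earlier letter first. If j comes first, its genericity hypothesis
    -- is about j and is supplied by `generic-partner`.
    partner-marks : ∀ {i j} → Admissible i → Admissible j → Partners i j → Generic y (end true i) (end false i)
      → ∀ b → (Marked (end b i) → Marked (end (not b) j)) × (Marked (end (not b) j) → Marked (end b i))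
    partner-marks {i} {j} I J P@(e , f , ≢) G = marks (ℕ.<-cmp (position-of I) (position-of J))
      where
      ℓ = proj₂ (proj₂ (proj₂ (place I)))
      ℓ′ = proj₂ (proj₂ (proj₂ (place J)))
      M′ : Minimal (Θ (sign i)) _ y
      M′ = subst (λ s → Minimal (Θ s) _ y) (sym e) (Location.min ℓ′)
      whole′ : total i ≡ _
      whole′ = trans (cong words f) (Location.whole ℓ′)
      Goal : Set
      Goal = ∀ b → (Marked (end b i) → Marked (end (not b) j)) × (Marked (end (not b) j) → Marked (end b i))
      marks : _ → Goal
      marks (tri≈ _ eq _) = ⊥-elim (≢ (item-unique I J e f eq))
      marks (tri< lt _ _) = λ { true → proj₁ R , proj₁ (proj₂ (proj₂ R)) ; false → proj₁ (proj₂ R) , proj₂ (proj₂ (proj₂ R)) }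
        where
        R = reversed-marks (subst₂ (Reversed y (end true i) (end false i)) (Location.left ℓ′) (Location.right ℓ′)
          (subst₂ (λ u v → Reversed y u v _ _) (Location.left ℓ) (Location.right ℓ)
          (ordered-splits-reversed (Θ-base (sign i)) (total i) _ _ _ _ _ _ (Location.whole ℓ) whole′ lt (Location.min ℓ) M′ (total-conjugates I)
            (subst₂ (Generic y) (sym (Location.left ℓ)) (sym (Location.right ℓ)) G))))
      marks (tri> _ _ gt) = λ { true → proj₂ (proj₂ (proj₂ R)) , proj₁ (proj₂ R) ; false → proj₁ (proj₂ (proj₂ R)) , proj₁ R }
        where
        R = reversed-marks (subst₂ (Reversed y (end true j) (end false j)) (Location.left ℓ) (Location.right ℓ)
          (subst₂ (λ u v → Reversed y u v _ _) (Location.left ℓ′) (Location.right ℓ′)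
          (ordered-splits-reversed (Θ-base (sign i)) (total i) _ _ _ _ _ _ whole′ (Location.whole ℓ) gt M′ (Location.min ℓ) (total-conjugates I)
            (subst₂ (Generic y) (sym (Location.left ℓ′)) (sym (Location.right ℓ′)) (generic-partner I J P G)))))

    -- The marked set is a union of residue classes stable under y, so a marked and an unmarked
    -- integer are neither congruent nor matched by y.
    generic-marked : ∀ b {i} → Marked (end b i) → ¬ Marked (end (not b) i) → Generic y (end true i) (end false i)
    generic-marked true m ¬m = generic (λ r → ¬m (marked-~ (~-sym r) m)) (λ r → ¬m (marked-~ r (marked-image m)))
    generic-marked false m ¬m = generic (λ r → ¬m (marked-~ r m)) (λ r → ¬m (marked-preimage (marked-~ (~-sym r) m)))

    -- Exchanging c for the neighbouring missing generator turns a marked left end into a marked right end.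
    SlideTo : Bool → Item → Item → Set
    SlideTo b (e , pre , A , post , c) (e′ , pre′ , A′ , post′ , c′) =
      e ≡ e′ × pre ≡ pre′ × A ≡ A′ × post ≡ post′ × end b (e , pre , A , post , c) ~ end (not b) (e′ , pre′ , A′ , post′ , c′)

    slide-injective : ∀ b {i i′ j} → SlideTo b i j → SlideTo b i′ j → i ≡ i′
    slide-injective true {e , pre , A , post , c} {j = _} (refl , refl , refl , refl , r) (refl , refl , refl , refl , r′) =
      cong (λ c → e , pre , A , post , c) (letter-injective (~-cancel (iv-affine (subset-word A)) (~-cancel (iv-affine (words post)) (~-trans r (~-sym r′)))))
    slide-injective false {e , pre , A , post , c} {j = _} (refl , refl , refl , refl , r) (refl , refl , refl , refl , r′) =
      cong (λ c → e , pre , A , post , c) (letter-injective (~-cancel-+ (+ 1) (~-cancel (iv-affine (words post)) (~-trans r (~-sym r′)))))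

    replace-letter : ∀ {e pre A post c} c′ → Admissible (e , pre , A , post , c) → c′ ∉ˢ A → Admissible (e , pre , A , post , c′)
    replace-letter {e} {pre} {A} {post} {c} c′ I c′∉ = record
      { fresh = c′∉ ; min = min I
      ; proper = All.++⁺ (All.++⁻ˡ pre (proper I)) (pr ∷ All.tail (All.++⁻ʳ pre (proper I)))
      ; shape = trans same-sizes (shape I) }
      where
      pr : Proper (insert c′ A)
      pr with c Fin.≟ c′
      ... | yes refl = proper-at pre (proper I)
      -- The generator c itself, once replaced, is missing from the new factor.
      ... | no c≢c′ = c , trans (insert-other A c≢c′) (fresh I)
      same-sizes : sizes (pre ++ insert c′ A ∷ post) ≡ sizes (pre ++ insert c A ∷ post)
      same-sizes = trans (L.map-++ _ pre _) (trans (cong (λ k → sizes pre ++ k ∷ sizes post)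
        (trans (length-insert-word c′∉ pr) (sym (length-insert-word (fresh I) (proper-at pre (proper I)))))) (sym (L.map-++ _ pre _)))

    -- Writing A also for the product of the subset, a left end is matched by c′ = A⁻¹(c) - 1 and a
    -- right end by c′ = A(c + 1), modulo n. Both choices are missing from A because A(x) is a
    -- missing generator exactly when x - 1 is.
    slide-exists : ∀ b {i} → Admissible i → ∃ λ j → Admissible j × SlideTo b i j
    slide-exists true {e , pre , A , post , c} I = (e , pre , A , post , c′) , replace-letter c′ I c′∉ ,
        refl , refl , refl , refl , ~-cong (iv-affine (words post)) (~-pred (~-sym (letter-res (x - + 1))))
      where
      x = iv (subset-word A) (letter c)
      c′ = res (x - + 1)
      c∉w : ¬ c ∈ subset-word A
      c∉w m = ∈ˢ-∉ˢ {A = A} (∈-subset-word⁻ m) (fresh I)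
      c′∉ : c′ ∉ˢ A
      c′∉ = ¬∈ˢ⇒∉ˢ {A = A} λ m → missing-next (subset-word-decreasing A) {x}
        (subst (λ r → ¬ r ∈ subset-word A) (sym (trans (cong res (ev-iv (subset-word A) (letter c))) (res-letter c))) c∉w)
        (∈-subset-word⁺ (c , fresh I) m)
    slide-exists false {e , pre , A , post , c} I = (e , pre , A , post , c′) , replace-letter c′ I c′∉ ,
        refl , refl , refl , refl , ~-cong (iv-affine (words post)) (~-trans (~-reflexive (sym (iv-ev (subset-word A) x)))
          (~-cong (iv-affine (subset-word A)) (~-sym (letter-res (ev (subset-word A) x)))))
      where
      x = letter c + + 1
      c′ = res (ev (subset-word A) x)
      c∉w : ¬ c ∈ subset-word A
      c∉w m = ∈ˢ-∉ˢ {A = A} (∈-subset-word⁻ m) (fresh I)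
      c′∉ : c′ ∉ˢ A
      c′∉ = ¬∈ˢ⇒∉ˢ {A = A} λ m → next-missing (subset-word-decreasing A) {x}
        (subst (λ r → ¬ r ∈ subset-word A) (sym (~-res {x - + 1} {c} (pred-~ ~-refl))) c∉w)
        (∈-subset-word⁺ (c , fresh I) m)

  -- Finite lists of items and the comparison of their lengths.

  module Enumerate (2∣n : 2 ℕD.∣ n) {y : ℤ → ℤ} (Y : FPF y) (p q : ℤ) (yp : y p ≡ q) (a : List ℕ) where
    open Bases 2∣n
    open Count 2∣n Y p q yp a

    _≟-Item_ : (i j : Item) → Dec (i ≡ j)
    _≟-Item_ = ×.≡-dec Bool._≟_ (×.≡-dec (L.≡-dec _≟-Subset_) (×.≡-dec _≟-Subset_ (×.≡-dec (L.≡-dec _≟-Subset_) Fin._≟_)))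
      where
      _≟-Subset_ : (A B : Subset) → Dec (A ≡ B)
      _≟-Subset_ = V.≡-dec Bool._≟_

    opaque
      candidates : List Item
      candidates = L.cartesianProduct bools (L.cartesianProduct (lists (vectors n) (length a))
        (L.cartesianProduct (vectors n) (L.cartesianProduct (lists (vectors n) (length a)) (L.allFin n))))

      universe : List Item
      universe = L.deduplicate _≟-Item_ candidates

      universe-unique : AllPairs _≢_ universe
      universe-unique = UniqueD.deduplicate-! _≟-Item_ candidates

      ∈-universe : ∀ {i} → Admissible i → i ∈ universe
      ∈-universe {e , pre , A , post , c} I = ∈P.∈-deduplicate⁺ _≟-Item_ (∈P.∈-cartesianProduct⁺ (∈-bools e)
          (∈P.∈-cartesianProduct⁺ (∈-lists ∈-vectors (length a) pre pre≤)
            (∈P.∈-cartesianProduct⁺ (∈-vectors A) (∈P.∈-cartesianProduct⁺ (∈-lists ∈-vectors (length a) post post≤) (∈P.∈-allFin c)))))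
        where
        len : length pre ℕ.+ suc (length post) ≡ length a
        len = trans (sym (L.length-++ pre)) (trans (sym (L.length-map _ (pre ++ insert c A ∷ post))) (cong length (Admissible.shape I)))
        pre≤ : length pre ℕ.≤ length a
        pre≤ = subst (length pre ℕ.≤_) len (ℕ.m≤m+n _ _)
        post≤ : length post ℕ.≤ length a
        post≤ = subst (length post ℕ.≤_) len (ℕ.≤-trans (ℕ.n≤1+n _) (ℕ.m≤n+m _ _))

    Θ-affine : ∀ e → Affine (Θ e)
    Θ-affine e = affine (base-fpf (Θ-base e))

    opaque
      admissible? : ∀ i → Dec (Admissible i)
      admissible? i@(e , pre , A , post , c) = map′
        (λ (f , pr , sh , m) → record { fresh = f ; proper = pr ; shape = sh ; min = m })
        (λ I → Admissible.fresh I , Admissible.proper I , Admissible.shape I , Admissible.min I)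
        ((V.lookup A c Bool.≟ false) ×-dec (All.all? proper? (filled i) ×-dec
          (L.≡-dec ℕ._≟_ (sizes (filled i)) a ×-dec minimal? (Θ-affine e) (affine Y) (deleted i))))

    opaque
      marked? : ∀ v → Dec (Marked v)
      marked? v = (v ~? p) ⊎-dec (v ~? q)

    Good : Bool → Item → Set
    Good b i = Admissible i × Marked (end b i)

    good? : ∀ b i → Dec (Good b i)
    good? b i = admissible? i ×-dec marked? (end b i)

    target-affine : ∀ {i} → Admissible i → Affine (target i)
    target-affine {i} I = affine (fpf-conjugate (total i) (base-fpf (Θ-base (sign i))) (total-conjugates I))

    Reduced-good : Item → Set
    Reduced-good i = Admissible i × Reduced-item i

    opaque
      reduced? : ∀ i → Dec (Reduced-good i)
      reduced? i with admissible? i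
      ... | no ¬I = no (¬I ∘ proj₁)
      ... | yes I = map′ (I ,_) proj₂ (minimal? (Θ-affine (sign i)) (target-affine I) (total i))

    other? : ∀ b i → Dec (Marked (end (not b) i))
    other? b i = marked? (end (not b) i)

    good both single reduced unreduced : Bool → List Item
    good b      = L.filter (good? b) universe
    both b      = L.filter (other? b) (good b)
    single b    = L.filter (λ i → ¬? (other? b i)) (good b)
    reduced b   = L.filter reduced? (single b)
    unreduced b = L.filter (λ i → ¬? (reduced? i)) (single b)

    not-not : ∀ b → not (not b) ≡ b
    not-not true = refl
    not-not false = refl

    good-unique : ∀ b → AllPairs _≢_ (good b)
    good-unique b = AllPairs.filter⁺ (good? b) universe-unique

    single-unique : ∀ b → AllPairs _≢_ (single b)
    single-unique b = AllPairs.filter⁺ (λ i → ¬? (other? b i)) (good-unique b)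

    ∈-good⁺ : ∀ b {i} → Good b i → i ∈ good b
    ∈-good⁺ b G = ∈P.∈-filter⁺ (good? b) (∈-universe (proj₁ G)) G

    ∈-good⁻ : ∀ b {i} → i ∈ good b → Good b i
    ∈-good⁻ b m = proj₂ (∈P.∈-filter⁻ (good? b) {xs = universe} m)

    Single : Bool → Item → Set
    Single b i = Good b i × ¬ Marked (end (not b) i)

    ∈-single⁺ : ∀ b {i} → Single b i → i ∈ single b
    ∈-single⁺ b (G , m) = ∈P.∈-filter⁺ (λ i → ¬? (other? b i)) (∈-good⁺ b G) m

    ∈-single⁻ : ∀ b {i} → i ∈ single b → Single b i
    ∈-single⁻ b m with ∈P.∈-filter⁻ (λ i → ¬? (other? b i)) {xs = good b} m
    ... | m′ , ¬o = ∈-good⁻ b m′ , ¬o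

    both-≤ : ∀ b → length (both b) ℕ.≤ length (both (not b))
    both-≤ b = related-length _≡_ (λ e e′ → trans e (sym e′)) (both (not b)) (AllPairs.filter⁺ (other? b) (good-unique b)) λ {i} m → i , move m , refl
      where
      move : ∀ {i} → i ∈ both b → i ∈ both (not b)
      move {i} m with ∈P.∈-filter⁻ (other? b) {xs = good b} m
      ... | m′ , o = ∈P.∈-filter⁺ (other? (not b)) (∈-good⁺ (not b) (proj₁ (∈-good⁻ b m′) , o))
                       (subst (λ c → Marked (end c i)) (sym (not-not b)) (proj₂ (∈-good⁻ b m′)))

    slide-marked : ∀ b i j → SlideTo b i j → end b i ~ end (not b) j
    slide-marked b (e , pre , A , post , c) (e′ , pre′ , A′ , post′ , c′) (_ , _ , _ , _ , r) = r

    good-≤ : ∀ b → length (good b) ℕ.≤ length (good (not b))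
    good-≤ b = related-length (SlideTo b) (slide-injective b) (good (not b)) (good-unique b) move
      where
      move : ∀ {i} → i ∈ good b → ∃ λ j → j ∈ good (not b) × SlideTo b i j
      move {i} m = go (slide-exists b (proj₁ (∈-good⁻ b m)))
        where
        go : (∃ λ j → Admissible j × SlideTo b i j) → ∃ λ j → j ∈ good (not b) × SlideTo b i j
        go (j , J , S) = j , ∈-good⁺ (not b) (J , marked-~ (~-sym (slide-marked b i j S)) (proj₂ (∈-good⁻ b m))) , S

    unreduced-≤ : ∀ b → length (unreduced b) ℕ.≤ length (unreduced (not b))
    unreduced-≤ b = related-length R inj (unreduced (not b)) (AllPairs.filter⁺ (λ i → ¬? (reduced? i)) (single-unique b)) move
      where
      R : Item → Item → Set
      R i j = Admissible i × Admissible j × Partners i j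
      inj : ∀ {i i′ j} → R i j → R i′ j → i ≡ i′
      inj (I , J , P) (I′ , _ , P′) = partners-injective I I′ J P P′
      partner : ∀ {i} → Single b i → ¬ Reduced-good i → (∃ λ j → Admissible j × Partners i j)
        → ∃ λ j → j ∈ unreduced (not b) × R i j
      partner {i} ((I , o) , ¬o) ¬red (j , J , P) =
          j , ∈P.∈-filter⁺ (λ i → ¬? (reduced? i)) (∈-single⁺ (not b) ((J , proj₁ (marks b) o) , λ h → ¬o (proj₂ (marks (not b)) h))) ¬red′ , (I , J , P)
        where
        marks : ∀ b → (Marked (end b i) → Marked (end (not b) j)) × (Marked (end (not b) j) → Marked (end b i))
        marks = partner-marks I J P (generic-marked b {i} o ¬o)
        ¬red′ : ¬ Reduced-good j
        ¬red′ (_ , M) = ¬red (I , minimal-≗ (sym ∘ targets-agree I J (proj₁ P) (proj₁ (proj₂ P)))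
          (subst₂ (λ s Bs → Minimal (Θ s) (words Bs) (target j)) (sym (proj₁ P)) (sym (proj₁ (proj₂ P))) M))
      move : ∀ {i} → i ∈ unreduced b → ∃ λ j → j ∈ unreduced (not b) × R i j
      move {i} m = partner S ¬red (partner-exists (proj₁ (proj₁ S)) (generic-marked b {i} (proj₂ (proj₁ S)) (proj₂ S)) (λ r → ¬red (proj₁ (proj₁ S) , r)))
        where
        filtered : i ∈ single b × ¬ Reduced-good i
        filtered = ∈P.∈-filter⁻ (λ i → ¬? (reduced? i)) {xs = single b} m
        S : Single b i
        S = ∈-single⁻ b (proj₁ filtered)
        ¬red : ¬ Reduced-good i
        ¬red = proj₂ filtered

    -- Every comparison is proved uniformly in b, so its two instances already give equality and no
    -- inverse map is constructed.
    both-directions : (f : Bool → List Item) → (∀ b → length (f b) ℕ.≤ length (f (not b))) → length (f true) ≡ length (f false)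
    both-directions f h = ℕ.≤-antisym (h true) (h false)

    -- `good` is the disjoint union of `both`, `reduced` and `unreduced`. Sliding equates `good`,
    -- identity equates `both`, and partners equate `unreduced`; the rest is cancellation.
    reduced-equal : length (reduced true) ≡ length (reduced false)
    reduced-equal = ℕ.+-cancelʳ-≡ (length (unreduced true)) _ _
      (trans (sym (length-filter-split reduced? (single true)))
        (trans single-equal (trans (length-filter-split reduced? (single false))
          (cong (length (reduced false) ℕ.+_) (sym (both-directions unreduced unreduced-≤))))))
      where
      single-equal : length (single true) ≡ length (single false)
      single-equal = ℕ.+-cancelˡ-≡ (length (both true)) _ _
        (trans (sym (length-filter-split (other? true) (good true)))
          (trans (both-directions good good-≤) (trans (length-filter-split (other? false) (good false))
            (cong (ℕ._+ length (single false)) (sym (both-directions both both-≤))))))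

    ∈-reduced⁺ : ∀ b {i} → Single b i → Reduced-item i → i ∈ reduced b
    ∈-reduced⁺ b S M = ∈P.∈-filter⁺ reduced? (∈-single⁺ b S) (proj₁ (proj₁ S) , M)

    ∈-reduced⁻ : ∀ b {i} → i ∈ reduced b → Single b i × Reduced-item i
    ∈-reduced⁻ b {i} m = ∈-single⁻ b (proj₁ filtered) , proj₂ (proj₂ filtered)
      where
      filtered : i ∈ single b × Reduced-good i
      filtered = ∈P.∈-filter⁻ reduced? {xs = single b} m

    reduced-unique : ∀ b → AllPairs _≢_ (reduced b)
    reduced-unique b = AllPairs.filter⁺ reduced? (single-unique b)

  -- Reduced items as terms of the coefficient of x^a.

  module Terms (2∣n : 2 ℕD.∣ n) {y : ℤ → ℤ} (y-perm : IsFPF n y) (p q : ℤ) (yp : y p ≡ q) (a : List ℕ) where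
    open Bases 2∣n

    Y : FPF y
    Y = fpf-from-IsFPF y-perm

    open Count 2∣n Y p q yp a
    open Enumerate 2∣n Y p q yp a

    yq : y q ≡ p
    yq = trans (cong y (sym yp)) (involutive Y p)

    Π : Bool → (ℤ → ℤ) → Set
    Π true  = Πp n y q
    Π false = Πm n y p

    side : Bool → ℤ → ℤ → ℤ
    side true  u v = u
    side false u v = v

    anchor : Bool → ℤ
    anchor true  = q
    anchor false = p

    -- A common form for the two cover sets: Π⁺(y,q) fixes the smaller index at q, and Π⁻(y,p) fixes
    -- the larger index at p.
    record Raising (b : Bool) (z : ℤ → ℤ) (u v : ℤ) : Set where
      field
        increasing : u < v
        distinct   : Generic y u v
        anchored   : side b u v ≡ anchor b
        covers     : CoversVia n y z u v
    open Raising

    Π⇒raising : ∀ b {z} → Π b z → IsFPF n z × ∃₂ λ u v → Raising b z u v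
    Π⇒raising true (F , j , q<j , j≁q , j≁yq , cov) = F , q , j , record
      { increasing = q<j ; distinct = generic (λ r → j≁q (~⇒∣ (~-sym r))) (j≁yq ∘ ~⇒∣) ; anchored = refl ; covers = cov }
    Π⇒raising false (F , i , i<p , i≁p , i≁yp , cov) = F , i , p , record
      { increasing = i<p ; distinct = generic (i≁p ∘ ~⇒∣) (λ r → i≁yp (~⇒∣ (~-sym (transpose Y r)))) ; anchored = refl ; covers = cov }

    raising⇒Π : ∀ b {z u v} → IsFPF n z → Raising b z u v → Π b z
    raising⇒Π true {u = u} {v} F record { increasing = u<v ; distinct = G ; anchored = refl ; covers = cov } =
      F , v , u<v , (λ d → apart G (~-sym (∣⇒~ d))) , (λ d → unpaired G (∣⇒~ d)) , cov
    raising⇒Π false {u = u} {v} F record { increasing = u<v ; distinct = G ; anchored = refl ; covers = cov } =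
      F , u , u<v , (λ d → apart G (∣⇒~ d)) , (λ d → unpaired (generic-sym Y G) (∣⇒~ d)) , cov

    twist-is-t : ∀ u v → twist y u v ≗ t n u v ∘ y ∘ t n u v
    twist-is-t u v x = trans (swap-is-t u v _) (cong (t n u v ∘ y) (swap-is-t u v x))

    twist-shift : ∀ {u v} → ¬ u ~ v → ∀ k → twist y (u + k * N) (v + k * N) ≗ twist y u v
    twist-shift {u} {v} d k x = trans (swap-shift d k _) (cong (swap u v ∘ y) (swap-shift d k x))

    generic-shift : ∀ {u v} k → Generic y u v → Generic y (u + k * N) (v + k * N)
    generic-shift {u} {v} k (generic a b) = generic (λ r → a (~-trans (~-sym (~-shift k)) (~-trans r (~-shift k))))
      (λ r → b (~-trans (~-sym (~-shift k)) (~-trans r (~-cong (affine Y) (~-shift k)))))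

    end-side : ∀ b i → end b i ≡ side b (end true i) (end false i)
    end-side true i = refl
    end-side false i = refl

    side-shift : ∀ b u v c → side b (u + c) (v + c) ≡ side b u v + c
    side-shift true u v c = refl
    side-shift false u v c = refl

    side-image : ∀ b u v → side b (y u) (y v) ≡ y (side b u v)
    side-image true u v = refl
    side-image false u v = refl

    marked-anchor : ∀ b {w} → Marked w → w ~ anchor b ⊎ y w ~ anchor b
    marked-anchor true (inj₁ m) = inj₂ (~-trans (~-cong (affine Y) m) (~-reflexive yp))
    marked-anchor true (inj₂ m) = inj₁ m
    marked-anchor false (inj₁ m) = inj₁ m
    marked-anchor false (inj₂ m) = inj₂ (~-trans (~-cong (affine Y) m) (~-reflexive yq))

    anchored-marked : ∀ b {u v} → side b u v ≡ anchor b → Marked (side b u v)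
    anchored-marked true refl = inj₂ ~-refl
    anchored-marked false refl = inj₁ ~-refl

    anchored-other : ∀ b {u v} → Generic y u v → side b u v ≡ anchor b → ¬ Marked (side (not b) u v)
    anchored-other true G refl (inj₁ m) = unpaired G (~-trans m (~-reflexive (sym yq)))
    anchored-other true G refl (inj₂ m) = apart G (~-sym m)
    anchored-other false G refl (inj₁ m) = apart G m
    anchored-other false G refl (inj₂ m) = unpaired (generic-sym Y G) (~-trans m (~-reflexive (sym yp)))

    record Anchored (b : Bool) (z : ℤ → ℤ) : Set where
      field
        {u v} : ℤ
        u<v : u < v
        gen : Generic y u v
        at  : side b u v ≡ anchor b
        eq  : z ≗ twist y u v

    anchor-shift : ∀ b {z x w} → x < w → Generic y x w → z ≗ twist y x w → side b x w ~ anchor b → Anchored b z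
    anchor-shift b {z} {x} {w} lt G e (k , s) = record
      { u<v = ℤ.+-monoˡ-< ((- k) * N) lt ; gen = generic-shift (- k) G
      ; at = trans (side-shift b x w ((- k) * N)) (sym (shift-back k s))
      ; eq = λ v → trans (e v) (sym (twist-shift (apart G) (- k) v)) }

    -- A marked end lying in the other of the two classes is brought to the anchor by applying y to
    -- the pair. The twist stays the same by `twist-image`, and y x < y w keeps the pair increasing.
    anchor-pair : ∀ b {z x w} → x < w → y x < y w → Generic y x w → z ≗ twist y x w → Marked (side b x w) → Anchored b z
    anchor-pair b {z} {x} {w} lt lt′ G e m = go (marked-anchor b m)
      where
      go : side b x w ~ anchor b ⊎ y (side b x w) ~ anchor b → Anchored b z
      go (inj₁ r) = anchor-shift b lt G e r
      go (inj₂ r) = anchor-shift b lt′ (generic-image Y G) (λ v → trans (e v) (sym (twist-image Y G v)))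
        (~-trans (~-reflexive (side-image b x w)) r)

    base-length : ∀ e → ¬ ¬ ∃ (Length (Θ e))
    base-length e none = length-exists (map res (θ e)) (sym ∘ Θ-word e) λ (k , ℓ , _) → none (k , ℓ)

    covers-if : ∀ e {ws us z u v} → Minimal (Θ e) us y → Minimal (Θ e) ws z → length ws ≡ suc (length us)
      → z ≗ twist y u v → CoversVia n y z u v
    covers-if e {ws} {us} {z} {u} {v} M M′ len eq = (λ x → trans (eq x) (twist-is-t u v x)) , λ k m ℓy ℓz →
      Dec.decidable-stable (m ℕ.≟ k ℕ.+ 2) λ ≢ → base-length e λ (k₀ , ℓ) → ≢ (begin
        m  ≡⟨ length-unique (λ _ → refl) (Len⇒length ℓz) (length-minimal (Θ-base e) ℓ ws M′) ⟩
        k₀ ℕ.+ 2 ℕ.* length ws  ≡⟨ cong (λ l → k₀ ℕ.+ 2 ℕ.* l) len ⟩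
        k₀ ℕ.+ 2 ℕ.* suc (length us)  ≡⟨ lem k₀ (length us) ⟩
        (k₀ ℕ.+ 2 ℕ.* length us) ℕ.+ 2  ≡⟨ cong (ℕ._+ 2) (length-unique (λ _ → refl) (length-minimal (Θ-base e) ℓ us M) (Len⇒length ℓy)) ⟩
        k ℕ.+ 2  ∎)
      where
      open ≡-Reasoning
      lem : ∀ k l → k ℕ.+ 2 ℕ.* (1 ℕ.+ l) ≡ k ℕ.+ 2 ℕ.* l ℕ.+ 2
      lem = ℕR.solve-∀

    covers-length : ∀ e {ws us z u v} → Minimal (Θ e) us y → Minimal (Θ e) ws z → CoversVia n y z u v
      → ¬ ¬ (length ws ≡ suc (length us))
    covers-length e {ws} {us} M M′ (_ , cov) ≢ = base-length e λ (k₀ , ℓ) → ≢ (ℕ.*-cancelˡ-≡ _ _ 2 (ℕ.+-cancelˡ-≡ k₀ _ _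
        (trans (cov _ _ (length⇒Len (length-minimal (Θ-base e) ℓ us M)) (length⇒Len (length-minimal (Θ-base e) ℓ ws M′)))
          (sym (lem k₀ (length us))))))
      where
      lem : ∀ k l → k ℕ.+ 2 ℕ.* (1 ℕ.+ l) ≡ k ℕ.+ 2 ℕ.* l ℕ.+ 2
      lem = ℕR.solve-∀

    factors : List Subset → List (ℤ → ℤ)
    factors = map (ev ∘ subset-word)

    triple : Item → Triple
    triple i = target i , ev (total i) , factors (filled i)

    -- Spelling z out as the word ws⁻¹ θ ws makes `ev-perm` available, in particular for the sum
    -- condition.
    conjugate-perm : ∀ e {z} ws → Conjugates (Θ e) (ev ws) z → IsFPF n z
    conjugate-perm e {z} ws C = perm-≗ same-perm (ev-perm (reverse ws ++ map res (θ e) ++ ws)) , involutive F ,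
        λ x r → fixfree F x (~-reflexive r)
      where
      F : FPF z
      F = fpf-conjugate ws (base-fpf (Θ-base e)) C
      same-perm : ev (reverse ws ++ map res (θ e) ++ ws) ≗ z
      same-perm x = begin
        ev (reverse ws ++ map res (θ e) ++ ws) x  ≡⟨ trans (ev-++ (reverse ws) _ x) (cong (ev (reverse ws)) (ev-++ (map res (θ e)) ws x)) ⟩
        ev (reverse ws) (ev (map res (θ e)) (ev ws x))     ≡⟨ iv-reverse ws _ ⟨
        iv ws (ev (map res (θ e)) (ev ws x))  ≡⟨ cong (iv ws) (Θ-word e (ev ws x)) ⟨
        iv ws (Θ e (ev ws x))  ≡⟨ cong (iv ws) (commutes C x) ⟩
        iv ws (ev ws (z x))  ≡⟨ iv-ev ws (z x) ⟩
        z x  ∎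
        where open ≡-Reasoning

    Θ-choice : ∀ e → Θ e ≗ Θ⁺ n ⊎ Θ e ≗ Θ⁻ n
    Θ-choice true = inj₁ λ _ → refl
    Θ-choice false = inj₂ λ _ → refl

    minimal-atom : ∀ e {ws z} → Minimal (Θ e) ws z → IsAtom n z (ev ws)
    minimal-atom e {ws} {z} (minimal C least′) = Θ e , Θ-choice e , (ev-perm ws , commutes C) , bound
      where
      bound : ∀ v → Conj n (Θ e) v z → ∀ k m → Len n (ev ws) k → Len n v m → k ℕ.≤ m
      bound v (_ , c) k m ℓ ℓ′ = ℕ.≤-trans (least (Len⇒length ℓ) ws (λ _ → refl))
        (subst (length ws ℕ.≤_) (size L′) (least′ (word L′) (conjugates-≗ (sym ∘ value L′) (λ _ → refl) (conjugates c))))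
        where
        L′ : Length v m
        L′ = Len⇒length ℓ′

    minimal⇒reduced : ∀ {e ws z} → Minimal (Θ e) ws z → Reduced ws
    minimal⇒reduced M ws′ r = minimal-reduced {ws′ = ws′} M r

    product-factors : ∀ Bs → product (factors Bs) ≗ ev (words Bs)
    product-factors [] x = refl
    product-factors (B ∷ Bs) x = trans (cong (ev (subset-word B)) (product-factors Bs x)) (sym (ev-++ (subset-word B) (words Bs) x))

    length-words : ∀ Bs → length (words Bs) ≡ sum (sizes Bs)
    length-words [] = refl
    length-words (B ∷ Bs) = trans (L.length-++ (subset-word B)) (cong (length (subset-word B) ℕ.+_) (length-words Bs))

    factors-cyclic : ∀ Bs → Reduced (words Bs) → Pointwise (λ f k → CycDec n f × Len n f k) (factors Bs) (sizes Bs)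
    factors-cyclic [] _ = []
    factors-cyclic (B ∷ Bs) red = (decreasing⇒CycDec (subset-word-decreasing B) head-reduced , length⇒Len (reduced-length {subset-word B} head-reduced))
        ∷ factors-cyclic Bs (reduced-middle (subset-word B) (words Bs) [] (subst (λ w → Reduced (subset-word B ++ w)) (sym (L.++-identityʳ (words Bs))) red))
      where
      head-reduced : Reduced (subset-word B)
      head-reduced = reduced-middle [] (subset-word B) (words Bs) red

    factorization : ∀ {Bs} → sizes Bs ≡ a → Reduced (words Bs) → IsFactorization n (ev (words Bs)) a (factors Bs)
    factorization {Bs} refl red = factors-cyclic Bs red , product-factors Bs ,
      subst (Len n (ev (words Bs))) (length-words Bs) (length⇒Len (reduced-length {words Bs} red))

    total-length : ∀ {i} → Admissible i → length (total i) ≡ suc (length (deleted i))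
    total-length {e , pre , A , post , c} I = begin
      length (words (pre ++ insert c A ∷ post))  ≡⟨ cong length (words-++ pre (insert c A ∷ post)) ⟩
      length (words pre ++ subset-word (insert c A) ++ words post)  ≡⟨ trans (L.length-++ (words pre)) (cong (length (words pre) ℕ.+_) (L.length-++ (subset-word (insert c A)))) ⟩
      length (words pre) ℕ.+ (length (subset-word (insert c A)) ℕ.+ length (words post))
        ≡⟨ cong (λ k → length (words pre) ℕ.+ (k ℕ.+ length (words post))) (length-insert-word {c} {A} (Admissible.fresh I) (proper-at pre (Admissible.proper I))) ⟩
      length (words pre) ℕ.+ suc (length (subset-word A) ℕ.+ length (words post)) ≡⟨ ℕ.+-suc (length (words pre)) _ ⟩
      suc (length (words pre) ℕ.+ (length (subset-word A) ℕ.+ length (words post)))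
        ≡⟨ cong suc (trans (L.length-++ (words pre)) (cong (length (words pre) ℕ.+_) (L.length-++ (subset-word A)))) ⟨
      suc (length (words pre ++ subset-word A ++ words post))  ∎
      where open ≡-Reasoning

    ends-positive : ∀ {i} → Admissible i → Reduced-item i → end true i < end false i
    ends-positive {i} I M = subst₂ _<_ (Location.left ℓ) (Location.right ℓ)
      (root-positive _ (proj₁ (proj₂ (place I))) _ (minimal-word (Location.whole ℓ) M))
      where
      ℓ = proj₂ (proj₂ (proj₂ (place I)))

    -- If y reversed the ends, `twisted-exchange` would give `target i` a word shorter than
    -- `deleted i`, although the minimal word `total i` is longer than `deleted i`.
    ends-image-positive : ∀ {i} → Admissible i → Reduced-item i → Generic y (end true i) (end false i) → y (end true i) < y (end false i)
    ends-image-positive {i} I M G with ℤ.<-cmp (y (end true i)) (y (end false i))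
    ... | tri< lt _ _ = lt
    ... | tri≈ _ e _ = ⊥-elim (apart G (~-reflexive (injective (affine Y) e)))
    ... | tri> _ _ gt = ⊥-elim (too-short (twisted-exchange (deleted i) (Θ-base (sign i)) (Minimal.conj (Admissible.min I)) G (ends-positive I M) gt))
      where
      too-short : ¬ TwistedDeletion (Θ (sign i)) (deleted i) (target i)
      too-short (twisted-deletion {us} {vs} {c} e C) = ℕ.<-irrefl refl (ℕ.<-≤-trans
        (ℕ.s≤s (ℕ.≤-trans (ℕ.n≤1+n _) (ℕ.≤-reflexive (sym (trans (cong length e) (length-insert us c vs))))))
        (ℕ.≤-trans (ℕ.≤-reflexive (sym (total-length I))) (Minimal.least M (us ++ vs) C)))

    sound : ∀ b {i} → i ∈ reduced b → CoeffTerm n (Π b) a (triple i)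
    sound b {i} m = member , minimal-atom (sign i) M , factorization (Admissible.shape I) (minimal⇒reduced {sign i} {total i} M)
      where
      S : Single b i
      S = proj₁ (∈-reduced⁻ b m)
      M : Reduced-item i
      M = proj₂ (∈-reduced⁻ b m)
      I : Admissible i
      I = proj₁ (proj₁ S)
      G : Generic y (end true i) (end false i)
      G = generic-marked b {i} (proj₂ (proj₁ S)) (proj₂ S)
      A : Anchored b (target i)
      A = anchor-pair b (ends-positive I M) (ends-image-positive I M G) G (λ _ → refl) (subst Marked (end-side b i) (proj₂ (proj₁ S)))
      member : Π b (target i)
      member = raising⇒Π b (conjugate-perm (sign i) (total i) (total-conjugates I)) record
        { increasing = Anchored.u<v A ; distinct = Anchored.gen A ; anchored = Anchored.at A
        ; covers = covers-if (sign i) (Admissible.min I) M (total-length I) (Anchored.eq A) }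

    factors-injective : ∀ {Bs Cs} → All Proper Bs → All Proper Cs → Pointwise _≗_ (factors Bs) (factors Cs) → Bs ≡ Cs
    factors-injective {[]} {[]} _ _ _ = refl
    factors-injective {B ∷ Bs} {C ∷ Cs} (P ∷ Ps) (Q ∷ Qs) (e ∷ es) = cong₂ _∷_ (subset-word-injective P Q e) (factors-injective Ps Qs es)

    -- A word w and z determine Θ = w z w⁻¹, and `Θ-distinct` separates the two signs.
    sign-determined : ∀ e e′ {z z′} ws → z ≗ z′ → Conjugates (Θ e) (ev ws) z → Conjugates (Θ e′) (ev ws) z′ → e ≡ e′
    sign-determined e e′ {z} {z′} ws eq C C′ = go e e′ same-base
      where
      same-base : Θ e ≗ Θ e′
      same-base x = begin
        Θ e x  ≡⟨ cong (Θ e) (ev-iv ws x) ⟨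
        Θ e (ev ws (iv ws x))     ≡⟨ commutes C (iv ws x) ⟩
        ev ws (z (iv ws x))  ≡⟨ cong (ev ws) (eq (iv ws x)) ⟩
        ev ws (z′ (iv ws x))      ≡⟨ commutes C′ (iv ws x) ⟨
        Θ e′ (ev ws (iv ws x))    ≡⟨ cong (Θ e′) (ev-iv ws x) ⟩
        Θ e′ x  ∎
        where open ≡-Reasoning
      go : ∀ e e′ → Θ e ≗ Θ e′ → e ≡ e′
      go true true _ = refl
      go false false _ = refl
      go true false r = ⊥-elim (Θ-distinct r)
      go false true r = ⊥-elim (Θ-distinct (sym ∘ r))

    -- The factors give back the subsets, and z with the word gives back the sign. The distinguished
    -- letter is recovered because a minimal total has only one letter whose deletion leads to y.
    triple-injective : ∀ {i j} → Admissible i → Reduced-item i → Admissible j → triple i ≈T triple j → i ≡ j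
    triple-injective {i} {j} I M J (e₁ , e₂ , e₃) = item-unique I J es fs positions
      where
      fs : filled i ≡ filled j
      fs = factors-injective (Admissible.proper I) (Admissible.proper J) e₃
      es : sign i ≡ sign j
      es = sign-determined (sign i) (sign j) (total j) e₁ (conjugates-≗ e₂ (λ _ → refl) (total-conjugates I)) (total-conjugates J)
      M′ : Minimal (Θ (sign j)) (total j) (target i)
      M′ = subst₂ (λ s Bs → Minimal (Θ s) (words Bs) (target i)) es fs M
      positions : position-of I ≡ position-of J
      positions with ℕ.<-cmp (position-of I) (position-of J)
      ... | tri≈ _ e _ = e
      ... | tri< lt _ _ = ⊥-elim (unique-split M′ (split-at es fs I) (split-at refl refl J) lt)
      ... | tri> _ _ gt = ⊥-elim (unique-split M′ (split-at refl refl J) (split-at es fs I) gt)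

    distinct-triples : ∀ b → AllPairs (λ u v → ¬ (u ≈T v)) (map triple (reduced b))
    distinct-triples b = AllPairs.map⁺ (pairs (reduced b) (reduced-unique b) (λ m → m))
      where
      pairs : ∀ xs → AllPairs _≢_ xs → (∀ {i} → i ∈ xs → i ∈ reduced b) → AllPairs (λ i j → ¬ (triple i ≈T triple j)) xs
      pairs [] [] _ = []
      pairs (i ∷ xs) (≢s ∷ us) sub = All.tabulate (λ {j} m e → All.lookup ≢s m (inj (sub (here refl)) (sub (there m)) e)) ∷ pairs xs us (sub ∘ there)
        where
        inj : ∀ {i j} → i ∈ reduced b → j ∈ reduced b → triple i ≈T triple j → i ≡ j
        inj m m′ = triple-injective (proj₁ (proj₁ (proj₁ (∈-reduced⁻ b m)))) (proj₂ (∈-reduced⁻ b m)) (proj₁ (proj₁ (proj₁ (∈-reduced⁻ b m′))))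

    -- Every term of the coefficient comes from a reduced item.

    record Encoding (π : ℤ → ℤ) (fs : List (ℤ → ℤ)) (ks : List ℕ) : Set where
      field
        subsets : List Subset
        proper  : All Proper subsets
        shape   : sizes subsets ≡ ks
        factor≗ : Pointwise _≗_ fs (factors subsets)
        product≗ : product fs ≗ ev (words subsets)

    encode : ∀ {π fs ks} → Pointwise (λ f k → CycDec n f × Len n f k) fs ks → Encoding π fs ks
    encode [] = record { subsets = [] ; proper = [] ; shape = refl ; factor≗ = [] ; product≗ = λ _ → refl }
    encode {π} {f ∷ fs} {k ∷ ks} ((cd , ℓ) ∷ ps) = go (CycDec⇒decreasing cd ℓ)
      where
      E : Encoding π fs ks
      E = encode ps
      open Encoding E
      go : (∃ λ ws → Decreasing ws × ev ws ≗ f × length ws ≡ k) → Encoding π (f ∷ fs) (k ∷ ks)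
      go (ws , d , e , len) = record
        { subsets = B ∷ subsets ; proper = decreasing-proper d ∷ proper
        ; shape = cong₂ _∷_ (trans (proj₂ (letters-word d)) len) shape
        ; factor≗ = f≗ ∷ factor≗
        ; product≗ = λ x → trans (f≗ (product fs x)) (trans (cong (ev (subset-word B)) (product≗ x)) (sym (ev-++ (subset-word B) (words subsets) x))) }
        where
        B = letters-subset ws
        f≗ : f ≗ ev (subset-word B)
        f≗ x = trans (sym (e x)) (sym (proj₁ (letters-word d) x))

    atom-sign : ∀ {z π} → IsAtom n z π → ∃ λ e → Conjugates (Θ e) π z
      × (∀ v → IsAffPerm n v → Conjugates (Θ e) v z → ∀ k m → Len n π k → Len n v m → k ℕ.≤ m)
    atom-sign (T , inj₁ T≗ , (_ , c) , m) = true , conjugates (λ x → trans (sym (T≗ _)) (c x)) ,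
      λ v V C → m v (V , λ x → trans (T≗ _) (commutes C x))
    atom-sign (T , inj₂ T≗ , (_ , c) , m) = false , conjugates (λ x → trans (sym (T≗ _)) (c x)) ,
      λ v V C → m v (V , λ x → trans (T≗ _) (commutes C x))

    atom-minimal : ∀ {e z π W} → Conjugates (Θ e) π z → π ≗ ev W → Len n π (length W)
      → (∀ v → IsAffPerm n v → Conjugates (Θ e) v z → ∀ k m → Len n π k → Len n v m → k ℕ.≤ m) → Minimal (Θ e) W z
    atom-minimal {e} {z} {π} {W} C eq ℓ m = minimal (conjugates-≗ eq (λ _ → refl) C) λ ws C′ →
      Dec.decidable-stable (length W ℕ.≤? length ws) λ ≰ → length-exists ws (λ _ → refl) λ (k , ℓ′ , k≤) →
        ≰ (ℕ.≤-trans (m (ev ws) (ev-perm ws) C′ _ _ ℓ (length⇒Len ℓ′)) k≤)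

    module Completeness (b : Bool) {e : Bool} {z : ℤ → ℤ} {W : Word} (M : Minimal (Θ e) W z) {u v : ℤ} (R : Raising b z u v) where
      u<v : u < v
      u<v = increasing R
      G : Generic y u v
      G = distinct R

      z≗ : z ≗ twist y u v
      z≗ x = trans (proj₁ (covers R) x) (sym (twist-is-t u v x))

      -- Appending a word for t_{uv} to W conjugates the same Θ to y. The covering condition then
      -- fixes the length of the minimal words for y.
      minimal-y : ¬ ¬ (∃ λ us → Minimal (Θ e) us y × length W ≡ suc (length us))
      minimal-y none = go (swap-word (apart G) u<v)
        where
        go : ¬ (∃ λ ws → ev ws ≗ swap u v)
        go (ws , w) = minimal-exists (W ++ ws) (conjugates-≗ (λ _ → refl) (λ x → trans (twist-≗ z≗ x) (twist-involutive {y} (apart G) x))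
            (conjugates-twist (apart G) (Minimal.conj M) (λ x → trans (ev-++ W ws x) (cong (ev W) (w x)))))
          λ (us , M′) → covers-length e M′ M (covers R) λ len → none (us , M′ , len)

      image-increasing : y u < y v
      image-increasing with ℤ.<-cmp (y u) (y v)
      ... | tri< lt _ _ = lt
      ... | tri≈ _ eq _ = ⊥-elim (apart G (~-reflexive (injective (affine Y) eq)))
      ... | tri> _ _ gt = ⊥-elim (minimal-y λ (us , M′ , len) → too-short us len (twisted-exchange us (Θ-base e) (Minimal.conj M′) G u<v gt))
        where
        too-short : ∀ us → length W ≡ suc (length us) → ¬ TwistedDeletion (Θ e) us (twist y u v)
        too-short us len (twisted-deletion {xs} {ys} {c} refl C) = ℕ.<-irrefl refl (ℕ.<-≤-trans
          (subst (length (xs ++ ys) ℕ.<_) (sym len) (ℕ.s≤s (ℕ.≤-trans (ℕ.n≤1+n _) (ℕ.≤-reflexive (sym (length-insert xs c ys))))))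
          (Minimal.least M (xs ++ ys) (conjugates-≗ (λ _ → refl) (sym ∘ z≗) C)))

      exchanged : TwistedDeletion (Θ e) W (twist (twist y u v) u v)
      exchanged = twisted-exchange W (Θ-base e) (conjugates-≗ (λ _ → refl) z≗ (Minimal.conj M)) (generic-twist Y G) u<v
        (subst₂ _<_ (sym (twist-right Y G)) (sym (twist-left Y G)) image-increasing)

      deleted-minimal : ∀ xs c ys → W ≡ xs ++ c ∷ ys → Conjugates (Θ e) (ev (xs ++ ys)) y → Minimal (Θ e) (xs ++ ys) y
      deleted-minimal xs c ys refl C = minimal C λ ws C′ → Dec.decidable-stable (length (xs ++ ys) ℕ.≤? length ws) λ ≰ →
        minimal-y λ (us , M′ , len) → ≰ (subst (ℕ._≤ length ws) (sym (ℕ.suc-injective (trans (sym (length-insert xs c ys)) len))) (Minimal.least M′ ws C′))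

      -- (u , v), (y u , y v) and (x , w) are all increasing, so the flipped cases cannot occur and
      -- left ends correspond to left ends. This is how the anchored index shows up at the correct
      -- end of the item.
      side-related : ∀ {x w} → Related y u v x w → x < w → ∀ b → side b u v ~ side b x w ⊎ y (side b u v) ~ side b x w
      side-related (same k r s) _ true = inj₁ (k , r)
      side-related (same k r s) _ false = inj₁ (k , s)
      side-related (same-image k r s) _ true = inj₂ (k , r)
      side-related (same-image k r s) _ false = inj₂ (k , s)
      side-related (flip k r s) x<w _ = ⊥-elim (ℤ.<-asym x<w (shift-cancel-< k (subst₂ _<_ r s u<v)))
      side-related (flip-image k r s) x<w _ = ⊥-elim (ℤ.<-asym x<w (shift-cancel-< k (subst₂ _<_ r s image-increasing)))

      marked-related : ∀ {w w′} → w ~ w′ ⊎ y w ~ w′ → (Marked w → Marked w′) × (Marked w′ → Marked w)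
      marked-related (inj₁ r) = marked-~ (~-sym r) , marked-~ r
      marked-related (inj₂ r) = (λ m → marked-~ (~-sym r) (marked-image m)) , (λ m → marked-preimage (marked-~ r m))

      found : ∀ Bs → All Proper Bs → sizes Bs ≡ a → W ≡ words Bs → ∃ λ i → i ∈ reduced b × filled i ≡ Bs × z ≗ target i
      found Bs pr sh refl = from-split exchanged
        where
        Goal : Set
        Goal = ∃ λ i → i ∈ reduced b × filled i ≡ Bs × z ≗ target i
        from-item : (i : Item) → Admissible i → sign i ≡ e → filled i ≡ Bs → Goal
        from-item i I refl refl = i , ∈-reduced⁺ b ((I , here-marked) , other-unmarked) M′ , refl , agree
          where
          agree : z ≗ target i
          agree = conjugates-unique (total i) (Minimal.conj M) (total-conjugates I)
          M′ : Reduced-item i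
          M′ = minimal-≗ agree M
          ends-apart : ¬ end true i ~ end false i
          ends-apart r = root-≁ (proj₁ (proj₂ (place I))) (proj₁ (proj₂ (proj₂ (place I))))
            (~-trans (~-reflexive (Location.left ℓ)) (~-trans r (~-reflexive (sym (Location.right ℓ)))))
            where
            ℓ = proj₂ (proj₂ (proj₂ (place I)))
          rel : ∀ b → side b u v ~ side b (end true i) (end false i) ⊎ y (side b u v) ~ side b (end true i) (end false i)
          rel = side-related (related Y G ends-apart (λ x → trans (sym (z≗ x)) (agree x))) (ends-positive I M′)
          here-marked : Marked (end b i)
          here-marked = subst Marked (sym (end-side b i)) (proj₁ (marked-related (rel b)) (anchored-marked b (anchored R)))
          other-unmarked : ¬ Marked (end (not b) i)
          other-unmarked m = anchored-other b G (anchored R) (proj₂ (marked-related (rel (not b))) (subst Marked (end-side (not b) i) m))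
        from-split : TwistedDeletion (Θ e) W (twist (twist y u v) u v) → Goal
        from-split (twisted-deletion {xs} {ys} {c} sp C) = use (item-at e Bs pr sh xs c ys sp
            (deleted-minimal xs c ys sp (conjugates-≗ (λ _ → refl) (twist-involutive {y} (apart G)) C)))
          where
          use : (∃ λ i → Σ (Admissible i) λ I → sign i ≡ e × filled i ≡ Bs × Location i xs c ys × position-of I ≡ length xs) → Goal
          use (i , I , es , fs , _) = from-item i I es fs

    listed : ∀ b {z π fs Bs} i → i ∈ reduced b → filled i ≡ Bs → z ≗ target i → π ≗ ev (words Bs)
      → Pointwise _≗_ fs (factors Bs) → Any ((z , π , fs) ≈T_) (map triple (reduced b))
    listed b {z} {π} {fs} i m refl e₁ e₂ e₃ = Any.map⁺ (Any.map at m)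
      where
      at : ∀ {j} → i ≡ j → (z , π , fs) ≈T triple j
      at refl = e₁ , e₂ , e₃

    complete-encoded : ∀ b {e z π fs u v} → Raising b z u v → (E : Encoding π fs a) → let open Encoding E in
      Minimal (Θ e) (words subsets) z → π ≗ ev (words subsets) → Any ((z , π , fs) ≈T_) (map triple (reduced b))
    complete-encoded b {e} {z} {π} {fs} R record { subsets = Bs ; proper = pr ; shape = sh ; factor≗ = f≗ } M π≗ =
      go (Completeness.found b {e} M R Bs pr sh refl)
      where
      go : (∃ λ i → i ∈ reduced b × filled i ≡ Bs × z ≗ target i) → Any ((z , π , fs) ≈T_) (map triple (reduced b))
      go (i , m , eq , z≗) = listed b i m eq z≗ π≗ f≗

    encoded-minimal : ∀ {e z π fs} (E : Encoding π fs a) → product fs ≗ π → Len n π (sum a) → Conjugates (Θ e) π z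
      → (∀ v → IsAffPerm n v → Conjugates (Θ e) v z → ∀ k m → Len n π k → Len n v m → k ℕ.≤ m)
      → Minimal (Θ e) (words (Encoding.subsets E)) z × π ≗ ev (words (Encoding.subsets E))
    encoded-minimal {e} {π = π} record { subsets = Bs ; shape = sh ; product≗ = pr } prod len C m =
        atom-minimal {e} C π≗ (subst (Len n π) (sym (trans (length-words Bs) (cong sum sh))) len) m , π≗
      where
      π≗ : π ≗ ev (words Bs)
      π≗ x = trans (sym (prod x)) (pr x)

    complete : ∀ b τ → CoeffTerm n (Π b) a τ → Any (τ ≈T_) (map triple (reduced b))
    complete b (z , π , fs) (mem , atom , (cyc , prod , len)) = go (encode cyc) (proj₂ (Π⇒raising b mem)) (atom-sign atom)
      where
      go : Encoding π fs a → (∃₂ λ u v → Raising b z u v) → (∃ λ e → Conjugates (Θ e) π z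
        × (∀ v → IsAffPerm n v → Conjugates (Θ e) v z → ∀ k m → Len n π k → Len n v m → k ℕ.≤ m))
        → Any ((z , π , fs) ≈T_) (map triple (reduced b))
      go E (u , v , R) (e , C , m) = complete-encoded b {e} R E (proj₁ M) (proj₂ M)
        where
        M : Minimal (Θ e) (words (Encoding.subsets E)) z × π ≗ ev (words (Encoding.subsets E))
        M = encoded-minimal {e} E prod len C m

    card : ∀ b → HasCard (CoeffTerm n (Π b) a) (length (reduced b))
    card b = map triple (reduced b) , L.length-map triple (reduced b) , All.map⁺ (All.tabulate (sound b)) , distinct-triples b , complete b

open import Defs
open import Data.Nat using (ℕ; _≤_)
open import Data.Nat.Divisibility using (_∣_)
open import Data.Integer using (ℤ; _<_)
open import Data.List using (List; length)
open import Data.Product using (∃; _×_; _,_)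
open import Data.Bool using (true; false)
open import Relation.Binary.PropositionalEquality using (_≡_; subst)

-- The power series are compared monomial by monomial: for the exponent list `a` both coefficients
-- are cardinalities, listed without repetition by `card`, and `reduced-equal` identifies them.
theorem5p8 : (n : ℕ) → 2 ≤ n → 2 ∣ n → (y : ℤ → ℤ) → IsFPF n y
    → (p q : ℤ) → p < q → y p ≡ q
    → (a : List ℕ)
    → ∃ λ N → HasCard (CoeffTerm n (Πm n y p) a) N × HasCard (CoeffTerm n (Πp n y q) a) N
theorem5p8 n 2≤n 2∣n y y-fpf p q _ yp a =
  length (reduced false) , card false , subst (HasCard (CoeffTerm n (Πp n y q) a)) reduced-equal (card true)
  where
  open Reflections n 2≤n
  open Terms 2∣n y-fpf p q yp a
  open Enumerate 2∣n Y p q yp a
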